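{- Assume $\mathcal J$ is countable. Let $S$ be a sorted complete system having the co-sorted embedding property. For each finitely generated sorted complete system $S'$ fix a nice finite presystem $X_{S'}$ generating $S'$. Then $\mathrm{Th}(S)$ is axiomatized by $$SCS_{SEP}\ \cup\ \{\exists\bar x\,\theta_{X_{S'}}(\bar x): S'\in\mathrm{coFSIm}(S)\}\ \cup\ \{\neg\exists\bar x\,\theta_{X_{S'}}(\bar x): S'\notin\mathrm{coFSIm}(S)\},$$ where $S'$ ranges over finitely generated sorted complete systems.
   Context: Fix a set $\mathcal J$ (of "sorts"). $\mathbb N$ is the set of positive integers and $\mathcal J^{<\mathbb N}=\bigcup_{n\in\mathbb N}\mathcal J^n$. For $J=(j_1,\dots,j_n)$ put $\|J\|=\{j_1,\dots,j_n\}$ and $\sqrt J=\{J'\in\mathcal J^{<\mathbb N}:\|J\|\subseteq\|J'\|\}$; $J^\frown J'$ is concatenation. Fix an arbitrary function $J^*_\subseteq:\mathbb N\times\mathcal J^{<\mathbb N}\to\mathcal J^{<\mathbb N}$ and put $J^*_\cap(J,J')=J^\frown J'$. For a profinite group $G$, $\mathcal N(G)$ is the set of open normal subgroups. A sorting data on $G$ is a family $F=\{F(N):N\in\mathcal N(G)\}$ of non-empty subsets of $\mathcal J^{<\mathbb N}$ such that: (i) $F(G)=\mathcal J^{<\mathbb N}$; (ii) $J\in F(N)\Leftrightarrow\sqrt J\subseteq F(N)$; (iii) if $N_1\subseteq N_2$, $[G:N_1]\le k$ and $J\in F(N_1)$, then $J^*_\subseteq(k,J)\in F(N_2)$; (iv)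 if $J_1\in F(N_1)$, $J_2\in F(N_2)$, then $J^*_\cap(J_1,J_2)\in F(N_1\cap N_2)$. The pair $(G,F)$ is a sorted profinite group. The many-sorted language $\mathcal L_{SCS}(\mathcal J)$ has sorts $m(k,J)$ for $(k,J)\in\mathbb N\times\mathcal J^{<\mathbb N}$ (elements of different sorts are regarded as distinct), binary relations $\le_{k,k',J,J'}$, $C_{k,k',J,J'}$ on $m(k,J)\times m(k',J')$ and ternary relations $P_{k,J}$ on $m(k,J)$. The sorted complete system $\mathcal S(G,F)$ of $(G,F)$ is the structure with $m(k,J)=\bigcup\{G/N\times\{k\}:N\in\mathcal N(G),[G:N]\le k,J\in F(N)\}$; $(gN,k)\le(g'N',k')$ iff $k\ge k'$ and $N\subseteq N'$; $C((gN,k),(g'N',k'))$ iff $k\ge k'$ and $gN\subseteq g'N'$; $P_{k,J}((g_1N,k),(g_2N,k),(g_3N,k))$ iff $g_3N=g_1g_2N$ (same $N$). $SCS$ is the first-order $\mathcal L_{SCS}(\mathcal J)$-theory whose models are exactly the structures isomorphic to some $\mathcal S(G,F)$; its models are called sorted complete systems. For an element $a=(gN,k)$ of $S\cong\mathcal S(G,F)$ write $N_a=N$. A subsystem of $S$ is a substructure that is a model of $SCS$; for $X\subseteq S$, $S_X$ is the smallest subsystem containing $X$ (generated by $X$); a sorted complete system is finitely generated if it is generated by a finite subset. $S$ has the co-sorted embedding property (co-SEP) if for all finitely generated subsystems $S_1,S_2\subseteq S$ and all $\mathcal L_{SCS}(\mathcal J)$-embeddings $\Pi:S_2\to S_1$,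 $\Phi:S_2\to S_2$ there is an embedding $\Psi:S_1\to S$ with $\Psi\circ\Pi=\iota\circ\Phi$, where $\iota:S_2\to S$ is the inclusion. $SCS_{SEP}$ is the first-order theory of the sorted complete systems having co-SEP. $\mathrm{coFSIm}(S)$ is the set of isomorphism classes of finitely generated subsystems of $S$; $S'\in\mathrm{coFSIm}(S)$ means that $S'$ is isomorphic to a finitely generated subsystem of $S$. A nice finite presystem generating $S'$ is a finite subset $X$ of $S'$ generating $S'$ such that $m(k,J)(S')\subseteq X$ whenever $X\cap m(k,J)(S')\ne\emptyset$, and such that for every $s\in S'$ there is $x\in X$ with $N_x\subseteq N_s$. For such $X$, $\theta_X(\bar x)$ is a first-order formula, in variables $\bar x=(x_e)_{e\in X}$ of the corresponding sorts, expressing the following: in a model $S''$ of $SCS$, a tuple $\bar c=(c_e)_{e\in X}$ satisfies $\theta_X$ iff the map $e\mapsto c_e$ extends to an isomorphism of $S'$ onto a subsystem of $S''$ (such a formula exists).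
   Formalization: Subsystems and embeddings are also required to preserve and reflect N_a ⊆ N_b for all pairs of elements, not only when k ≥ k'; with bare substructures and embeddings the smallest subsystem S_X and the formula θ_X need not exist (e.g. G = Z/2 with F(1) = F(G) all of J^{<N}). -}

module Defs where

open import Level using (Lift; _⊔_) renaming (suc to lsuc)
open import Algebra.Bundles using (Group)
import Algebra.Properties.Group as GroupProperties
open import Data.Empty.Polymorphic using (⊥)
open import Data.Fin.Base using (Fin)
open import Data.List.Base using (List; []; _∷_)
open import Data.List.Membership.Propositional renaming (_∈_ to _∈ₗ_)
open import Data.List.NonEmpty.Base using (List⁺; toList; _⁺++⁺_)
import Data.List.Relation.Binary.Subset.Propositional as Sublist
open import Data.List.Relation.Unary.All as All using (All)
open import Data.List.Relation.Unary.Any using (Any)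
open import Data.Nat.Base using (ℕ; NonZero; _≥_)
open import Data.Product.Base using (Σ; ∃; ∃-syntax; Σ-syntax; _×_; _,_; proj₁; proj₂)
open import Data.Sum.Base using (_⊎_)
open import Data.Unit.Polymorphic using (⊤; tt)
open import Function.Bundles using (_⇔_; mk⇔)
open import Function.Base using (_∘_)
open import Relation.Binary.Bundles using (Setoid)
open import Relation.Binary.Core using (REL)
open import Relation.Binary.Definitions using (_Respects_)
open import Relation.Nullary.Negation.Core using (¬_)
open import Relation.Unary using (Pred; _∈_; _⊆_; _≐_; _∩_; _∪_; _≬_; ⋃)

-- A topology on a setoid.  Families of open sets are indexed by types of
-- the level of the space; as a union of open sets is the union of a family
-- indexed by its points, this loses nothing classically.
record Topology {ℓ} (A : Setoid ℓ ℓ) : Set (lsuc ℓ) where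
  open Setoid A using (Carrier; _≈_)
  field
    Open         : Pred (Pred Carrier ℓ) ℓ
    open-≐       : ∀ {U V} → U ≐ V → Open U → Open V
    open-respect : ∀ {U} → Open U → U Respects _≈_
    open-⊤       : Open (λ _ → ⊤)
    open-∩       : ∀ {U V} → Open U → Open V → Open (U ∩ V)
    open-⋃       : ∀ {I : Set ℓ} (U : I → Pred Carrier ℓ) →
                   (∀ i → Open (U i)) → Open (⋃ I U)

  Compact : Set (lsuc ℓ)
  Compact = ∀ {I : Set ℓ} (U : I → Pred Carrier ℓ) → (∀ i → Open (U i)) →
            (∀ x → ∃[ i ] x ∈ U i) →
            ∃[ is ] (∀ x → Any (λ i → x ∈ U i) is)

  Hausdorff : Set (lsuc ℓ)
  Hausdorff = ∀ x y → ¬ x ≈ y →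
              ∃[ U ] ∃[ V ] Open U × Open V × x ∈ U × y ∈ V × ¬ (U ≬ V)

  Connected : Pred Carrier ℓ → Set (lsuc ℓ)
  Connected C = ∀ U V → Open U → Open V → C ⊆ U ∪ V →
                C ≬ U → C ≬ V → C ≬ (U ∩ V)

  TotallyDisconnected : Set (lsuc ℓ)
  TotallyDisconnected = ∀ C → Connected C → ∀ {x y} → x ∈ C → y ∈ C → x ≈ y

record ProfiniteGroup ℓ : Set (lsuc ℓ) where
  field
    group    : Group ℓ ℓ
  open Group group public
  field
    topology : Topology setoid
  open Topology topology public
  field
    ∙-continuous : ∀ {U} → Open U → ∀ x y → (x ∙ y) ∈ U →
                   ∃[ V ] ∃[ W ] Open V × Open W × x ∈ V × y ∈ W ×
                     (∀ {v w} → v ∈ V → w ∈ W → (v ∙ w) ∈ U)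
    ⁻¹-continuous : ∀ {U} → Open U → Open (U ∘ _⁻¹)
    compact             : Compact
    hausdorff           : Hausdorff
    totallyDisconnected : TotallyDisconnected

module _ {ℓ} (G : ProfiniteGroup ℓ) where
  open ProfiniteGroup G

  record OpenNormalSubgroup : Set (lsuc ℓ) where
    field
      mem       : Pred Carrier ℓ
      isOpen    : Open mem
      ε-mem     : ε ∈ mem
      ∙-mem     : ∀ {x y} → x ∈ mem → y ∈ mem → (x ∙ y) ∈ mem
      ⁻¹-mem    : ∀ {x} → x ∈ mem → (x ⁻¹) ∈ mem
      conj-mem  : ∀ g {x} → x ∈ mem → (g ∙ x ∙ g ⁻¹) ∈ mem

module _ {ℓ} {G : ProfiniteGroup ℓ} where
  open ProfiniteGroup G
  open OpenNormalSubgroup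

  infixr 7 _∩ᴺ_
  infix  8 _·_

  whole : OpenNormalSubgroup G
  whole = record
    { mem = λ _ → ⊤ ; isOpen = open-⊤ ; ε-mem = tt ; ∙-mem = λ _ _ → tt
    ; ⁻¹-mem = λ _ → tt ; conj-mem = λ _ _ → tt }

  _∩ᴺ_ : OpenNormalSubgroup G → OpenNormalSubgroup G → OpenNormalSubgroup G
  N ∩ᴺ N′ = record
    { mem      = mem N ∩ mem N′
    ; isOpen   = open-∩ (isOpen N) (isOpen N′)
    ; ε-mem    = ε-mem N , ε-mem N′
    ; ∙-mem    = λ (p , p′) (q , q′) → ∙-mem N p q , ∙-mem N′ p′ q′
    ; ⁻¹-mem   = λ (p , p′) → ⁻¹-mem N p , ⁻¹-mem N′ p′
    ; conj-mem = λ g (p , p′) → conj-mem N g p , conj-mem N′ g p′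
    }

  _·_ : Carrier → OpenNormalSubgroup G → Pred Carrier ℓ
  (g · N) x = (g ⁻¹ ∙ x) ∈ mem N

  -- [G : N] ≤ k: some k cosets of N exhaust G.
  Index≤ : OpenNormalSubgroup G → ℕ → Set ℓ
  Index≤ N k = Σ[ r ∈ (Fin k → Carrier) ] (∀ g → ∃[ i ] g ∈ r i · N)

  ·-self : ∀ N g → g ∈ g · N
  ·-self N g = open-respect (isOpen N) (sym (inverseˡ g)) (ε-mem N)

  ·-⊆ : ∀ N {x y} → y ∈ x · N → y · N ⊆ x · N
  ·-⊆ N {x} {y} p {z} q = open-respect (isOpen N) eq (∙-mem N p q)
    where
    open GroupProperties group
    eq : (x ⁻¹ ∙ y) ∙ (y ⁻¹ ∙ z) ≈ x ⁻¹ ∙ z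
    eq = trans (assoc _ _ _) (∙-congˡ (\\-leftDividesˡ y z))

  ·-mul : ∀ N {x x′ y y′} → x′ ∈ x · N → y′ ∈ y · N → (x′ ∙ y′) ∈ (x ∙ y) · N
  ·-mul N {x} {x′} {y} {y′} p q =
    open-respect (isOpen N) eq (∙-mem N (conj-mem N (y ⁻¹) p) q)
    where
    open GroupProperties group
    open import Relation.Binary.Reasoning.Setoid setoid
    eq : (y ⁻¹ ∙ (x ⁻¹ ∙ x′) ∙ y ⁻¹ ⁻¹) ∙ (y ⁻¹ ∙ y′) ≈ (x ∙ y) ⁻¹ ∙ (x′ ∙ y′)
    eq = begin
      (y ⁻¹ ∙ (x ⁻¹ ∙ x′) ∙ y ⁻¹ ⁻¹) ∙ (y ⁻¹ ∙ y′)    ≈⟨ assoc _ _ _ ⟩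
      (y ⁻¹ ∙ (x ⁻¹ ∙ x′)) ∙ (y ⁻¹ ⁻¹ ∙ (y ⁻¹ ∙ y′))  ≈⟨ ∙-congˡ (\\-leftDividesʳ (y ⁻¹) y′) ⟩
      (y ⁻¹ ∙ (x ⁻¹ ∙ x′)) ∙ y′                       ≈⟨ ∙-congʳ (assoc _ _ _) ⟨
      ((y ⁻¹ ∙ x ⁻¹) ∙ x′) ∙ y′                       ≈⟨ assoc _ _ _ ⟩
      (y ⁻¹ ∙ x ⁻¹) ∙ (x′ ∙ y′)                       ≈⟨ ∙-congʳ (⁻¹-anti-homo-∙ x y) ⟨
      (x ∙ y) ⁻¹ ∙ (x′ ∙ y′)                          ∎

  ·-product-⊆ : ∀ N N′ {x x′ y y′} → mem N ⊆ mem N′ → x ∈ x′ · N′ → y ∈ y′ · N′ →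
                (x ∙ y) · N ⊆ (x′ ∙ y′) · N′
  ·-product-⊆ N N′ N⊆N′ p q z∈ = ·-⊆ N′ (·-mul N′ p q) (N⊆N′ z∈)

record ℕ⁺ : Set where
  constructor pos
  field
    value       : ℕ
    .{{nonZero}} : NonZero value

open ℕ⁺ public using (value)

-- 𝒥 is the set of sorts, List⁺ 𝒥 is 𝒥^{<ℕ}, and J*⊆ is the function J*_⊆.
module Sorted {ℓ} (𝒥 : Set ℓ) (J*⊆ : ℕ⁺ → List⁺ 𝒥 → List⁺ 𝒥) where

  √_ : List⁺ 𝒥 → Pred (List⁺ 𝒥) ℓ
  (√ J) J′ = toList J Sublist.⊆ toList J′

  J*∩ : List⁺ 𝒥 → List⁺ 𝒥 → List⁺ 𝒥
  J*∩ J J′ = J ⁺++⁺ J′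

  record SortingData (G : ProfiniteGroup ℓ) : Set (lsuc ℓ) where
    open OpenNormalSubgroup
    field
      F          : OpenNormalSubgroup G → Pred (List⁺ 𝒥) ℓ
      F-respects : ∀ {N N′} → mem N ≐ mem N′ → F N ⊆ F N′
      nonEmpty   : ∀ N → ∃[ J ] J ∈ F N
      F-whole    : ∀ J → J ∈ F whole
      F-√        : ∀ N J → J ∈ F N ⇔ √ J ⊆ F N
      F-⊆        : ∀ N₁ N₂ k J → mem N₁ ⊆ mem N₂ → Index≤ N₁ (value k) →
                   J ∈ F N₁ → J*⊆ k J ∈ F N₂
      F-∩        : ∀ N₁ N₂ J₁ J₂ → J₁ ∈ F N₁ → J₂ ∈ F N₂ →
                   J*∩ J₁ J₂ ∈ F (N₁ ∩ᴺ N₂)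

  Sort : Set ℓ
  Sort = ℕ⁺ × List⁺ 𝒥

  -- Sorts are interpreted by setoids, since the cosets gN of the standard
  -- structures below have no canonical representatives.
  record Structure c e : Set (lsuc (c ⊔ e) ⊔ ℓ) where
    field
      m : Sort → Setoid c e

    ∣_∣ : Sort → Set c
    ∣ s ∣ = Setoid.Carrier (m s)

    infix 4 _≈_

    _≈_ : ∀ {s} → ∣ s ∣ → ∣ s ∣ → Set e
    _≈_ {s} = Setoid._≈_ (m s)

    field
      LE  : ∀ {s t} → REL ∣ s ∣ ∣ t ∣ e
      C   : ∀ {s t} → REL ∣ s ∣ ∣ t ∣ e
      P   : ∀ {s} → ∣ s ∣ → ∣ s ∣ → ∣ s ∣ → Set e
      LE-resp : ∀ {s t} {a a′ : ∣ s ∣} {b b′ : ∣ t ∣} →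
                a ≈ a′ → b ≈ b′ → LE a b → LE a′ b′
      C-resp  : ∀ {s t} {a a′ : ∣ s ∣} {b b′ : ∣ t ∣} →
                a ≈ a′ → b ≈ b′ → C a b → C a′ b′
      P-resp  : ∀ {s} {a a′ b b′ d d′ : ∣ s ∣} →
                a ≈ a′ → b ≈ b′ → d ≈ d′ → P a b d → P a′ b′ d′

  open Structure public using (∣_∣)

  record Embedding {c e c′ e′} (M : Structure c e) (N : Structure c′ e′) :
                   Set (ℓ ⊔ c ⊔ e ⊔ c′ ⊔ e′) where
    private
      module M = Structure M
      module N = Structure N
    field
      to    : ∀ {s} → M.∣ s ∣ → N.∣ s ∣
      to-≈  : ∀ {s} (a b : M.∣ s ∣) → a M.≈ b ⇔ to a N.≈ to b
      to-LE : ∀ {s t} (a : M.∣ s ∣) (b : M.∣ t ∣) →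
              M.LE a b ⇔ N.LE (to a) (to b)
      to-C  : ∀ {s t} (a : M.∣ s ∣) (b : M.∣ t ∣) →
              M.C a b ⇔ N.C (to a) (to b)
      to-P  : ∀ {s} (a b d : M.∣ s ∣) →
              M.P a b d ⇔ N.P (to a) (to b) (to d)

  record _≅_ {c e c′ e′} (M : Structure c e) (N : Structure c′ e′) :
             Set (ℓ ⊔ c ⊔ e ⊔ c′ ⊔ e′) where
    field
      embedding  : Embedding M N
    open Embedding embedding public
    field
      surjective : ∀ {s} (b : ∣ N ∣ s) → ∃[ a ] Structure._≈_ N (to a) b

  module _ {c e} (M : Structure c e) where
    open Structure M hiding (∣_∣)

    record SubsetOf : Set (ℓ ⊔ c ⊔ e ⊔ lsuc ℓ) where
      field
        holds    : ∀ {s} → Pred (∣ M ∣ s) ℓ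
        respects : ∀ {s} → holds {s} Respects _≈_

    substructure : SubsetOf → Structure (c ⊔ ℓ) e
    substructure A = record
      { m  = λ s → record
          { Carrier = Σ (∣ M ∣ s) (SubsetOf.holds A)
          ; _≈_     = λ a b → proj₁ a ≈ proj₁ b
          ; isEquivalence = record
              { refl  = Setoid.refl (m s)
              ; sym   = Setoid.sym (m s)
              ; trans = Setoid.trans (m s)
              }
          }
      ; LE = λ a b → LE (proj₁ a) (proj₁ b)
      ; C  = λ a b → C (proj₁ a) (proj₁ b)
      ; P  = λ a b d → P (proj₁ a) (proj₁ b) (proj₁ d)
      ; LE-resp = LE-resp
      ; C-resp  = C-resp
      ; P-resp  = P-resp
      }

    inclusion : (A : SubsetOf) → Embedding (substructure A) M
    inclusion A = record
      { to    = proj₁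
      ; to-≈  = λ _ _ → mk⇔ (λ p → p) (λ p → p)
      ; to-LE = λ _ _ → mk⇔ (λ p → p) (λ p → p)
      ; to-C  = λ _ _ → mk⇔ (λ p → p) (λ p → p)
      ; to-P  = λ _ _ _ → mk⇔ (λ p → p) (λ p → p)
      }

  -- A formula over Γ has free variables x_i of sort s, one for each
  -- i : s ∈ₗ Γ.
  data Formula (Γ : List Sort) : Set ℓ where
    _≈ᶠ_  : ∀ {s} → s ∈ₗ Γ → s ∈ₗ Γ → Formula Γ
    LEᶠ   : ∀ {s t} → s ∈ₗ Γ → t ∈ₗ Γ → Formula Γ
    Cᶠ    : ∀ {s t} → s ∈ₗ Γ → t ∈ₗ Γ → Formula Γ
    Pᶠ    : ∀ {s} → s ∈ₗ Γ → s ∈ₗ Γ → s ∈ₗ Γ → Formula Γ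
    ⊥ᶠ    : Formula Γ
    _∧ᶠ_ _∨ᶠ_ _⇒ᶠ_ : Formula Γ → Formula Γ → Formula Γ
    ∀ᶠ ∃ᶠ : ∀ s → Formula (s ∷ Γ) → Formula Γ

  ¬ᶠ_ : ∀ {Γ} → Formula Γ → Formula Γ
  ¬ᶠ φ = φ ⇒ᶠ ⊥ᶠ

  Sentence : Set ℓ
  Sentence = Formula []

  ∃∃ᶠ : ∀ {Γ} → Formula Γ → Sentence
  ∃∃ᶠ {[]}    φ = φ
  ∃∃ᶠ {s ∷ Γ} φ = ∃∃ᶠ (∃ᶠ s φ)

  Theory : ∀ a → Set (ℓ ⊔ lsuc a)
  Theory a = Pred Sentence a

  module _ {c e} (M : Structure c e) where
    open Structure M hiding (∣_∣)

    Assignment : List Sort → Set (c ⊔ ℓ)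
    Assignment = All ∣ M ∣

    Satisfies : ∀ {Γ} → Formula Γ → Assignment Γ → Set (c ⊔ e)
    Satisfies (i ≈ᶠ j)   ρ = Lift c (All.lookup ρ i ≈ All.lookup ρ j)
    Satisfies (LEᶠ i j)  ρ = Lift c (LE (All.lookup ρ i) (All.lookup ρ j))
    Satisfies (Cᶠ i j)   ρ = Lift c (C (All.lookup ρ i) (All.lookup ρ j))
    Satisfies (Pᶠ i j k) ρ =
      Lift c (P (All.lookup ρ i) (All.lookup ρ j) (All.lookup ρ k))
    Satisfies ⊥ᶠ         ρ = ⊥
    Satisfies (φ ∧ᶠ ψ)   ρ = Satisfies φ ρ × Satisfies ψ ρ
    Satisfies (φ ∨ᶠ ψ)   ρ = Satisfies φ ρ ⊎ Satisfies ψ ρ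
    Satisfies (φ ⇒ᶠ ψ)   ρ = Satisfies φ ρ → Satisfies ψ ρ
    Satisfies (∀ᶠ s φ)   ρ = ∀ (a : ∣ M ∣ s) → Satisfies φ (a All.∷ ρ)
    Satisfies (∃ᶠ s φ)   ρ = Σ[ a ∈ ∣ M ∣ s ] Satisfies φ (a All.∷ ρ)

  infix 4 _⊨_ _⊨ᵀ_

  _⊨_ : ∀ {c e} → Structure c e → Sentence → Set (c ⊔ e)
  M ⊨ φ = Satisfies M φ All.[]

  _⊨ᵀ_ : ∀ {c e a} → Structure c e → Theory a → Set (ℓ ⊔ c ⊔ e ⊔ a)
  M ⊨ᵀ T = ∀ φ → φ ∈ T → M ⊨ φ

  Th : ∀ {c e} → Structure c e → Theory (c ⊔ e)
  Th M φ = M ⊨ φ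

  _IsAxiomatizedBy_ : ∀ {a b} → Theory a → Theory b → Set (lsuc ℓ ⊔ a ⊔ b)
  T IsAxiomatizedBy T′ = ∀ (M : Structure ℓ ℓ) → M ⊨ᵀ T ⇔ M ⊨ᵀ T′

  module _ (G : ProfiniteGroup ℓ) (data-F : SortingData G) where
    open ProfiniteGroup G using (Carrier; _∙_)
    open OpenNormalSubgroup
    open SortingData data-F using (F)

    -- The elements (gN,k) of m(k,J), where k is recorded by the sort.
    record Element (s : Sort) : Set (lsuc ℓ) where
      field
        N     : OpenNormalSubgroup G
        index : Index≤ N (value (proj₁ s))
        sort  : proj₂ s ∈ F N
        g     : Carrier

      coset : Pred Carrier ℓ
      coset = g · N

    open Element

    -- Being a coset of N is part of the data of an element; equality of the
    -- cosets already implies equality of the subgroups.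
    _≋_ : ∀ {s} → Element s → Element s → Set ℓ
    a ≋ b = mem (N a) ≐ mem (N b) × coset a ≐ coset b

    private
      ≋-refl : ∀ {s} {a : Element s} → a ≋ a
      ≋-refl = ((λ x → x) , (λ x → x)) , ((λ x → x) , (λ x → x))

      ≋-sym : ∀ {s} {a b : Element s} → a ≋ b → b ≋ a
      ≋-sym ((p , p′) , (q , q′)) = (p′ , p) , (q′ , q)

      ≋-trans : ∀ {s} {a b d : Element s} → a ≋ b → b ≋ d → a ≋ d
      ≋-trans ((p , p′) , (q , q′)) ((r , r′) , (t , t′)) =
        ((λ x → r (p x)) , (λ x → p′ (r′ x))) , ((λ x → t (q x)) , (λ x → q′ (t′ x)))

      self : ∀ {s} (a : Element s) → g a ∈ coset a
      self a = ·-self (N a) (g a)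

    𝒮 : Structure (lsuc ℓ) ℓ
    𝒮 = record
      { m  = λ s → record
          { Carrier = Element s
          ; _≈_     = _≋_
          ; isEquivalence = record
              { refl  = λ {a} → ≋-refl {s} {a}
              ; sym   = λ {a} {b} → ≋-sym {s} {a} {b}
              ; trans = λ {a} {b} {d} → ≋-trans {s} {a} {b} {d}
              }
          }
      ; LE = λ {s} {t} a b → value (proj₁ s) ≥ value (proj₁ t) × mem (N a) ⊆ mem (N b)
      ; C  = λ {s} {t} a b → value (proj₁ s) ≥ value (proj₁ t) × coset a ⊆ coset b
      ; P  = λ a b d → mem (N a) ≐ mem (N b) × mem (N b) ≐ mem (N d) ×
                       coset d ≐ (g a ∙ g b) · N a
      ; LE-resp = λ ((_ , a′⊆a) , _) ((b⊆b′ , _) , _) (k , a⊆b) → k , λ x → b⊆b′ (a⊆b (a′⊆a x))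
      ; C-resp  = λ (_ , (_ , a′⊆a)) (_ , (b⊆b′ , _)) (k , a⊆b) → k , λ x → b⊆b′ (a⊆b (a′⊆a x))
      ; P-resp  = λ {s} {a} {a′} {b} {b′} {d} {d′}
          ((a⊆ , a⊇) , (ca⊆ , ca⊇)) ((b⊆ , b⊇) , (cb⊆ , cb⊇)) ((d⊆ , d⊇) , (cd⊆ , cd⊇))
          ((ab⊆ , ab⊇) , (bd⊆ , bd⊇) , (p⊆ , p⊇)) →
            ((λ x → b⊆ (ab⊆ (a⊇ x))) , (λ x → a⊆ (ab⊇ (b⊇ x))))
          , ((λ x → d⊆ (bd⊆ (b⊇ x))) , (λ x → b⊆ (bd⊇ (d⊇ x))))
          , ( (λ x → ·-product-⊆ (N a) (N a′) a⊆ (ca⊆ (self a))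
                       (a⊆ (ab⊇ (b⊇ (cb⊆ (self b))))) (p⊆ (cd⊇ x)))
            , (λ x → cd⊆ (p⊇ (·-product-⊆ (N a′) (N a) a⊇ (ca⊇ (self a′))
                       (ab⊇ (cb⊇ (self b′))) x))) )
      }

  -- The theory SCS is represented by its models, the structures isomorphic to
  -- some 𝒮(G,F).
  record IsSortedCompleteSystem {c e} (M : Structure c e) : Set (lsuc ℓ ⊔ c ⊔ e) where
    field
      G      : ProfiniteGroup ℓ
      data-F : SortingData G
      iso    : M ≅ 𝒮 G data-F

    N : ∀ {s} → ∣ M ∣ s → OpenNormalSubgroup G
    N a = Element.N (_≅_.to iso a)

    infix 4 _⊆ᴺ_

    _⊆ᴺ_ : ∀ {s t} → ∣ M ∣ s → ∣ M ∣ t → Set ℓ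
    a ⊆ᴺ b = OpenNormalSubgroup.mem (N a) ⊆ OpenNormalSubgroup.mem (N b)

  record SortedCompleteSystem : Set (lsuc ℓ) where
    field
      structure : Structure ℓ ℓ
      isSCS     : IsSortedCompleteSystem structure
    open Structure structure public hiding (∣_∣)
    open IsSortedCompleteSystem isSCS public

  open SortedCompleteSystem using (structure; isSCS)

  -- An embedding of sorted complete systems has to respect the subgroups N_a
  -- also when it compares elements (gN,k) and (g′N′,k′) with k < k′, which the
  -- relations LE and C do not see.  For a system of the trivial group and one
  -- in which some N ≠ G has F(N) = 𝒥^{<ℕ}, the assignment sending the element
  -- of index k to (G,k) if k < [G : N] and to (N,k) otherwise preserves and
  -- reflects all relations; its image is not a subsystem, as the only subgroup
  -- of the trivial group would be both G and N there.
  Coherent : ∀ {c e c′ e′} {M : Structure c e} {M′ : Structure c′ e′} →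
             IsSortedCompleteSystem M → IsSortedCompleteSystem M′ → Embedding M M′ →
             Set (ℓ ⊔ c)
  Coherent {M = M} p p′ h = ∀ {s t} (a : ∣ M ∣ s) (b : ∣ M ∣ t) →
    IsSortedCompleteSystem._⊆ᴺ_ p a b ⇔
    IsSortedCompleteSystem._⊆ᴺ_ p′ (Embedding.to h a) (Embedding.to h b)

  record SystemEmbedding (S S′ : SortedCompleteSystem) : Set ℓ where
    field
      embedding : Embedding (structure S) (structure S′)
      coherent  : Coherent (isSCS S) (isSCS S′) embedding
    open Embedding embedding public

  record Subsystem (S : SortedCompleteSystem) : Set (lsuc ℓ) where
    field
      subset   : SubsetOf (structure S)
      subSCS   : IsSortedCompleteSystem (substructure (structure S) subset)
      coherent : Coherent subSCS (isSCS S) (inclusion (structure S) subset)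
    open SubsetOf subset public

    system : SortedCompleteSystem
    system = record { structure = substructure (structure S) subset ; isSCS = subSCS }

  open Subsystem using (system)

  module _ (S : SortedCompleteSystem) where
    open SortedCompleteSystem S using (_≈_; _⊆ᴺ_)

    -- A finite subset X of S is given by a list of sorts and elements
    -- of these sorts.
    FiniteSubset : Set ℓ
    FiniteSubset = Σ (List Sort) (Assignment (structure S))

    infix 4 _∈ᶠ_

    _∈ᶠ_ : ∀ {s} → ∣ structure S ∣ s → FiniteSubset → Set ℓ
    _∈ᶠ_ {s} a (Γ , X) = Σ[ i ∈ s ∈ₗ Γ ] All.lookup X i ≈ a

    Generates : FiniteSubset → Set (lsuc ℓ)
    Generates X = ∀ (A : Subsystem S) →
      (∀ {s} (a : ∣ structure S ∣ s) → a ∈ᶠ X → Subsystem.holds A a) →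
      ∀ {s} (a : ∣ structure S ∣ s) → Subsystem.holds A a

    IsFinitelyGenerated : Set (lsuc ℓ)
    IsFinitelyGenerated = ∃ Generates

    record NiceFinitePresystem : Set (lsuc ℓ) where
      field
        X         : FiniteSubset
        generates : Generates X
        full      : ∀ {s} (a b : ∣ structure S ∣ s) → a ∈ᶠ X → b ∈ᶠ X
        cofinal   : ∀ {s} (a : ∣ structure S ∣ s) →
                    ∃[ t ] Σ[ x ∈ ∣ structure S ∣ t ] (x ∈ᶠ X × x ⊆ᴺ a)

      sorts : List Sort
      sorts = proj₁ X

      elements : Assignment (structure S) sorts
      elements = proj₂ X

  record FGSystem : Set (lsuc ℓ) where
    field
      scs : SortedCompleteSystem
      fg  : IsFinitelyGenerated scs

  open FGSystem using (scs)

  infix 4 _∈coFSIm_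

  _∈coFSIm_ : FGSystem → SortedCompleteSystem → Set (lsuc ℓ)
  S′ ∈coFSIm S = Σ[ A ∈ Subsystem S ]
    IsFinitelyGenerated (system A) × structure (scs S′) ≅ structure (system A)

  Expresses : (S′ : SortedCompleteSystem) (X : NiceFinitePresystem S′) →
              Formula (NiceFinitePresystem.sorts X) → Set (lsuc ℓ)
  Expresses S′ X θ =
    ∀ (S″ : SortedCompleteSystem) (c̄ : Assignment (structure S″) sorts) →
    Satisfies (structure S″) θ c̄ ⇔
      (Σ[ A ∈ Subsystem S″ ] Σ[ h ∈ structure S′ ≅ structure (system A) ]
        (∀ {s} (i : s ∈ₗ sorts) →
          SortedCompleteSystem._≈_ S″
            (proj₁ (_≅_.to h (All.lookup elements i))) (All.lookup c̄ i)))
    where open NiceFinitePresystem X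

  CoSEP : SortedCompleteSystem → Set (lsuc ℓ)
  CoSEP S = ∀ (S₁ S₂ : Subsystem S) →
    IsFinitelyGenerated (system S₁) → IsFinitelyGenerated (system S₂) →
    (Π : SystemEmbedding (system S₂) (system S₁)) →
    (Φ : SystemEmbedding (system S₂) (system S₂)) →
    Σ[ Ψ ∈ SystemEmbedding (system S₁) S ]
      (∀ {s} (a : ∣ structure (system S₂) ∣ s) →
        SortedCompleteSystem._≈_ S
          (SystemEmbedding.to Ψ (SystemEmbedding.to Π a))
          (proj₁ (SystemEmbedding.to Φ a)))

  -- The set of sentences true in all sorted complete systems with co-SEP.
  SCS-SEP : Theory (lsuc ℓ)
  SCS-SEP φ = ∀ (S : SortedCompleteSystem) → CoSEP S → structure S ⊨ φ

{-# OPTIONS --safe #-}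
module Submission where

open import Defs
open import Level using (Lift; lift; lower) renaming (suc to lsuc)
open import Algebra.Bundles using (Group)
import Algebra.Properties.Group as GroupProperties
open import Axiom.ExcludedMiddle using (ExcludedMiddle)
open import Data.Empty using (⊥-elim)
open import Data.Empty.Polymorphic using (⊥) renaming (⊥-elim to ⊥ₚ-elim)
open import Data.Fin.Base as Fin using (Fin; combine; punchIn; punchOut; remQuot; splitAt; _↑ˡ_)
open import Data.Fin.Properties
  using (_≟_; any?; pigeonhole; punchIn-punchOut; punchOut-injective; remQuot-combine;
         splitAt-↑ˡ; <⇒≢)
open import Data.List.Base using (List; []; _∷_; _++_; length; lookup; map; replicate)
open import Data.List.Membership.Propositional renaming (_∈_ to _∈ₗ_)
open import Data.List.Membership.Propositional.Properties using (∈-++⁺ˡ; ∈-++⁺ʳ; ∈-map⁺)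
open import Data.List.NonEmpty.Base using (List⁺)
open import Data.List.Relation.Unary.All as All using (All; []; _∷_)
open import Data.List.Relation.Unary.All.Properties using (++⁺)
open import Data.List.Relation.Unary.Any as Any using (here; there)
import Data.List.Relation.Unary.Any.Properties as Any
open import Data.Nat.Base using (ℕ; zero; suc; NonZero; _+_; _*_; _≤_; _<_; _≥_)
open import Data.Nat.Induction using (<-rec)
open import Data.Nat.Properties
  using (≤-refl; ≤-trans; <⇒≤; n<1+n; m≤m+n; m≤n+m; m≤m*n; m≤n*m; m*n≢0)
open import Data.Product.Base using (Σ; ∃; ∃-syntax; Σ-syntax; _×_; _,_; proj₁; proj₂)
open import Data.Sum.Base using (inj₁; inj₂; [_,_])
open import Data.Unit.Polymorphic using (⊤; tt)
open import Function.Base using (_∘_; const; id)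
open import Function.Bundles using (_⇔_; mk⇔; Equivalence; _↣_)
open import Relation.Binary.Bundles using (Setoid)
open import Relation.Binary.Definitions using (_Respects_)
open import Relation.Binary.PropositionalEquality.Core as ≡ using (_≡_)
open import Relation.Nullary.Decidable using (True; toWitness; fromWitness)
open import Relation.Nullary.Decidable.Core using (yes; no)
open import Relation.Nullary.Negation.Core using (¬_)
open import Relation.Unary using (Pred; _∈_; _⊆_; _≐_; _∪_)

open OpenNormalSubgroup
open Equivalence using () renaming (to to fwd; from to bwd)

-- A model M of the axioms is compared with S by a back-and-forth over finite tuples, without
-- showing that M is itself a sorted complete system: besides the axioms on the θ, all that is
-- used about M are first-order sentences valid in all sorted complete systems with co-SEP.  A
-- tuple is nice if it has a lowest entry and contains the whole finite group of this entry.  In a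
-- sorted complete system the atomic diagram of a nice tuple determines the subsystem that it
-- generates up to isomorphism.  Hence, for the system S′ generated by a nice tuple c, the
-- sentence ∃x̄ θ_{S′} says that the diagram of c is realized by a nice tuple, and by co-SEP a
-- realization of c can be moved so as to extend any given nice tuple with the diagram of a nice
-- part of c.  In one direction of the back-and-forth S′ is generated by a tuple of S, in the
-- other by a realization, in some sorted complete system, of the diagram of a nice tuple of M; it
-- embeds in S because M satisfies ∃x̄ θ_{S′}.

-- Profinite groups

-- A nice tuple carries a finite quotient group: modulo the subgroup K of the lowest entry its
-- entries list all cosets, and the atoms recover their multiplication. Equal diagrams therefore
-- give an isomorphism of the two quotients, kept as a relation (`Correspondence`) because cosets
-- have no canonical representatives. What remains is the sorting data. The generated system lives
-- on G/K with the least sorting data containing the sorts of the entries; this is an inductive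
-- family (`Gen`), so it is transported along the isomorphism by induction on derivations. The
-- obstacle is the index in a sort: `LE` and `C` say nothing when an element of index k is compared
-- with one of index k′ > k. Elements are therefore first moved to a larger index, embeddings carry
-- coherence as extra data, and a count (`full`) shows that an embedding cannot land in a larger
-- quotient. That every tuple extends to a nice one is first-order because the size of the extension
-- is read off the sorts: the sort of a common lower bound is computed from theirs, and k entries
-- suffice for the cosets of a subgroup of index at most k.

module _ {ℓ} {G : ProfiniteGroup ℓ} where
  open ProfiniteGroup G
  open GroupProperties group

  module _ (N : OpenNormalSubgroup G) where

    mem-resp : mem N Respects _≈_
    mem-resp = open-respect (isOpen N)

    ·-sym : ∀ {x y} → y ∈ x · N → x ∈ y · N
    ·-sym {x} {y} p = mem-resp eq (⁻¹-mem N p)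
      where
      eq : (x ⁻¹ ∙ y) ⁻¹ ≈ y ⁻¹ ∙ x
      eq = trans (⁻¹-anti-homo-∙ (x ⁻¹) y) (∙-congˡ (⁻¹-involutive x))

    ·-≈ : ∀ {x y} → x ≈ y → y ∈ x · N
    ·-≈ x≈y = mem-resp (trans (sym (inverseˡ _)) (∙-congˡ x≈y)) (ε-mem N)

    ·-common : ∀ {x y z} → z ∈ x · N → z ∈ y · N → y ∈ x · N
    ·-common p q = ·-⊆ N p (·-sym q)

    ·-ε⁺ : ∀ {x} → x ∈ mem N → x ∈ ε · N
    ·-ε⁺ p = mem-resp (trans (sym (identityˡ _)) (∙-congʳ (sym ε⁻¹≈ε))) p

    ·-ε⁻ : ∀ {x} → x ∈ ε · N → x ∈ mem N
    ·-ε⁻ p = mem-resp (trans (∙-congʳ ε⁻¹≈ε) (identityˡ _)) p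

    ·-absorb : ∀ {x y} → y ∈ mem N → (x ∙ y) ∈ x · N
    ·-absorb p = mem-resp (sym (\\-leftDividesʳ _ _)) p

    ·-absorb⁻ : ∀ {x y} → (x ∙ y) ∈ x · N → y ∈ mem N
    ·-absorb⁻ p = mem-resp (\\-leftDividesʳ _ _) p

    mem-coset : ∀ {x y} → x ∈ mem N → y ∈ x · N → y ∈ mem N
    mem-coset p q = ·-ε⁻ (·-⊆ N (·-ε⁺ p) q)

    ·-⁻¹ : ∀ {x y} → y ∈ x · N → (y ⁻¹) ∈ (x ⁻¹) · N
    ·-⁻¹ {x} {y} p = mem-resp eq (conj-mem N y (·-sym p))
      where
      eq : (y ∙ (y ⁻¹ ∙ x)) ∙ y ⁻¹ ≈ x ⁻¹ ⁻¹ ∙ y ⁻¹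
      eq = ∙-congʳ (trans (\\-leftDividesˡ y x) (sym (⁻¹-involutive x)))

    -- Continuity of the product at g⁻¹ and a point y of the coset gives a neighbourhood `W` of y
    -- with g⁻¹ `W` inside `N`. The coset is the union of these neighbourhoods, indexed by its own
    -- points.
    coset-open : ∀ g → Open (g · N)
    coset-open g = open-≐ ((λ (i , z∈) → W-⊆ i z∈) , (λ {z} z∈ → (z , z∈) , ∈-W (z , z∈)))
                          (open-⋃ W W-open)
      where
      nbhd : ∀ (i : ∃ (g · N)) → _
      nbhd (y , y∈) = ∙-continuous (isOpen N) (g ⁻¹) y y∈
      W : ∃ (g · N) → Pred Carrier ℓ
      W i = proj₁ (proj₂ (nbhd i))
      W-open : ∀ i → Open (W i)
      W-open i = let (_ , _ , _ , o , _) = nbhd i in o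
      ∈-W : ∀ i → proj₁ i ∈ W i
      ∈-W i = let (_ , _ , _ , _ , _ , p , _) = nbhd i in p
      W-⊆ : ∀ i → W i ⊆ g · N
      W-⊆ i z∈ = let (_ , _ , _ , _ , p , _ , f) = nbhd i in f p z∈

    ⋃-cosets-open : ∀ {U : Pred Carrier ℓ} → (∀ {x y} → y ∈ x · N → x ∈ U → y ∈ U) → Open U
    ⋃-cosets-open {U} h =
      open-≐ ((λ ((x , p) , q) → h q p) , (λ {x} p → (x , p) , ·-self N x))
             (open-⋃ {I = ∃ U} (λ i → proj₁ i · N) (λ i → coset-open (proj₁ i)))

    finite-index : ∃[ k ] Index≤ N k
    finite-index =
      let is , cover = compact (_· N) coset-open (λ x → x , ·-self N x)
      in length is , lookup is , λ g → Any.index (cover g) , Any.lookup-index (cover g)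

  Index≤-mono : ∀ N N′ {k} → mem N ⊆ mem N′ → Index≤ {G = G} N k → Index≤ {G = G} N′ k
  Index≤-mono N N′ N⊆N′ (r , cover) = r , λ g → proj₁ (cover g) , N⊆N′ (proj₂ (cover g))

-- Quotients by an open normal subgroup

module Quotient (em : ∀ {a} → ExcludedMiddle a) {ℓ} (G : ProfiniteGroup ℓ)
                (K : OpenNormalSubgroup G) where
  open ProfiniteGroup G

  infix 4 _≈ᴷ_

  _≈ᴷ_ : Carrier → Carrier → Set ℓ
  x ≈ᴷ y = y ∈ x · K

  -- Only the equality of G is coarsened and the carrier is kept, so no representatives are chosen.
  -- Open normal subgroups of the quotient are those of G that contain `K`, with the same membership
  -- predicate.
  quotientGroup : Group ℓ ℓ
  quotientGroup = record
    { Carrier = Carrier ; _≈_ = _≈ᴷ_ ; _∙_ = _∙_ ; ε = ε ; _⁻¹ = _⁻¹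
    ; isGroup = record
        { isMonoid = record
            { isSemigroup = record
                { isMagma = record
                    { isEquivalence = record
                        { refl = ·-self K _ ; sym = ·-sym K ; trans = λ p q → ·-⊆ K p q }
                    ; ∙-cong = ·-mul K
                    }
                ; assoc = λ x y z → ·-≈ K (assoc x y z)
                }
            ; identity = (λ x → ·-≈ K (identityˡ x)) , (λ x → ·-≈ K (identityʳ x))
            }
        ; inverse = (λ x → ·-≈ K (inverseˡ x)) , (λ x → ·-≈ K (inverseʳ x))
        ; ⁻¹-cong = ·-⁻¹ K
        }
    }

  quotientTopology : Topology (Group.setoid quotientGroup)
  quotientTopology = record
    { Open = λ U → Open U × U Respects _≈ᴷ_
    ; open-≐ = λ U≐V (o , r) → open-≐ U≐V o , λ p q → proj₁ U≐V (r p (proj₂ U≐V q))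
    ; open-respect = proj₂
    ; open-⊤ = open-⊤ , _
    ; open-∩ = λ (o , r) (o′ , r′) → open-∩ o o′ , λ p (q , q′) → r p q , r′ p q′
    ; open-⋃ = λ U o → open-⋃ U (proj₁ ∘ o) , λ p (i , q) → i , proj₂ (o i) p q
    }

  coset-openᴷ : ∀ g → Topology.Open quotientTopology (g · K)
  coset-openᴷ g = coset-open K g , λ q p → ·-⊆ K p q

  quotient : ProfiniteGroup ℓ
  quotient = record
    { group = quotientGroup
    ; topology = quotientTopology
    ; ∙-continuous = λ (o , r) x y p →
        x · K , y · K , coset-openᴷ x , coset-openᴷ y
        , ·-self K x , ·-self K y , λ v∈ w∈ → r (·-mul K v∈ w∈) p
    ; ⁻¹-continuous = λ (o , r) → ⁻¹-continuous o , λ p q → r (·-⁻¹ K p) q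
    ; compact = λ U o → compact U (proj₁ ∘ o)
    ; hausdorff = λ x y x≉y →
        x · K , y · K , coset-openᴷ x , coset-openᴷ y
        , ·-self K x , ·-self K y , λ (z , p , q) → x≉y (·-common K p q)
    ; totallyDisconnected = separated
    }
    where
    -- A coset of `K` and its complement are both open and invariant under `K`, so together they
    -- would split a connected set that meets two cosets.
    separated : Topology.TotallyDisconnected quotientTopology
    separated C connected {x} {y} x∈C y∈C with em {P = x ≈ᴷ y}
    ... | yes p = p
    ... | no x≉y = ⊥-elim (let (z , _ , p , q) = connected (x · K) V (coset-openᴷ x) oV split
                                                   (x , x∈C , ·-self K x) (y , y∈C , x≉y)
                           in q p)
      where
      V : Pred Carrier ℓ
      V z = ¬ (z ∈ x · K)
      V-resp : ∀ {z w} → w ∈ z · K → z ∈ V → w ∈ V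
      V-resp p z∉ w∈ = z∉ (·-common K w∈ p)
      oV : Topology.Open quotientTopology V
      oV = ⋃-cosets-open K V-resp , λ p q → V-resp p q
      split : C ⊆ (x · K) ∪ V
      split {z} _ with em {P = z ∈ x · K}
      ... | yes p = inj₁ p
      ... | no p = inj₂ p

  toQuotient : (N : OpenNormalSubgroup G) → mem K ⊆ mem N → OpenNormalSubgroup quotient
  toQuotient N K⊆N = record
    { mem = mem N ; isOpen = isOpen N , λ p q → mem-coset N q (K⊆N p)
    ; ε-mem = ε-mem N ; ∙-mem = ∙-mem N ; ⁻¹-mem = ⁻¹-mem N ; conj-mem = conj-mem N }

  fromQuotient : OpenNormalSubgroup quotient → OpenNormalSubgroup G
  fromQuotient N = record
    { mem = mem N ; isOpen = proj₁ (isOpen N)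
    ; ε-mem = ε-mem N ; ∙-mem = ∙-mem N ; ⁻¹-mem = ⁻¹-mem N ; conj-mem = conj-mem N }

  kernel-⊆ : ∀ (N : OpenNormalSubgroup quotient) → mem K ⊆ mem N
  kernel-⊆ N p = proj₂ (isOpen N) (·-ε⁺ K p) (ε-mem N)

-- Counting cosets

+-nonZero : ∀ m n .{{_ : NonZero m}} → NonZero (m + n)
+-nonZero (suc m) n = _

_+⁺_ : ℕ⁺ → ℕ⁺ → ℕ⁺
pos k +⁺ pos k′ = pos (k + k′) {{+-nonZero k k′}}

module _ {ℓ} {G : ProfiniteGroup ℓ} where

  Index≤-+ : ∀ (N : OpenNormalSubgroup G) {k} m → Index≤ {G = G} N k → Index≤ {G = G} N (k + m)
  Index≤-+ N {k} m (r , cover) =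
    -- The first k representatives already cover the group; the m additional ones are padding.
    ([ r , const (ProfiniteGroup.ε G) ] ∘ splitAt k) , λ g →
      let i , p = cover g
      in i ↑ˡ m , ≡.subst (λ j → g ∈ [ r , const (ProfiniteGroup.ε G) ] j · N)
                          (≡.sym (splitAt-↑ˡ k i m)) p

-- A missed value could be punched out of the codomain, and the pigeonhole principle would then
-- contradict injectivity.
injective⇒surjective : ∀ {n} (f : Fin n → Fin n) → (∀ {i j} → f i ≡ f j → i ≡ j) →
                       ∀ l → ∃[ i ] f i ≡ l
injective⇒surjective {suc n} f inj l with any? (λ i → f i ≟ l)
... | yes p = p
... | no l∉f =
  let avoid = λ i l≡fi → l∉f (i , ≡.sym l≡fi)
      i , j , i<j , e = pigeonhole (n<1+n n) (λ i → punchOut (avoid i))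
  in ⊥-elim (<⇒≢ i<j (inj (punchOut-injective (avoid i) (avoid j) e)))

module _ (em : ∀ {a} → ExcludedMiddle a) where

  least : ∀ {p} (P : ℕ → Set p) {n} → P n →
          ∃[ m ] (m ≤ n × P m × (∀ i → i < m → ¬ P i))
  least P {n} = <-rec (λ n → P n → ∃[ m ] (m ≤ n × P m × (∀ i → i < m → ¬ P i))) step n
    where
    step : ∀ n → (∀ {i} → i < n → P i → _) → P n → _
    step n rec pn with em {P = ∃[ i ] (i < n × P i)}
    ... | yes (i , i<n , pi) =
      let m , m≤i , rest = rec i<n pi in m , ≤-trans m≤i (<⇒≤ i<n) , rest
    ... | no none = n , ≤-refl , pn , λ i i<m pi → none (i , i<m , pi)

module _ {ℓ} {G : ProfiniteGroup ℓ} where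
  open ProfiniteGroup G

  -- If two representatives shared a coset, the list without `r j` would still cover the group, with
  -- one entry fewer.
  minimal⇒distinct : ∀ (N : OpenNormalSubgroup G) {n} (i≤ : Index≤ {G = G} N n) →
    (∀ i → i < n → ¬ Index≤ {G = G} N i) →
    ∀ {i j} → proj₁ i≤ j ∈ proj₁ i≤ i · N → i ≡ j
  minimal⇒distinct N {suc n} (r , cover) minimal {i} {j} p with i ≟ j
  ... | yes i≡j = i≡j
  ... | no i≢j = ⊥-elim (minimal n (n<1+n n) ((λ l → r (punchIn j l)) , cover′))
    where
    cover′ : ∀ g → ∃[ l ] g ∈ r (punchIn j l) · N
    cover′ g with cover g
    ... | l , q with j ≟ l
    ... | yes ≡.refl = punchOut (i≢j ∘ ≡.sym) ,
      ≡.subst (λ l → g ∈ r l · N) (≡.sym (punchIn-punchOut (i≢j ∘ ≡.sym))) (·-⊆ N p q)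
    ... | no j≢l = punchOut j≢l ,
      ≡.subst (λ l → g ∈ r l · N) (≡.sym (punchIn-punchOut j≢l)) q

  Index≤⇒NonZero : ∀ (N : OpenNormalSubgroup G) {n} → Index≤ {G = G} N n → NonZero n
  Index≤⇒NonZero N {zero} (_ , cover) with cover ε
  ... | () , _
  Index≤⇒NonZero N {suc n} _ = _

-- The graph of an isomorphism H₁/K₁ → H₂/K₂.
record Correspondence {ℓ} {H₁ H₂ : ProfiniteGroup ℓ}
                      (K₁ : OpenNormalSubgroup H₁) (K₂ : OpenNormalSubgroup H₂) :
                      Set (lsuc ℓ) where
  private
    module H₁ = ProfiniteGroup H₁
    module H₂ = ProfiniteGroup H₂
  field
    T      : H₁.Carrier → H₂.Carrier → Set ℓ
    total₁ : ∀ x → ∃[ g ] T x g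
    total₂ : ∀ g → ∃[ x ] T x g
    T-∙    : ∀ {x y g g′} → T x g → T y g′ → T (x H₁.∙ y) (g H₂.∙ g′)
    T-·    : ∀ {x y g g′} → T x g → T y g′ → y ∈ x · K₁ ⇔ g′ ∈ g · K₂
    T-resp : ∀ {x y g g′} → T x g → y ∈ x · K₁ → g′ ∈ g · K₂ → T y g′

  -- A partner of the identity is idempotent modulo `K₂`, hence lies in `K₂`.
  T-ε : T H₁.ε H₂.ε
  T-ε =
    let g , t = total₁ H₁.ε
    in T-resp t (·-self K₁ _)
         (·-sym K₂ (·-ε⁺ K₂ (·-absorb⁻ K₂
           (fwd (T-· t (T-∙ t t)) (·-≈ K₁ (H₁.sym (H₁.identityˡ _)))))))

  T-⁻¹ : ∀ {x g} → T x g → T (x H₁.⁻¹) (g H₂.⁻¹)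
  T-⁻¹ {x} {g} t =
    let g′ , t′ = total₁ (x H₁.⁻¹)
        p = ·-ε⁻ K₂ (fwd (T-· T-ε (T-∙ t t′)) (·-≈ K₁ (H₁.sym (H₁.inverseʳ x))))
    in T-resp t′ (·-self K₁ _) (·-sym K₂ (mem-resp K₂ (H₂.∙-congʳ (H₂.sym (⁻¹-involutive g))) p))
    where open GroupProperties H₂.group

  module _ (N : OpenNormalSubgroup H₂) (K₂⊆N : mem K₂ ⊆ mem N) where

    private
      Pull : Pred H₁.Carrier ℓ
      Pull x = ∃[ g ] (T x g × g ∈ mem N)

      ∈Pull : ∀ {x g} → T x g → x ∈ Pull → g ∈ mem N
      ∈Pull t (g′ , t′ , p) = mem-coset N p (K₂⊆N (fwd (T-· t′ t) (·-self K₁ _)))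

      Pull-resp : ∀ {x y} → y ∈ x · K₁ → x ∈ Pull → y ∈ Pull
      Pull-resp q (g , t , p) = g , T-resp t q (·-self K₂ g) , p

    -- The preimage of `N` under the isomorphism. It is open as a union of cosets of `K₁`, and it
    -- does not depend on the chosen partners because `N` contains `K₂`.
    pull : OpenNormalSubgroup H₁
    pull = record
      { mem      = Pull
      ; isOpen   = ⋃-cosets-open K₁ Pull-resp
      ; ε-mem    = H₂.ε , T-ε , ε-mem N
      ; ∙-mem    = λ (g , t , p) (g′ , t′ , p′) → g H₂.∙ g′ , T-∙ t t′ , ∙-mem N p p′
      ; ⁻¹-mem   = λ (g , t , p) → g H₂.⁻¹ , T-⁻¹ t , ⁻¹-mem N p
      ; conj-mem = λ y (g , t , p) →
          let h , u = total₁ y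
          in h H₂.∙ g H₂.∙ h H₂.⁻¹ , T-∙ (T-∙ u t) (T-⁻¹ u) , conj-mem N h p
      }

    pull-mem : ∀ {x g} → T x g → x ∈ mem pull ⇔ g ∈ mem N
    pull-mem t = mk⇔ (∈Pull t) (λ p → _ , t , p)

    pull-· : ∀ {x y g g′} → T x g → T y g′ → y ∈ x · pull ⇔ g′ ∈ g · N
    pull-· t t′ = pull-mem (T-∙ (T-⁻¹ t) t′)

    pull-⊇ : mem K₁ ⊆ mem pull
    pull-⊇ p = Pull-resp (·-ε⁺ K₁ p) (H₂.ε , T-ε , ε-mem N)

    pull-Index≤ : ∀ {k} → Index≤ {G = H₂} N k → Index≤ {G = H₁} pull k
    pull-Index≤ (r , cover) = (λ i → proj₁ (total₂ (r i))) , λ x →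
      let g , t = total₁ x
          i , p = cover g
      in i , bwd (pull-· (proj₂ (total₂ (r i))) t) p

finite-index⁺ : ∀ {ℓ} {G : ProfiniteGroup ℓ} (N : OpenNormalSubgroup G) →
                ∃[ k ] Index≤ {G = G} N (value k)
finite-index⁺ N = let k , i = finite-index N in pos k {{Index≤⇒NonZero N i}} , i

-- Finite tuples and index bounds of intersections

lookup-tabulate : ∀ {a p} {A : Set a} {P : A → Set p} {xs} (f : ∀ {x} → x ∈ₗ xs → P x)
                  {x} (i : x ∈ₗ xs) → All.lookup (All.tabulate f) i ≡ f i
lookup-tabulate f (here ≡.refl) = ≡.refl
lookup-tabulate f (there i) = lookup-tabulate (λ j → f (there j)) i

_*⁺_ : ℕ⁺ → ℕ⁺ → ℕ⁺
pos k *⁺ pos k′ = pos (k * k′) {{m*n≢0 k k′}}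

k≤k*⁺k′ : ∀ k k′ → value (k *⁺ k′) ≥ value k
k≤k*⁺k′ (pos k) (pos k′) = m≤m*n k k′

k′≤k*⁺k′ : ∀ k k′ → value (k *⁺ k′) ≥ value k′
k′≤k*⁺k′ (pos k) (pos k′) = m≤n*m k′ k

module _ {a p} {A : Set a} {P : A → Set p} where

  module _ {ys} (ρ : All P ys) where

    lookup-++⁺ˡ : ∀ {xs} (δ : All P xs) {x} (i : x ∈ₗ xs) →
                  All.lookup (++⁺ δ ρ) (∈-++⁺ˡ i) ≡ All.lookup δ i
    lookup-++⁺ˡ (_ ∷ δ) (here ≡.refl) = ≡.refl
    lookup-++⁺ˡ (_ ∷ δ) (there i)     = lookup-++⁺ˡ δ i

    lookup-++⁺ʳ : ∀ {xs} (δ : All P xs) {y} (i : y ∈ₗ ys) →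
                  All.lookup (++⁺ δ ρ) (∈-++⁺ʳ xs i) ≡ All.lookup ρ i
    lookup-++⁺ʳ []      i = ≡.refl
    lookup-++⁺ʳ (_ ∷ δ) i = lookup-++⁺ʳ δ i

    lookup-++⁺-elim : ∀ {q} (Q : ∀ {x} → P x → Set q) {xs} (δ : All P xs) →
      (∀ {x} (i : x ∈ₗ xs) → Q (All.lookup δ i)) → (∀ {y} (i : y ∈ₗ ys) → Q (All.lookup ρ i)) →
      ∀ {x} (i : x ∈ₗ xs ++ ys) → Q (All.lookup (++⁺ δ ρ) i)
    lookup-++⁺-elim Q []      l r i             = r i
    lookup-++⁺-elim Q (_ ∷ δ) l r (here ≡.refl) = l (here ≡.refl)
    lookup-++⁺-elim Q (_ ∷ δ) l r (there i)     = lookup-++⁺-elim Q δ (l ∘ there) r i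

  module _ {x : A} where

    tabulateʳ : ∀ n → (Fin n → P x) → All P (replicate n x)
    tabulateʳ zero    f = []
    tabulateʳ (suc n) f = f Fin.zero ∷ tabulateʳ n (f ∘ Fin.suc)

    tabulateʳ-hit : ∀ n (f : Fin n → P x) i →
                    Σ[ j ∈ x ∈ₗ replicate n x ] All.lookup (tabulateʳ n f) j ≡ f i
    tabulateʳ-hit (suc n) f Fin.zero    = here ≡.refl , ≡.refl
    tabulateʳ-hit (suc n) f (Fin.suc i) =
      let j , e = tabulateʳ-hit n (f ∘ Fin.suc) i in there j , e

    tabulateʳ-elim : ∀ {q} (Q : ∀ {y} → P y → Set q) n (f : Fin n → P x) → (∀ i → Q (f i)) →
                     ∀ {y} (j : y ∈ₗ replicate n x) → Q (All.lookup (tabulateʳ n f) j)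
    tabulateʳ-elim Q (suc n) f h (here ≡.refl) = h Fin.zero
    tabulateʳ-elim Q (suc n) f h (there j)     = tabulateʳ-elim Q n (f ∘ Fin.suc) (h ∘ Fin.suc) j

module _ (em : ∀ {a} → ExcludedMiddle a) {ℓ} {G : ProfiniteGroup ℓ} where
  open ProfiniteGroup G

  Index≤-∩ : ∀ (N N′ : OpenNormalSubgroup G) {k k′} → Index≤ {G = G} N k → Index≤ {G = G} N′ k′ →
             Index≤ {G = G} (N ∩ᴺ N′) (k * k′)
  Index≤-∩ N N′ {k} {k′} (r , cover) (r′ , cover′) = (λ l → choice (remQuot k′ l)) , λ g →
    let i , p = cover g
        i′ , p′ = cover′ g
    in combine i i′ , ≡.subst (λ l → g ∈ choice l · (N ∩ᴺ N′)) (≡.sym (remQuot-combine i i′))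
                        (covers p p′)
    where
    Meet : Fin k × Fin k′ → Set ℓ
    Meet (i , i′) = ∃[ g ] (g ∈ r i · N × g ∈ r′ i′ · N′)
    choice : Fin k × Fin k′ → Carrier
    choice l with em {P = Meet l}
    ... | yes (g , _) = g
    -- A pair of disjoint cosets covers nothing, so any value serves here.
    ... | no _ = ε
    covers : ∀ {i i′ g} → g ∈ r i · N → g ∈ r′ i′ · N′ → g ∈ choice (i , i′) · (N ∩ᴺ N′)
    covers {i} {i′} {g} p p′ with em {P = Meet (i , i′)}
    ... | yes (h , q , q′) = ·-⊆ N (·-sym N q) p , ·-⊆ N′ (·-sym N′ q′) p′
    ... | no ∄ with () ← ∄ (g , p , p′)

-- Elements of a sorted complete system as cosets

module SortedSystems (em : ∀ {a} → ExcludedMiddle a)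
                     {ℓ} (𝒥 : Set ℓ) (J*⊆ : ℕ⁺ → List⁺ 𝒥 → List⁺ 𝒥) where
  open Sorted 𝒥 J*⊆
  open SortedCompleteSystem using (structure; isSCS)

  module SCS (S : SortedCompleteSystem) where
    open SortedCompleteSystem S public hiding (structure)
    open ProfiniteGroup G public using (_∙_; ε) renaming (Carrier to ∣G∣)
    open SortingData data-F public

    rep : ∀ {s} → ∣ structure S ∣ s → ∣G∣
    rep a = Element.g (_≅_.to iso a)

    coset : ∀ {s} → ∣ structure S ∣ s → Pred ∣G∣ ℓ
    coset a = rep a · N a

    index : ∀ {s} (a : ∣ structure S ∣ s) → Index≤ (N a) (value (proj₁ s))
    index a = Element.index (_≅_.to iso a)

    sort : ∀ {s} (a : ∣ structure S ∣ s) → proj₂ s ∈ F (N a)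
    sort a = Element.sort (_≅_.to iso a)

    infix 4 _≐ᴺ_

    _≐ᴺ_ : ∀ {s t} → ∣ structure S ∣ s → ∣ structure S ∣ t → Set ℓ
    a ≐ᴺ b = mem (N a) ≐ mem (N b)

    rep∈ : ∀ {s} (a : ∣ structure S ∣ s) → rep a ∈ coset a
    rep∈ a = ·-self (N a) (rep a)

    coset-⊆ : ∀ {s t} (a : ∣ structure S ∣ s) (b : ∣ structure S ∣ t) {z} →
              a ⊆ᴺ b → z ∈ coset a → z ∈ coset b → coset a ⊆ coset b
    coset-⊆ a b a⊆b z∈a z∈b w∈a = ·-⊆ (N b) z∈b (a⊆b (·-⊆ (N a) (·-sym (N a) z∈a) w∈a))

    coset-⊆⇒⊆ᴺ : ∀ {s t} (a : ∣ structure S ∣ s) (b : ∣ structure S ∣ t) →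
                 coset a ⊆ coset b → a ⊆ᴺ b
    coset-⊆⇒⊆ᴺ a b ca⊆cb z∈ =
      ·-absorb⁻ (N b) (·-⊆ (N b) (·-sym (N b) (ca⊆cb (rep∈ a))) (ca⊆cb (·-absorb (N a) z∈)))

    ≈⇒≐ : ∀ {s} {a b : ∣ structure S ∣ s} → a ≈ b → a ≐ᴺ b
    ≈⇒≐ {a = a} {b} p = proj₁ (fwd (_≅_.to-≈ iso a b) p)

    ≈⇒coset : ∀ {s} {a b : ∣ structure S ∣ s} → a ≈ b → coset a ≐ coset b
    ≈⇒coset {a = a} {b} p = proj₂ (fwd (_≅_.to-≈ iso a b) p)

    ≈-intro : ∀ {s} (a b : ∣ structure S ∣ s) {z} →
              a ≐ᴺ b → z ∈ coset a → z ∈ coset b → a ≈ b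
    ≈-intro a b (p , q) z∈a z∈b =
      bwd (_≅_.to-≈ iso a b) ((p , q) , (coset-⊆ a b p z∈a z∈b , coset-⊆ b a q z∈b z∈a))

    LE-intro : ∀ {s t} (a : ∣ structure S ∣ s) (b : ∣ structure S ∣ t) →
               value (proj₁ s) ≥ value (proj₁ t) → a ⊆ᴺ b → LE a b
    LE-intro a b k p = bwd (_≅_.to-LE iso a b) (k , p)

    LE⇒≥ : ∀ {s t} (a : ∣ structure S ∣ s) (b : ∣ structure S ∣ t) →
           LE a b → value (proj₁ s) ≥ value (proj₁ t)
    LE⇒≥ a b p = proj₁ (fwd (_≅_.to-LE iso a b) p)

    LE⇒⊆ᴺ : ∀ {s t} (a : ∣ structure S ∣ s) (b : ∣ structure S ∣ t) → LE a b → a ⊆ᴺ b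
    LE⇒⊆ᴺ a b p = proj₂ (fwd (_≅_.to-LE iso a b) p)

    C-intro : ∀ {s t} (a : ∣ structure S ∣ s) (b : ∣ structure S ∣ t) {z} →
              value (proj₁ s) ≥ value (proj₁ t) → a ⊆ᴺ b → z ∈ coset a → z ∈ coset b → C a b
    C-intro a b k p z∈a z∈b = bwd (_≅_.to-C iso a b) (k , coset-⊆ a b p z∈a z∈b)

    C⇒⊆ : ∀ {s t} (a : ∣ structure S ∣ s) (b : ∣ structure S ∣ t) → C a b → coset a ⊆ coset b
    C⇒⊆ a b p = proj₂ (fwd (_≅_.to-C iso a b) p)

    C⇒≥ : ∀ {s t} (a : ∣ structure S ∣ s) (b : ∣ structure S ∣ t) →
          C a b → value (proj₁ s) ≥ value (proj₁ t)
    C⇒≥ a b p = proj₁ (fwd (_≅_.to-C iso a b) p)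

    C-⊆ : ∀ {s t} (a : ∣ structure S ∣ s) (b : ∣ structure S ∣ t) →
          value (proj₁ s) ≥ value (proj₁ t) → coset a ⊆ coset b → C a b
    C-⊆ a b k p = bwd (_≅_.to-C iso a b) (k , p)

    P⇒≐ : ∀ {s} (a b d : ∣ structure S ∣ s) → P a b d → a ≐ᴺ b × b ≐ᴺ d
    P⇒≐ a b d p = let q , r , _ = fwd (_≅_.to-P iso a b d) p in q , r

    P-intro : ∀ {s} (a b d : ∣ structure S ∣ s) → a ≐ᴺ b → b ≐ᴺ d →
              (rep a ∙ rep b) ∈ coset d → P a b d
    P-intro a b d ab@(_ , ba) bd@(bd₁ , db) p = bwd (_≅_.to-P iso a b d)
      (ab , bd , ( (λ q → ·-⊆ (N a) (·-sym (N a) (ba (db p))) (ba (db q)))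
                 , (λ q → ·-⊆ (N d) p (bd₁ (proj₁ ab q))) ))

    P⇒∙ : ∀ {s} (a b d : ∣ structure S ∣ s) {x y} → P a b d →
          x ∈ coset a → y ∈ coset b → (x ∙ y) ∈ coset d
    P⇒∙ a b d pabd x∈ y∈ =
      let (_ , ba) , _ , (_ , q) = fwd (_≅_.to-P iso a b d) pabd
      in q (·-mul (N a) x∈ (ba y∈))

    mk : ∀ s (M : OpenNormalSubgroup G) → Index≤ M (value (proj₁ s)) → proj₂ s ∈ F M → ∀ g →
         Σ[ a ∈ ∣ structure S ∣ s ] mem (N a) ≐ mem M × g ∈ coset a
    mk s M i f g =
      let a , (p , _ , q) = _≅_.surjective iso
            (record { N = M ; index = i ; sort = f ; g = g })
      in a , p , q (·-self M g)

    mate : ∀ {s} (a : ∣ structure S ∣ s) g → Σ[ b ∈ ∣ structure S ∣ s ] b ≐ᴺ a × g ∈ coset b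
    mate {s} a g = mk s (N a) (index a) (sort a) g

    -- The same coset listed under a larger index bound. The copy can be compared by `LE` and `C`
    -- with elements of index k′ as well as with `a`.
    raise : ∀ {k J} k′ (a : ∣ structure S ∣ (k , J)) →
            Σ[ b ∈ ∣ structure S ∣ (k +⁺ k′ , J) ] b ≐ᴺ a × rep a ∈ coset b
    raise {k} {J} k′ a =
      mk (k +⁺ k′ , J) (N a) (Index≤-+ (N a) (value k′) (index a)) (sort a) (rep a)

    -- LE alone does not compare elements of index k < k′, but the largest element below a
    -- of a sort of larger index has the same subgroup as a.
    ⊆ᴺ-definable : ∀ {k k′ J J′} (a : ∣ structure S ∣ (k , J)) (b : ∣ structure S ∣ (k′ , J′)) →
      a ⊆ᴺ b ⇔ (Σ[ x ∈ ∣ structure S ∣ (k +⁺ k′ , J) ]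
                  LE x a × (∀ (y : ∣ structure S ∣ (k +⁺ k′ , J)) → LE y a → LE y x) × LE x b)
    ⊆ᴺ-definable {k} {k′} a b = mk⇔ to from
      where
      to : a ⊆ᴺ b → _
      to a⊆b =
        let x , (x⊆a , a⊆x) , _ = raise k′ a
        in x , LE-intro x a (m≤m+n _ _) x⊆a
             , (λ y p → LE-intro y x ≤-refl (λ z → a⊆x (LE⇒⊆ᴺ y a p z)))
             , LE-intro x b (m≤n+m _ _) (λ z → a⊆b (x⊆a z))
      from : _ → a ⊆ᴺ b
      from (x , _ , max , q) {z} z∈ =
        let y , (y⊆a , a⊆y) , _ = raise k′ a
        in LE⇒⊆ᴺ x b q (LE⇒⊆ᴺ y x (max y (LE-intro y a (m≤m+n _ _) y⊆a)) (a⊆y z∈))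


  -- Isomorphisms and coherent embeddings

  ≅-refl : ∀ {c e} {M : Structure c e} → M ≅ M
  ≅-refl {M = M} = record
    { embedding = record { to = id ; to-≈ = λ _ _ → mk⇔ id id ; to-LE = λ _ _ → mk⇔ id id
                         ; to-C = λ _ _ → mk⇔ id id ; to-P = λ _ _ _ → mk⇔ id id }
    ; surjective = λ b → b , Setoid.refl (Structure.m M _)
    }

  ≅-sym : ∀ {c e c′ e′} {M : Structure c e} {M′ : Structure c′ e′} → M ≅ M′ → M′ ≅ M
  ≅-sym {M = M} {M′} h = record
    { embedding = record
        { to    = inv
        ; to-≈  = λ a b → mk⇔ (λ p → bwd (h.to-≈ _ _) (trans (sec a) (trans p (sym (sec b)))))
                              (λ p → trans (sym (sec a)) (trans (fwd (h.to-≈ _ _) p) (sec b)))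
        ; to-LE = λ a b → mk⇔ (λ p → bwd (h.to-LE _ _) (LE-resp (sym (sec a)) (sym (sec b)) p))
                              (λ p → LE-resp (sec a) (sec b) (fwd (h.to-LE _ _) p))
        ; to-C  = λ a b → mk⇔ (λ p → bwd (h.to-C _ _) (C-resp (sym (sec a)) (sym (sec b)) p))
                              (λ p → C-resp (sec a) (sec b) (fwd (h.to-C _ _) p))
        ; to-P  = λ a b d → mk⇔
            (λ p → bwd (h.to-P _ _ _) (P-resp (sym (sec a)) (sym (sec b)) (sym (sec d)) p))
            (λ p → P-resp (sec a) (sec b) (sec d) (fwd (h.to-P _ _ _) p))
        }
    ; surjective = λ a → h.to a , bwd (h.to-≈ _ _) (sec (h.to a))
    }
    where
    module h = _≅_ h
    open Structure M′ hiding (∣_∣)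
    sym : ∀ {s} {x y : ∣ M′ ∣ s} → x ≈ y → y ≈ x
    sym = Setoid.sym (m _)
    trans : ∀ {s} {x y z : ∣ M′ ∣ s} → x ≈ y → y ≈ z → x ≈ z
    trans = Setoid.trans (m _)
    inv : ∀ {s} → ∣ M′ ∣ s → ∣ M ∣ s
    inv b = proj₁ (h.surjective b)
    sec : ∀ {s} (b : ∣ M′ ∣ s) → h.to (inv b) ≈ b
    sec b = proj₂ (h.surjective b)

  ∘-Embedding : ∀ {c e c′ e′ c″ e″} {M : Structure c e} {M′ : Structure c′ e′}
                {M″ : Structure c″ e″} → Embedding M′ M″ → Embedding M M′ → Embedding M M″
  ∘-Embedding f g = record
    { to    = f.to ∘ g.to
    ; to-≈  = λ a b → f.to-≈ _ _ ⇔∘ g.to-≈ a b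
    ; to-LE = λ a b → f.to-LE _ _ ⇔∘ g.to-LE a b
    ; to-C  = λ a b → f.to-C _ _ ⇔∘ g.to-C a b
    ; to-P  = λ a b d → f.to-P _ _ _ ⇔∘ g.to-P a b d
    }
    where
    module f = Embedding f
    module g = Embedding g
    _⇔∘_ : ∀ {a b c} {A : Set a} {B : Set b} {C : Set c} → B ⇔ C → A ⇔ B → A ⇔ C
    p ⇔∘ q = mk⇔ (fwd p ∘ fwd q) (bwd q ∘ bwd p)

  ≅-trans : ∀ {c e c′ e′ c″ e″} {M : Structure c e} {M′ : Structure c′ e′}
            {M″ : Structure c″ e″} → M ≅ M′ → M′ ≅ M″ → M ≅ M″
  ≅-trans {M″ = M″} f g = record
    { embedding  = ∘-Embedding (_≅_.embedding g) (_≅_.embedding f)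
    ; surjective = λ b →
        let b′ , p = _≅_.surjective g b
            a , q = _≅_.surjective f b′
        in a , Setoid.trans (Structure.m M″ _) (fwd (_≅_.to-≈ g _ _) q) p
    }

  -- `⊆ᴺ-definable` describes inclusion by a formula with a universal quantifier over elements;
  -- surjectivity of `h` is what carries that quantifier across.
  ≅⇒Coherent : ∀ (S S′ : SortedCompleteSystem) (h : structure S ≅ structure S′) →
               Coherent (isSCS S) (isSCS S′) (_≅_.embedding h)
  ≅⇒Coherent S S′ h a b = mk⇔ to from
    where
    module S  = SCS S
    module S′ = SCS S′
    module h  = _≅_ h
    refl : ∀ {s} {x : ∣ structure S′ ∣ s} → x S′.≈ x
    refl = Setoid.refl (Structure.m (structure S′) _)
    sym : ∀ {s} {x y : ∣ structure S′ ∣ s} → x S′.≈ y → y S′.≈ x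
    sym = Setoid.sym (Structure.m (structure S′) _)
    to : a S.⊆ᴺ b → h.to a S′.⊆ᴺ h.to b
    to p =
      let x , q , max , r = fwd (S.⊆ᴺ-definable a b) p
      in bwd (S′.⊆ᴺ-definable (h.to a) (h.to b))
           ( h.to x , fwd (h.to-LE x a) q
           , (λ y′ t → let y , e = h.surjective y′
                       in S′.LE-resp e refl (fwd (h.to-LE y x)
                            (max y (bwd (h.to-LE y a) (S′.LE-resp (sym e) refl t)))))
           , fwd (h.to-LE x b) r )
    from : h.to a S′.⊆ᴺ h.to b → a S.⊆ᴺ b
    from p =
      let x′ , q , max , r = fwd (S′.⊆ᴺ-definable (h.to a) (h.to b)) p
          x , e = h.surjective x′
      in bwd (S.⊆ᴺ-definable a b)
           ( x , bwd (h.to-LE x a) (S′.LE-resp (sym e) refl q)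
           , (λ y t → bwd (h.to-LE y x)
               (S′.LE-resp refl (sym e) (max (h.to y) (fwd (h.to-LE y a) t))))
           , bwd (h.to-LE x b) (S′.LE-resp (sym e) refl r) )

  ≅⇒SystemEmbedding : ∀ (S S′ : SortedCompleteSystem) → structure S ≅ structure S′ →
                      SystemEmbedding S S′
  ≅⇒SystemEmbedding S S′ h = record
    { embedding = _≅_.embedding h ; coherent = ≅⇒Coherent S S′ h }

  ∘-SystemEmbedding : ∀ {S S′ S″} → SystemEmbedding S′ S″ → SystemEmbedding S S′ →
                      SystemEmbedding S S″
  ∘-SystemEmbedding f g = record
    { embedding = ∘-Embedding f.embedding g.embedding
    ; coherent  = λ a b → mk⇔ (fwd (f.coherent _ _) ∘ fwd (g.coherent a b))
                              (bwd (g.coherent a b) ∘ bwd (f.coherent _ _))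
    }
    where
    module f = SystemEmbedding f
    module g = SystemEmbedding g

  id-SystemEmbedding : ∀ {S} → SystemEmbedding S S
  id-SystemEmbedding {S} = record
    { embedding = _≅_.embedding (≅-refl {M = structure S}) ; coherent = λ _ _ → mk⇔ id id }

  ι : ∀ {S} (A : Subsystem S) → SystemEmbedding (Subsystem.system A) S
  ι {S} A = record
    { embedding = inclusion (structure S) (Subsystem.subset A) ; coherent = Subsystem.coherent A }

  -- Embeddings of sorted complete systems

  module EmbeddingProperties {B S : SortedCompleteSystem} (h : SystemEmbedding B S) where
    module B = SCS B
    module S = SCS S
    open SystemEmbedding h using (to; to-≈; to-LE; to-C; to-P; coherent) public

    ≐⇒ : ∀ {s t} (a : ∣ structure B ∣ s) (b : ∣ structure B ∣ t) → a B.≐ᴺ b → to a S.≐ᴺ to b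
    ≐⇒ a b (p , q) = fwd (coherent a b) p , fwd (coherent b a) q

    ≐⇐ : ∀ {s t} (a : ∣ structure B ∣ s) (b : ∣ structure B ∣ t) → to a S.≐ᴺ to b → a B.≐ᴺ b
    ≐⇐ a b (p , q) = bwd (coherent a b) p , bwd (coherent b a) q

    private
      -- An element b whose subgroup has index n in the group of B has an element of sort (n , J)
      -- with the same subgroup, so that this subgroup has index at most n in the group of S as
      -- well, and a count shows that the cosets from B are all of them.
      full′ : ∀ {s} (b : ∣ structure B ∣ s) g →
              Σ[ b′ ∈ ∣ structure B ∣ s ] b′ B.≐ᴺ b × g ∈ S.coset (to b′)
      full′ {k , J} b g = b⁺ i , b⁺≐ i ,
          S.coset-⊆ (to (b⁻ i)) (to (b⁺ i)) (proj₁ hb⁻≐hb⁺) in⁻ in⁺ g∈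
        where
        minimal = least em (Index≤ (B.N b)) (B.index b)
        n = proj₁ minimal
        n≤k = proj₁ (proj₂ minimal)
        cover = proj₁ (proj₂ (proj₂ minimal))
        r = proj₁ cover
        n⁺ : ℕ⁺
        n⁺ = pos n {{Index≤⇒NonZero (B.N b) cover}}

        small : ∀ i → Σ[ c ∈ ∣ structure B ∣ (n⁺ , J) ] c B.≐ᴺ b × r i ∈ B.coset c
        small i = B.mk (n⁺ , J) (B.N b) cover (B.sort b) (r i)
        b⁻ : Fin n → ∣ structure B ∣ (n⁺ , J)
        b⁻ i = proj₁ (small i)
        b⁻≐ : ∀ i → b⁻ i B.≐ᴺ b
        b⁻≐ i = proj₁ (proj₂ (small i))
        big : ∀ i → Σ[ c ∈ ∣ structure B ∣ (k , J) ] c B.≐ᴺ b × r i ∈ B.coset c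
        big i = B.mk (k , J) (B.N b) (B.index b) (B.sort b) (r i)
        b⁺ : Fin n → ∣ structure B ∣ (k , J)
        b⁺ i = proj₁ (big i)
        b⁺≐ : ∀ i → b⁺ i B.≐ᴺ b
        b⁺≐ i = proj₁ (proj₂ (big i))

        hb≐ : ∀ i → to (b⁻ i) S.≐ᴺ to b
        hb≐ i = ≐⇒ (b⁻ i) b (b⁻≐ i)

        M = S.N (to b)
        coverᴹ : Index≤ M n
        coverᴹ = Index≤-mono (S.N (to (b⁻ _))) M (proj₁ (hb≐ _))
                   (S.index (to (b⁻ (proj₁ (proj₂ cover B.ε)))))
        ρ = proj₁ coverᴹ

        -- The cell of the cover of the group of S in which the image of the i-th coset lies. Equal
        -- cells force equal images, hence equal elements of `B`, which minimality of n keeps apart;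
        -- so every cell is taken.
        f : Fin n → Fin n
        f i = proj₁ (proj₂ coverᴹ (S.rep (to (b⁻ i))))
        f∈ : ∀ i → S.rep (to (b⁻ i)) ∈ ρ (f i) · M
        f∈ i = proj₂ (proj₂ coverᴹ (S.rep (to (b⁻ i))))

        f-reflects : ∀ {i j x} → f i ≡ f j → x ∈ S.coset (to (b⁻ i)) → x ∈ S.coset (to (b⁻ j))
        f-reflects {i} {j} e p =
          proj₂ (hb≐ j) (·-⊆ M (·-⊆ M (·-sym M (f∈ j))
            (≡.subst (λ l → S.rep (to (b⁻ i)) ∈ ρ l · M) e (f∈ i))) (proj₁ (hb≐ i) p))

        f-injective : ∀ {i j} → f i ≡ f j → i ≡ j
        f-injective {i} {j} e = minimal⇒distinct (B.N b) cover (proj₂ (proj₂ (proj₂ minimal)))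
          (proj₁ (b⁻≐ i) (·-⊆ (B.N (b⁻ i)) (·-sym (B.N (b⁻ i)) (proj₂ (proj₂ (small i))))
            (proj₂ (B.≈⇒coset b⁻i≈b⁻j) (proj₂ (proj₂ (small j))))))
          where
          b⁻i≈b⁻j : b⁻ i B.≈ b⁻ j
          b⁻i≈b⁻j = bwd (to-≈ (b⁻ i) (b⁻ j)) (S.≈-intro (to (b⁻ i)) (to (b⁻ j))
            (≐⇒ (b⁻ i) (b⁻ j) ((proj₂ (b⁻≐ j) ∘ proj₁ (b⁻≐ i)) , (proj₂ (b⁻≐ i) ∘ proj₁ (b⁻≐ j))))
            (S.rep∈ (to (b⁻ i))) (f-reflects e (S.rep∈ (to (b⁻ i)))))

        hit = injective⇒surjective f f-injective (proj₁ (proj₂ coverᴹ g))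
        i = proj₁ hit
        g∈ : g ∈ S.coset (to (b⁻ i))
        g∈ = proj₂ (hb≐ i) (·-⊆ M (·-sym M (f∈ i))
               (≡.subst (λ l → g ∈ ρ l · M) (≡.sym (proj₂ hit)) (proj₂ (proj₂ coverᴹ g))))

        hb⁻≐hb⁺ : to (b⁻ i) S.≐ᴺ to (b⁺ i)
        hb⁻≐hb⁺ = ≐⇒ (b⁻ i) (b⁺ i)
          ((proj₂ (b⁺≐ i) ∘ proj₁ (b⁻≐ i)) , (proj₂ (b⁻≐ i) ∘ proj₁ (b⁺≐ i)))

        in⁺ = S.rep∈ (to (b⁺ i))
        -- The result must have the sort of `b`, whereas the count took place in index n. As n ≤ k,
        -- the relation `C` ties the two copies of the same coset together.
        in⁻ : S.rep (to (b⁺ i)) ∈ S.coset (to (b⁻ i))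
        in⁻ = S.C⇒⊆ (to (b⁺ i)) (to (b⁻ i)) (fwd (to-C (b⁺ i) (b⁻ i))
                (B.C-intro (b⁺ i) (b⁻ i) n≤k ((proj₂ (b⁻≐ i) ∘ proj₁ (b⁺≐ i)))
                  (proj₂ (proj₂ (big i))) (proj₂ (proj₂ (small i))))) in⁺

    abstract
      full : ∀ {s} (b : ∣ structure B ∣ s) g →
             Σ[ b′ ∈ ∣ structure B ∣ s ] b′ B.≐ᴺ b × g ∈ S.coset (to b′)
      full = full′

  module EmbeddingImage {B S : SortedCompleteSystem} (h : SystemEmbedding B S) where
    open EmbeddingProperties h public

    private
      coset≐ : ∀ {s t} (a : ∣ structure B ∣ s) (b : ∣ structure B ∣ t) →
               value (proj₁ s) ≥ value (proj₁ t) → a B.≐ᴺ b → B.rep b ∈ B.coset a →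
               S.coset (to a) ≐ S.coset (to b)
      coset≐ a b k p q = a⊆b ,
          S.coset-⊆ (to b) (to a) (proj₂ (≐⇒ a b p)) (a⊆b (S.rep∈ (to a))) (S.rep∈ (to a))
        where
        a⊆b : S.coset (to a) ⊆ S.coset (to b)
        a⊆b = S.C⇒⊆ (to a) (to b) (fwd (to-C a b) (B.C-intro a b k (proj₁ p) q (B.rep∈ b)))

    -- The index of `a` may be too small for `C`. A raised copy can be compared with `b`, and by
    -- coherence the images of `a` and of its copy are the same coset.
    coset-⊆⇒ : ∀ {s t} (a : ∣ structure B ∣ s) (b : ∣ structure B ∣ t) →
               B.coset a ⊆ B.coset b → S.coset (to a) ⊆ S.coset (to b)
    coset-⊆⇒ {_} {k , _} a b a⊆b z∈ =
      let a⁺ , (p , q) , r = B.raise k a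
      in S.C⇒⊆ (to a⁺) (to b)
           (fwd (to-C a⁺ b) (B.C-intro a⁺ b (m≤n+m _ _)
             (λ z∈ → B.coset-⊆⇒⊆ᴺ a b a⊆b (p z∈)) r (a⊆b (B.rep∈ a))))
           (proj₂ (coset≐ a⁺ a (m≤m+n _ _) (p , q) r) z∈)

    coset-⊆⇐ : ∀ {s t} (a : ∣ structure B ∣ s) (b : ∣ structure B ∣ t) →
               S.coset (to a) ⊆ S.coset (to b) → B.coset a ⊆ B.coset b
    coset-⊆⇐ {_} {k , _} a b a⊆b z∈ =
      let a⁺ , (p , q) , r = B.raise k a
          c⊆ , _ = coset≐ a⁺ a (m≤m+n _ _) (p , q) r
          z = S.rep∈ (to a⁺)
      in B.C⇒⊆ a⁺ b
           (bwd (to-C a⁺ b) (S.C-intro (to a⁺) (to b) (m≤n+m _ _)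
             (λ w∈ → S.coset-⊆⇒⊆ᴺ (to a) (to b) a⊆b (proj₁ (≐⇒ a⁺ a (p , q)) w∈))
             z (a⊆b (c⊆ z))))
           (B.coset-⊆ a a⁺ q (B.rep∈ a) r z∈)

    module _ {s} (b : ∣ structure B ∣ s) where
      private
        -- The isomorphism of quotient groups induced by the embedding: x and g correspond if they
        -- lie in a coset over `N b` and in its image. That every g has a partner is `full`.
        T : B.∣G∣ → S.∣G∣ → Set ℓ
        T x g = Σ[ a ∈ ∣ structure B ∣ s ] (a B.≐ᴺ b × x ∈ B.coset a × g ∈ S.coset (to a))

        T-∙ : ∀ {x y g g′} → T x g → T y g′ → T (x B.∙ y) (g S.∙ g′)
        T-∙ {x} {y} (a , (p₁ , p₂) , x∈ , g∈) (a′ , (p₁′ , p₂′) , y∈ , g′∈) =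
          let c , (q₁ , q₂) , xy∈ = B.mate b (x B.∙ y)
              aP = B.P-intro a a′ c ((λ z → p₂′ (p₁ z)) , (λ z → p₂ (p₁′ z)))
                     ((λ z → q₂ (p₁′ z)) , (λ z → p₂′ (q₁ z)))
                     (·-⊆ (B.N c) xy∈ (·-mul (B.N c) (q₂ (p₁ (·-sym (B.N a) x∈)))
                                                     (q₂ (p₁′ (·-sym (B.N a′) y∈)))))
          in c , (q₁ , q₂) , xy∈ , S.P⇒∙ (to a) (to a′) (to c) (fwd (to-P a a′ c) aP) g∈ g′∈

        T-· : ∀ {x y g g′} → T x g → T y g′ → y ∈ x · B.N b ⇔ g′ ∈ g · S.N (to b)
        T-· (a , p@(p₁ , p₂) , x∈ , g∈) (a′ , p′@(p₁′ , p₂′) , y∈ , g′∈) =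
          let q₁ , q₂ = ≐⇒ a b p
              q₁′ , q₂′ = ≐⇒ a′ b p′
          in mk⇔
            (λ y∈x → q₁ (·-⊆ (S.N (to a)) (·-sym (S.N (to a)) g∈)
              (coset-⊆⇒ a′ a (B.coset-⊆ a′ a (λ z → p₂ (p₁′ z)) y∈
                               (·-⊆ (B.N a) x∈ (p₂ y∈x))) g′∈)))
            (λ g′∈g → p₁ (·-⊆ (B.N a) (·-sym (B.N a) x∈)
              (coset-⊆⇐ a′ a (S.coset-⊆ (to a′) (to a) (λ z → q₂ (q₁′ z)) g′∈
                                (·-⊆ (S.N (to a)) g∈ (q₂ g′∈g))) y∈)))

      correspondence : Correspondence (B.N b) (S.N (to b))
      correspondence = record
        { T      = T
        ; total₁ = λ x → let a , p , q = B.mate b x in S.rep (to a) , a , p , q , S.rep∈ (to a)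
        ; total₂ = λ g → let a , p , q = full b g in B.rep a , a , p , B.rep∈ a , q
        ; T-∙    = T-∙
        ; T-·    = T-·
        ; T-resp = λ (a , p , x∈ , g∈) y∈x g′∈g →
            a , p , ·-⊆ (B.N a) x∈ (proj₂ p y∈x)
              , ·-⊆ (S.N (to a)) g∈ (proj₂ (≐⇒ a b p) g′∈g)
        }

    module Corr {s} (b : ∣ structure B ∣ s) = Correspondence (correspondence b)

    -- A subgroup is its own trivial coset: `e` is the element over `c` such that both it and its
    -- image contain the identity, and membership becomes inclusion of the coset of `a` in that of
    -- `e`.
    mem-transfer : ∀ {s t} (b : ∣ structure B ∣ s) (c : ∣ structure B ∣ t) {x g} →
                   b B.⊆ᴺ c → Corr.T b x g → x ∈ mem (B.N c) ⇔ g ∈ mem (S.N (to c))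
    mem-transfer b c b⊆c (a , (a⊆b , _) , x∈ , g∈) =
      let e , e≐c@(e⊆c , c⊆e) , ε∈ , ε∈′ = Corr.T-ε c
          he⊆hc , hc⊆he = ≐⇒ e c e≐c
          a⊆e = λ {z} z∈ → c⊆e (b⊆c (a⊆b {z} z∈))
      in mk⇔
        (λ p → he⊆hc (·-ε⁻ (S.N (to e)) (·-⊆ (S.N (to e)) (·-sym (S.N (to e)) ε∈′)
          (coset-⊆⇒ a e (B.coset-⊆ a e a⊆e x∈
            (·-⊆ (B.N e) ε∈ (·-ε⁺ (B.N e) (c⊆e p)))) g∈))))
        (λ p → e⊆c (·-ε⁻ (B.N e) (·-⊆ (B.N e) (·-sym (B.N e) ε∈)
          (coset-⊆⇐ a e (S.coset-⊆ (to a) (to e) (fwd (coherent a e) a⊆e) g∈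
            (·-⊆ (S.N (to e)) ε∈′ (·-ε⁺ (S.N (to e)) (hc⊆he p)))) x∈))))

    Hit : ∀ {s} → ∣ structure S ∣ s → Set ℓ
    Hit {s} a = Σ[ b ∈ ∣ structure B ∣ s ] to b S.≈ a

    -- The image of the embedding as a family of sorts over subgroups of the group of S. It is
    -- vacuously true if J is not in F(N), which is why most of the closure lemmas below also assume
    -- membership in `S.F`. These lemmas mirror the conditions on a sorting data, so that inductions
    -- on `Gen` can end in `Hits`.
    Hits : OpenNormalSubgroup S.G → List⁺ 𝒥 → Set ℓ
    Hits N J = ∀ k (a : ∣ structure S ∣ (k , J)) → mem (S.N a) ≐ mem N → Hit a

    Index≤-reflect : ∀ {s} (b : ∣ structure B ∣ s) {k} →
                     Index≤ {G = S.G} (S.N (to b)) k → Index≤ {G = B.G} (B.N b) k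
    Index≤-reflect b i =
      Index≤-mono (Corr.pull b (S.N (to b)) id) (B.N b)
        (λ (g , t , g∈) → bwd (mem-transfer b b id t) g∈)
        (Corr.pull-Index≤ b (S.N (to b)) id i)

    -- The index bound is known on the side of S and is carried to `B` by the correspondence. Then
    -- `B` has an element of sort (k , J) over `b`, and `full` supplies every coset.
    reach : ∀ {s} (b : ∣ structure B ∣ s) {N J} → mem (S.N (to b)) ≐ mem N → J ∈ B.F (B.N b) →
            Hits N J
    reach b {N} {J} (n , n′) j k a (p , q) =
      let index = Index≤-reflect b (Index≤-mono (S.N a) (S.N (to b)) (λ z → n′ (p z)) (S.index a))
          c , (c₁ , c₂) , _ = B.mk (k , J) (B.N b) index j B.ε
          d , (d₁ , d₂) , rep∈ = full c (S.rep a)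
          u , v = ≐⇒ d b ((λ z → c₁ (d₁ z)) , (λ z → d₂ (c₂ z)))
      in d , S.≈-intro (to d) a ((λ z → q (n (u z))) , (λ z → v (n′ (p z)))) rep∈ (S.rep∈ a)

    private
      witness : ∀ N J → J ∈ S.F N → Hits N J →
                Σ[ k ∈ ℕ⁺ ] Σ[ b ∈ ∣ structure B ∣ (k , J) ] mem (S.N (to b)) ≐ mem N
      witness N J j hits =
        let k , i = finite-index⁺ N
            a , (p₁ , p₂) , _ = S.mk (k , J) N i j S.ε
            b , b≈a = hits k a (p₁ , p₂)
            q₁ , q₂ = S.≈⇒≐ b≈a
        in k , b , ((λ z → p₁ (q₁ z)) , (λ z → q₂ (p₂ z)))

    Hits-≐ : ∀ N N′ J → mem N ≐ mem N′ → Hits N J → Hits N′ J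
    Hits-≐ N N′ J (p , q) hits k a (p′ , q′) = hits k a ((λ z → q (p′ z)) , (λ z → q′ (p z)))

    Hits-√ : ∀ N J J′ → J ∈ S.F N → Hits N J → J′ ∈ √ J → Hits N J′
    Hits-√ N J J′ j hits J⊆J′ =
      let k , b , p = witness N J j hits
      in reach b {N} p (fwd (B.F-√ (B.N b) J) (B.sort b) J⊆J′)

    Hits-whole : ∀ J → Hits whole J
    Hits-whole J =
      let b , (_ , b₂) , _ = B.mk (pos 1 , J) whole ((λ _ → B.ε) , λ g → Fin.zero , tt)
                               (B.F-whole J) B.ε
          all : ∀ g → g ∈ mem (S.N (to b))
          all g = let x , t = Corr.total₂ b g in fwd (mem-transfer b b id t) (b₂ tt)
      in reach b {whole} ((λ _ → tt) , (λ {g} _ → all g)) (B.sort b)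

    Hits-∩ : ∀ N₁ N₂ J₁ J₂ → J₁ ∈ S.F N₁ → J₂ ∈ S.F N₂ → Hits N₁ J₁ → Hits N₂ J₂ →
             Hits (N₁ ∩ᴺ N₂) (J*∩ J₁ J₂)
    Hits-∩ N₁ N₂ J₁ J₂ j₁ j₂ hits₁ hits₂ =
      let _ , b₁ , (p₁ , q₁) = witness N₁ J₁ j₁ hits₁
          _ , b₂ , (p₂ , q₂) = witness N₂ J₂ j₂ hits₂
          j = B.F-∩ (B.N b₁) (B.N b₂) J₁ J₂ (B.sort b₁) (B.sort b₂)
          k , i = finite-index⁺ (B.N b₁ ∩ᴺ B.N b₂)
          b , (p , q) , _ = B.mk (k , J*∩ J₁ J₂) (B.N b₁ ∩ᴺ B.N b₂) i j B.ε
          all : ∀ {g} → g ∈ mem N₁ → g ∈ mem N₂ → g ∈ mem (S.N (to b))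
          all {g} g∈₁ g∈₂ =
            let x , t = Corr.total₂ b g
            in fwd (mem-transfer b b id t)
                 (q ( bwd (mem-transfer b b₁ (λ z → proj₁ (p z)) t) (q₁ g∈₁)
                    , bwd (mem-transfer b b₂ (λ z → proj₂ (p z)) t) (q₂ g∈₂) ))
      in reach b {N₁ ∩ᴺ N₂}
           ( (λ z → p₁ (fwd (coherent b b₁) (λ w → proj₁ (p w)) z)
                  , p₂ (fwd (coherent b b₂) (λ w → proj₂ (p w)) z))
           , (λ (z₁ , z₂) → all z₁ z₂) ) (B.sort b)

    -- `N₂` is not given as the subgroup of an image. Its preimage `M` receives the sort `J*⊆ k J`
    -- from the sorting data of `B`, and the element obtained over `M` is sent to one over `N₂`.
    Hits-⊆ : ∀ N₁ N₂ k J → mem N₁ ⊆ mem N₂ → Index≤ N₁ (value k) → J ∈ S.F N₁ → Hits N₁ J →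
             Hits N₂ (J*⊆ k J)
    Hits-⊆ N₁ N₂ k J N₁⊆N₂ i j hits =
      let _ , b₁ , (p₁ , q₁) = witness N₁ J j hits
          hb₁⊆N₂ = λ {z} z∈ → N₁⊆N₂ (p₁ {z} z∈)
          M = Corr.pull b₁ N₂ hb₁⊆N₂
          j′ = B.F-⊆ (B.N b₁) M k J (Corr.pull-⊇ b₁ N₂ hb₁⊆N₂)
                 (Index≤-reflect b₁ (Index≤-mono N₁ (S.N (to b₁)) q₁ i)) (B.sort b₁)
          k′ , i′ = finite-index⁺ M
          b , (p , q) , _ = B.mk (k′ , J*⊆ k J) M i′ j′ B.ε
          b₁⊆b : b₁ B.⊆ᴺ b
          b₁⊆b z = q (Corr.pull-⊇ b₁ N₂ hb₁⊆N₂ z)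
          ⊆N₂ : mem (S.N (to b)) ⊆ mem N₂
          ⊆N₂ {g} g∈ =
            let x , t = Corr.total₂ b₁ g
            in fwd (Corr.pull-mem b₁ N₂ hb₁⊆N₂ t) (p (bwd (mem-transfer b₁ b b₁⊆b t) g∈))
          N₂⊆ : mem N₂ ⊆ mem (S.N (to b))
          N₂⊆ {g} g∈ =
            let x , t = Corr.total₂ b₁ g
            in fwd (mem-transfer b₁ b b₁⊆b t) (q (bwd (Corr.pull-mem b₁ N₂ hb₁⊆N₂ t) g∈))
      in reach b {N₂} (⊆N₂ , N₂⊆) (B.sort b)

    imageSubset : SubsetOf (structure S)
    imageSubset = record
      { holds    = Hit
      ; respects = λ a≈a′ (b , p) → b , Setoid.trans (S.m _) p a≈a′
      }

    image≅ : structure B ≅ substructure (structure S) imageSubset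
    image≅ = record
      { embedding = record { to = λ b → to b , b , Setoid.refl (S.m _)
                           ; to-≈ = to-≈ ; to-LE = to-LE ; to-C = to-C ; to-P = to-P }
      ; surjective = λ (a , b , p) → b , p
      }

    image : Subsystem S
    image = record
      { subset   = imageSubset
      ; subSCS   = record { G = B.G ; data-F = B.data-F ; iso = ≅-trans (≅-sym image≅) B.iso }
      ; coherent = λ (a , b , p) (a′ , b′ , p′) →
          mk⇔ {A = b B.⊆ᴺ b′} {B = a S.⊆ᴺ a′}
            (λ q z → proj₁ (S.≈⇒≐ p′) (fwd (coherent b b′) q (proj₂ (S.≈⇒≐ p) z)))
            (λ q → bwd (coherent b b′) (λ z → proj₂ (S.≈⇒≐ p′) (q (proj₁ (S.≈⇒≐ p) z))))
      }

  -- Generated subsystems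

  -- Excluded middle makes every proposition equivalent to one at level ℓ.
  abstract
    ⌊_⌋ : ∀ {a} → Set a → Set ℓ
    ⌊ A ⌋ = Lift ℓ (True (em {P = A}))

    ⌊⌋⁺ : ∀ {a} {A : Set a} → A → ⌊ A ⌋
    ⌊⌋⁺ x = lift (fromWitness x)

    ⌊⌋⁻ : ∀ {a} {A : Set a} → ⌊ A ⌋ → A
    ⌊⌋⁻ x = toWitness (lower x)

  Tuple : Structure ℓ ℓ → List Sort → Set ℓ
  Tuple M Γ = ∀ {s} → s ∈ₗ Γ → ∣ M ∣ s

  module Generated (S : SortedCompleteSystem) {Γ} (σ : Tuple (structure S) Γ) {t} (i₀ : t ∈ₗ Γ)
                   (below : ∀ {s} (i : s ∈ₗ Γ) → SortedCompleteSystem._⊆ᴺ_ S (σ i₀) (σ i)) where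
    open SCS S
    K : OpenNormalSubgroup G
    K = N (σ i₀)
    open Quotient em G K public

    -- The least sorting data on the quotient that contains the sorts of the tuple. Apart from
    -- `gen`, the constructors are the closure conditions; `up` joins upward closure in the sort
    -- with invariance under equality of subgroups. Quantifying over subgroups raises the universe
    -- level, hence `⌊_⌋` below.
    data Gen : OpenNormalSubgroup quotient → List⁺ 𝒥 → Set (lsuc ℓ) where
      gen   : ∀ {s} (i : s ∈ₗ Γ) → Gen (toQuotient (N (σ i)) (below i)) (proj₂ s)
      all   : ∀ J → Gen whole J
      up    : ∀ {N₁ N₂ J₁ J₂} → mem N₁ ≐ mem N₂ → J₂ ∈ √ J₁ → Gen N₁ J₁ → Gen N₂ J₂
      above : ∀ {N₁ N₂} k {J} → mem N₁ ⊆ mem N₂ → Index≤ N₁ (value k) → Gen N₁ J →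
              Gen N₂ (J*⊆ k J)
      meet  : ∀ {N₁ N₂ J₁ J₂} → Gen N₁ J₁ → Gen N₂ J₂ → Gen (N₁ ∩ᴺ N₂) (J*∩ J₁ J₂)

    Gen⇒F : ∀ {M J} → Gen M J → J ∈ F (fromQuotient M)
    Gen⇒F (gen i) = F-respects (id , id) (sort (σ i))
    Gen⇒F (all J) = F-respects (id , id) (F-whole J)
    Gen⇒F (up {N₁} {N₂} {J₁} p q d) = F-respects p (fwd (F-√ (fromQuotient N₁) J₁) (Gen⇒F d) q)
    Gen⇒F (above {N₁} {N₂} k {J} p i d) = F-⊆ (fromQuotient N₁) (fromQuotient N₂) k J p i (Gen⇒F d)
    Gen⇒F (meet {N₁} {N₂} {J₁} {J₂} d d′) = F-respects (id , id)
      (F-∩ (fromQuotient N₁) (fromQuotient N₂) J₁ J₂ (Gen⇒F d) (Gen⇒F d′))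

    sortingData : SortingData quotient
    sortingData = record
      { F          = λ M J → ⌊ Gen M J ⌋
      ; F-respects = λ p d → ⌊⌋⁺ (up p id (⌊⌋⁻ d))
      -- Every subgroup of the quotient contains `K`, and `K` has a sort because it comes from the
      -- lowest entry.
      ; nonEmpty   = λ M → _ , ⌊⌋⁺
          (above {N₂ = M} (proj₁ t) (kernel-⊆ M) (index (σ i₀)) (gen i₀))
      ; F-whole    = λ J → ⌊⌋⁺ (all J)
      ; F-√        = λ M J → mk⇔ {B = √ J ⊆ λ J′ → ⌊ Gen M J′ ⌋}
          (λ d p → ⌊⌋⁺ (up {N₁ = M} (id , id) p (⌊⌋⁻ d)))
          (λ p → p id)
      ; F-⊆        = λ N₁ N₂ k J p i d → ⌊⌋⁺ (above k p i (⌊⌋⁻ d))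
      ; F-∩        = λ N₁ N₂ J₁ J₂ d d′ → ⌊⌋⁺ (meet (⌊⌋⁻ d) (⌊⌋⁻ d′))
      }

    subset : SubsetOf (structure S)
    subset = record
      { holds    = λ {s} a → Σ[ p ∈ mem K ⊆ mem (N a) ] ⌊ Gen (toQuotient (N a) p) (proj₂ s) ⌋
      ; respects = λ a≈b (p , d) → (λ z → proj₁ (≈⇒≐ a≈b) (p z))
                     , ⌊⌋⁺ (up (≈⇒≐ a≈b) id (⌊⌋⁻ d))
      }

    iso-𝒮 : substructure (structure S) subset ≅ 𝒮 quotient sortingData
    iso-𝒮 = record
      { embedding = record
          { to    = λ (a , p , d) → record
              { N = toQuotient (N a) p ; index = index a ; sort = d ; g = rep a }
          ; to-≈  = λ (a , _) (b , _) → _≅_.to-≈ iso a b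
          ; to-LE = λ (a , _) (b , _) → _≅_.to-LE iso a b
          ; to-C  = λ (a , _) (b , _) → _≅_.to-C iso a b
          ; to-P  = λ (a , _) (b , _) (c , _) → _≅_.to-P iso a b c
          }
      ; surjective = λ {s} e →
          let module e = Element e
              a , (p , q) , g∈ = mk s (fromQuotient e.N) e.index (Gen⇒F (⌊⌋⁻ e.sort)) e.g
          in (a , (λ z → q (kernel-⊆ e.N z))
                , ⌊⌋⁺ (up (q , p) id (⌊⌋⁻ e.sort)))
             , (p , q) , (λ z → p (·-⊆ (N a) (·-sym (N a) g∈) z)) , (λ z → ·-⊆ (N a) g∈ (q z))
      }

    subsystem : Subsystem S
    subsystem = record
      { subset   = subset
      ; subSCS   = record { G = quotient ; data-F = sortingData ; iso = iso-𝒮 }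
      ; coherent = λ _ _ → mk⇔ id id
      }

    system : SortedCompleteSystem
    system = Subsystem.system subsystem

    generators : Tuple (structure system) Γ
    generators i = σ i , below i , ⌊⌋⁺ (gen i)

    module _ {B} (h : SystemEmbedding B system) where
      open EmbeddingImage h using (Hit; Hits; reach; Hits-≐; Hits-√; Hits-whole; Hits-∩; Hits-⊆)

      -- Induction on derivations in `Gen`, each constructor being answered by a closure property of
      -- the image. Applied to inclusions it gives finite generation, applied to other embeddings
      -- surjectivity.
      generated : (∀ {s} (i : s ∈ₗ Γ) → Hit (generators i)) →
                  ∀ {s} (a : ∣ structure system ∣ s) → Hit a
      generated hit {k , J} a = hits (⌊⌋⁻ (proj₂ (proj₂ a))) k a ((λ z → z) , (λ z → z))
        where
        hits : ∀ {N J} → Gen N J → Hits N J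
        hits (gen i) =
          let b , b≈ = hit i
          in reach b {N = toQuotient (N (σ i)) (below i)}
               (SCS.≈⇒≐ system {a = SystemEmbedding.to h b} {b = generators i} b≈) (SCS.sort B b)
        hits (all J) = Hits-whole J
        hits (up {N₁} {N₂} {J₁} {J₂} p q d) = Hits-≐ N₁ N₂ J₂ p
          (Hits-√ N₁ J₁ J₂ (⌊⌋⁺ d) (hits d) q)
        hits (above {N₁} {N₂} k {J} p i d) =
          Hits-⊆ N₁ N₂ k J p i (⌊⌋⁺ d) (hits d)
        hits (meet {N₁} {N₂} {J₁} {J₂} d d′) =
          Hits-∩ N₁ N₂ J₁ J₂ (⌊⌋⁺ d) (⌊⌋⁺ d′) (hits d) (hits d′)

    finitelyGenerated : IsFinitelyGenerated system
    finitelyGenerated = (Γ , All.tabulate generators) , λ A contains a →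
      let (b , q) , b≈a = generated (ι A)
            (λ i → (generators i , contains (generators i)
                      (i , reflexive (lookup-tabulate generators i)))
                 , reflexive {a = generators i} ≡.refl) a
      in Subsystem.respects A b≈a q
      where
      reflexive : ∀ {s} {a b : ∣ structure system ∣ s} → a ≡ b → SCS._≈_ system a b
      reflexive = Setoid.reflexive (SCS.m system _)

  -- A subsystem `A` of S′ containing the moved generators is carried to S by the inverse
  -- isomorphism; its image there contains the original generators, hence everything.
  IsFinitelyGenerated-≅ : ∀ (S S′ : SortedCompleteSystem) → structure S ≅ structure S′ →
                          IsFinitelyGenerated S → IsFinitelyGenerated S′
  IsFinitelyGenerated-≅ S S′ h ((Γ , ρ) , generates) = (Γ , ρ′) , λ A contains a →
    let e = ∘-SystemEmbedding {system A} {S′} {S} (≅⇒SystemEmbedding S′ S (≅-sym h)) (ι A)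
        (b , q) , p = generates (EmbeddingImage.image e)
          (λ a (i , r) →
            ( h.to (All.lookup ρ i)
            , contains (h.to (All.lookup ρ i))
                (i , Setoid.reflexive (S′.m _) (lookup-tabulate (h.to ∘ All.lookup ρ) i)) )
            , Setoid.trans (S.m _)
                (bwd (h.to-≈ _ _) (proj₂ (h.surjective (h.to (All.lookup ρ i))))) r)
          (h⁻¹.to a)
    in Subsystem.respects A (bwd (h⁻¹.to-≈ b a) p) q
    where
    module S = SCS S
    module S′ = SCS S′
    module h = _≅_ h
    module h⁻¹ = _≅_ (≅-sym h)
    open Subsystem using (system)
    ρ′ : Assignment (structure S′) Γ
    ρ′ = All.tabulate (h.to ∘ All.lookup ρ)

  -- Atomic diagrams and nice tuples

  data Atom (Γ : List Sort) : Set ℓ where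
    eqᵃ    : ∀ {s} → s ∈ₗ Γ → s ∈ₗ Γ → Atom Γ
    leᵃ cᵃ : ∀ {s t} → s ∈ₗ Γ → t ∈ₗ Γ → Atom Γ
    pᵃ     : ∀ {s} → s ∈ₗ Γ → s ∈ₗ Γ → s ∈ₗ Γ → Atom Γ

  module _ (M : Structure ℓ ℓ) where
    open Structure M hiding (∣_∣)

    Holds : ∀ {Γ} → Tuple M Γ → Atom Γ → Set ℓ
    Holds σ (eqᵃ i j)  = σ i ≈ σ j
    Holds σ (leᵃ i j)  = LE (σ i) (σ j)
    Holds σ (cᵃ i j)   = C (σ i) (σ j)
    Holds σ (pᵃ i j k) = P (σ i) (σ j) (σ k)

    -- The counterpart of a nice finite presystem: a tuple with a lowest entry, all of whose
    -- cosets are entries as well.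
    record Top {Γ} (σ : Tuple M Γ) {t} (i₀ : t ∈ₗ Γ) : Set ℓ where
      field
        lowest : ∀ {s} (i : s ∈ₗ Γ) → LE (σ i₀) (σ i)
        mates : ∀ (y : ∣ M ∣ t) → LE (σ i₀) y → LE y (σ i₀) → Σ[ i ∈ t ∈ₗ Γ ] σ i ≈ y

  SameAtoms : (M M′ : Structure ℓ ℓ) → ∀ {Γ} → Tuple M Γ → Tuple M′ Γ → Set ℓ
  SameAtoms M M′ {Γ} σ σ′ = ∀ (α : Atom Γ) → Holds M σ α ⇔ Holds M′ σ′ α

  module TopProperties (S : SortedCompleteSystem) {Γ} {σ : Tuple (structure S) Γ} {t}
                       {i₀ : t ∈ₗ Γ} (top : Top (structure S) σ i₀) where
    open SCS S
    open Top top

    below : ∀ {s} (i : s ∈ₗ Γ) → σ i₀ ⊆ᴺ σ i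
    below i = LE⇒⊆ᴺ (σ i₀) (σ i) (lowest i)

    mate∈ : ∀ g → Σ[ i ∈ t ∈ₗ Γ ] σ i ≐ᴺ σ i₀ × g ∈ coset (σ i)
    mate∈ g =
      let a , (p , q) , g∈ = mate (σ i₀) g
          i , e = mates a (LE-intro (σ i₀) a ≤-refl q) (LE-intro a (σ i₀) ≤-refl p)
          r , r′ = ≈⇒≐ e
      in i , ((λ z → p (r z)) , (λ z → r′ (q z))) , proj₂ (≈⇒coset e) g∈

  -- Extending a map of nice tuples to the generated systems

  module _ (S₁ S₂ : SortedCompleteSystem) where
    private
      module S₁ = SCS S₁
      module S₂ = SCS S₂

    module _
      (φ : ∀ {s} → ∣ structure S₁ ∣ s → ∣ structure S₂ ∣ s)
      (T : S₂.∣G∣ → S₁.∣G∣ → Set ℓ)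
      (total₁ : ∀ x → ∃[ g ] T x g)
      (total₂ : ∀ g → ∃[ x ] T x g)
      (T-∙ : ∀ {x y g h} → T x g → T y h → T (x S₂.∙ y) (g S₁.∙ h))
      (N-match : ∀ {s} (a : ∣ structure S₁ ∣ s) {x g} → T x g →
                 g ∈ mem (S₁.N a) ⇔ x ∈ mem (S₂.N (φ a)))
      (coset-match : ∀ {s} (a : ∣ structure S₁ ∣ s) {x g} → T x g →
                     g ∈ S₁.coset a ⇔ x ∈ S₂.coset (φ a))
      where
      private
        N⇒ : ∀ {s t} (a : ∣ structure S₁ ∣ s) (b : ∣ structure S₁ ∣ t) →
             a S₁.⊆ᴺ b → φ a S₂.⊆ᴺ φ b
        N⇒ a b a⊆b {x} x∈ =
          let g , u = total₁ x in fwd (N-match b u) (a⊆b (bwd (N-match a u) x∈))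

        N⇐ : ∀ {s t} (a : ∣ structure S₁ ∣ s) (b : ∣ structure S₁ ∣ t) →
             φ a S₂.⊆ᴺ φ b → a S₁.⊆ᴺ b
        N⇐ a b a⊆b {g} g∈ =
          let x , u = total₂ g in bwd (N-match b u) (a⊆b (fwd (N-match a u) g∈))

        C⇒ : ∀ {s t} (a : ∣ structure S₁ ∣ s) (b : ∣ structure S₁ ∣ t) →
             S₁.coset a ⊆ S₁.coset b → S₂.coset (φ a) ⊆ S₂.coset (φ b)
        C⇒ a b a⊆b {x} x∈ =
          let g , u = total₁ x in fwd (coset-match b u) (a⊆b (bwd (coset-match a u) x∈))

        C⇐ : ∀ {s t} (a : ∣ structure S₁ ∣ s) (b : ∣ structure S₁ ∣ t) →
             S₂.coset (φ a) ⊆ S₂.coset (φ b) → S₁.coset a ⊆ S₁.coset b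
        C⇐ a b a⊆b {g} g∈ =
          let x , u = total₂ g in bwd (coset-match b u) (a⊆b (fwd (coset-match a u) g∈))

        to-P : ∀ {s} (a b d : ∣ structure S₁ ∣ s) → S₁.P a b d ⇔ S₂.P (φ a) (φ b) (φ d)
        to-P a b d = mk⇔
          (λ p →
            let (ab , ba) , (bd , db) = S₁.P⇒≐ a b d p
                g , u = total₁ (S₂.rep (φ a))
                h , v = total₁ (S₂.rep (φ b))
            in S₂.P-intro (φ a) (φ b) (φ d) (N⇒ a b ab , N⇒ b a ba) (N⇒ b d bd , N⇒ d b db)
                 (fwd (coset-match d (T-∙ u v))
                   (S₁.P⇒∙ a b d p (bwd (coset-match a u) (S₂.rep∈ (φ a)))
                                   (bwd (coset-match b v) (S₂.rep∈ (φ b))))))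
          (λ p →
            let (ab , ba) , (bd , db) = S₂.P⇒≐ (φ a) (φ b) (φ d) p
                x , u = total₂ (S₁.rep a)
                y , v = total₂ (S₁.rep b)
            in S₁.P-intro a b d (N⇐ a b ab , N⇐ b a ba) (N⇐ b d bd , N⇐ d b db)
                 (bwd (coset-match d (T-∙ u v))
                   (S₂.P⇒∙ (φ a) (φ b) (φ d) p (fwd (coset-match a u) (S₁.rep∈ a))
                                               (fwd (coset-match b v) (S₁.rep∈ b)))))

      -- Given the sorts, every relation of the language, and coherence too, speaks only of products
      -- and of membership in subgroups and cosets. A relation that is total on both sides and
      -- matches these suffices.
      matchingEmbedding : SystemEmbedding S₁ S₂
      matchingEmbedding = record
        { embedding = record
            { to    = φ
            ; to-≈  = λ a b → mk⇔
                (λ p → let n , n′ = S₁.≈⇒≐ {a = a} {b} p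
                           c = proj₁ (S₁.≈⇒coset {a = a} {b} p)
                       in S₂.≈-intro (φ a) (φ b) (N⇒ a b n , N⇒ b a n′)
                            (S₂.rep∈ (φ a)) (C⇒ a b c (S₂.rep∈ (φ a))))
                (λ p → let n , n′ = S₂.≈⇒≐ {a = φ a} {φ b} p
                           c = proj₁ (S₂.≈⇒coset {a = φ a} {φ b} p)
                       in S₁.≈-intro a b (N⇐ a b n , N⇐ b a n′)
                            (S₁.rep∈ a) (C⇐ a b c (S₁.rep∈ a)))
            ; to-LE = λ a b → mk⇔
                (λ p → S₂.LE-intro (φ a) (φ b) (S₁.LE⇒≥ a b p) (N⇒ a b (S₁.LE⇒⊆ᴺ a b p)))
                (λ p → S₁.LE-intro a b (S₂.LE⇒≥ (φ a) (φ b) p) (N⇐ a b (S₂.LE⇒⊆ᴺ (φ a) (φ b) p)))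
            ; to-C  = λ a b → mk⇔
                (λ p → S₂.C-⊆ (φ a) (φ b) (S₁.C⇒≥ a b p) (C⇒ a b (S₁.C⇒⊆ a b p)))
                (λ p → S₁.C-⊆ a b (S₂.C⇒≥ (φ a) (φ b) p) (C⇐ a b (S₂.C⇒⊆ (φ a) (φ b) p)))
            ; to-P  = to-P
            }
        ; coherent = λ a b → mk⇔ {A = a S₁.⊆ᴺ b} {B = φ a S₂.⊆ᴺ φ b} (N⇒ a b) (N⇐ a b)
        }

  module Extension (S₁ S₂ : SortedCompleteSystem) {Γ₁ Γ₂}
    {d : Tuple (structure S₁) Γ₁} {c : Tuple (structure S₂) Γ₂} (f : ∀ {s} → s ∈ₗ Γ₁ → s ∈ₗ Γ₂)
    {t} {i₀ : t ∈ₗ Γ₁}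
    (top-d : Top (structure S₁) d i₀) (top-c : Top (structure S₂) (λ i → c (f i)) i₀)
    (same : SameAtoms (structure S₁) (structure S₂) d (λ i → c (f i)))
    {t₂} {j₀ : t₂ ∈ₗ Γ₂}
    (below-c : ∀ {s} (j : s ∈ₗ Γ₂) → SortedCompleteSystem._⊆ᴺ_ S₂ (c j₀) (c j))
    where
    private
      module S₁ = SCS S₁
      module S₂ = SCS S₂
      module D = TopProperties S₁ {σ = d} top-d
      module E = TopProperties S₂ {σ = λ i → c (f i)} top-c
      module ⟨d⟩ = Generated S₁ d i₀ D.below
      module ⟨c⟩ = Generated S₂ c j₀ below-c

      e : Tuple (structure S₂) Γ₁
      e i = c (f i)

      -- Read off the entries that list the cosets of the lowest entry. It runs from S₂ to S₁ so
      -- that `pull` moves subgroups in the direction of the embedding, from the system of `d` to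
      -- that of `c`.
      T : S₂.∣G∣ → S₁.∣G∣ → Set ℓ
      T x g = Σ[ j ∈ t ∈ₗ Γ₁ ]
        (d j S₁.≐ᴺ d i₀ × e j S₂.≐ᴺ e i₀ × x ∈ S₂.coset (e j) × g ∈ S₁.coset (d j))

      ≐⇒ : ∀ {s} (i j : s ∈ₗ Γ₁) → d i S₁.≐ᴺ d j → e i S₂.≐ᴺ e j
      ≐⇒ i j (p , q) =
          S₂.LE⇒⊆ᴺ (e i) (e j) (fwd (same (leᵃ i j)) (S₁.LE-intro (d i) (d j) ≤-refl p))
        , S₂.LE⇒⊆ᴺ (e j) (e i) (fwd (same (leᵃ j i)) (S₁.LE-intro (d j) (d i) ≤-refl q))

      ≐⇐ : ∀ {s} (i j : s ∈ₗ Γ₁) → e i S₂.≐ᴺ e j → d i S₁.≐ᴺ d j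
      ≐⇐ i j (p , q) =
          S₁.LE⇒⊆ᴺ (d i) (d j) (bwd (same (leᵃ i j)) (S₂.LE-intro (e i) (e j) ≤-refl p))
        , S₁.LE⇒⊆ᴺ (d j) (d i) (bwd (same (leᵃ j i)) (S₂.LE-intro (e j) (e i) ≤-refl q))

      T-∙ : ∀ {x y g g′} → T x g → T y g′ → T (x S₂.∙ y) (g S₁.∙ g′)
      T-∙ {g = g} {g′} (j , (p₁ , p₂) , q , x∈ , g∈) (j′ , (p₁′ , p₂′) , q′ , y∈ , g′∈) =
        let k , (r₁ , r₂) , gg′∈ = D.mate∈ (g S₁.∙ g′)
            P₁ = S₁.P-intro (d j) (d j′) (d k)
                   ((λ z → p₂′ (p₁ z)) , (λ z → p₂ (p₁′ z)))
                   ((λ z → r₂ (p₁′ z)) , (λ z → p₂′ (r₁ z)))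
                   (·-⊆ (S₁.N (d k)) gg′∈ (·-mul (S₁.N (d k))
                     (r₂ (p₁ (·-sym (S₁.N (d j)) g∈))) (r₂ (p₁′ (·-sym (S₁.N (d j′)) g′∈)))))
        in k , (r₁ , r₂) , ≐⇒ k i₀ (r₁ , r₂)
             , S₂.P⇒∙ (e j) (e j′) (e k) (fwd (same (pᵃ j j′ k)) P₁) x∈ y∈ , gg′∈

      T-· : ∀ {x y g g′} → T x g → T y g′ → y ∈ x · S₂.N (e i₀) ⇔ g′ ∈ g · S₁.N (d i₀)
      T-· (j , (p₁ , p₂) , (q₁ , q₂) , x∈ , g∈) (j′ , (p₁′ , p₂′) , (q₁′ , q₂′) , y∈ , g′∈) = mk⇔
        (λ y∈x →
          let ej′≈ej = S₂.≈-intro (e j′) (e j) ((λ z → q₂ (q₁′ z)) , (λ z → q₂′ (q₁ z))) y∈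
                         (·-⊆ (S₂.N (e j)) x∈ (q₂ y∈x))
              dj′≈dj = bwd (same (eqᵃ j′ j)) ej′≈ej
          in p₁ (·-⊆ (S₁.N (d j)) (·-sym (S₁.N (d j)) g∈) (proj₁ (S₁.≈⇒coset dj′≈dj) g′∈)))
        (λ g′∈g →
          let dj′≈dj = S₁.≈-intro (d j′) (d j) ((λ z → p₂ (p₁′ z)) , (λ z → p₂′ (p₁ z))) g′∈
                         (·-⊆ (S₁.N (d j)) g∈ (p₂ g′∈g))
              ej′≈ej = fwd (same (eqᵃ j′ j)) dj′≈dj
          in q₁ (·-⊆ (S₂.N (e j)) (·-sym (S₂.N (e j)) x∈) (proj₁ (S₂.≈⇒coset ej′≈ej) y∈)))

      correspondence : Correspondence (S₂.N (e i₀)) (S₁.N (d i₀))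
      correspondence = record
        { T      = T
        ; total₁ = λ x → let j , p , x∈ = E.mate∈ x
                         in S₁.rep (d j) , j , ≐⇐ j i₀ p , p , x∈ , S₁.rep∈ (d j)
        ; total₂ = λ g → let j , p , g∈ = D.mate∈ g
                         in S₂.rep (e j) , j , p , ≐⇒ j i₀ p , S₂.rep∈ (e j) , g∈
        ; T-∙    = T-∙
        ; T-·    = T-·
        ; T-resp = λ (j , p , q , x∈ , g∈) y∈x g′∈g →
            j , p , q , ·-⊆ (S₂.N (e j)) x∈ (proj₂ q y∈x) , ·-⊆ (S₁.N (d j)) g∈ (proj₂ p g′∈g)
        }

      module T = Correspondence correspondence
      open T using (pull; pull-mem; pull-·; pull-⊇; pull-Index≤)

      -- Here it matters that `Top` asks for `LE` and not just for inclusion: the inequality of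
      -- indices lets the atom `cᵃ j i` decide whether the coset of entry j lies in that of entry i.
      T-coset : ∀ {s} (i : s ∈ₗ Γ₁) {x g} → T x g → x ∈ S₂.coset (e i) ⇔ g ∈ S₁.coset (d i)
      T-coset i (j , (p , _) , (q , _) , x∈ , g∈) = mk⇔
        (λ x∈′ → S₁.C⇒⊆ (d j) (d i) (bwd (same (cᵃ j i))
          (S₂.C-intro (e j) (e i) (S₂.LE⇒≥ (e i₀) (e i) (Top.lowest top-c i))
            (λ z → E.below i (q z)) x∈ x∈′)) g∈)
        (λ g∈′ → S₂.C⇒⊆ (e j) (e i) (fwd (same (cᵃ j i))
          (S₁.C-intro (d j) (d i) (S₁.LE⇒≥ (d i₀) (d i) (Top.lowest top-d i))
            (λ z → D.below i (p z)) g∈ g∈′)) x∈)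

      T-N : ∀ {s} (i : s ∈ₗ Γ₁) {x g} → T x g → x ∈ mem (S₂.N (e i)) ⇔ g ∈ mem (S₁.N (d i))
      T-N i {x} {g} u =
        let y , v = T.total₂ (S₁.rep (d i))
            y∈ = bwd (T-coset i v) (S₁.rep∈ (d i))
        in mk⇔
          (λ x∈ → ·-absorb⁻ (S₁.N (d i)) (fwd (T-coset i (T-∙ v u))
            (·-⊆ (S₂.N (e i)) y∈ (·-absorb (S₂.N (e i)) x∈))))
          (λ g∈ → ·-absorb⁻ (S₂.N (e i)) (·-⊆ (S₂.N (e i)) (·-sym (S₂.N (e i)) y∈)
            (bwd (T-coset i (T-∙ v u)) (·-absorb (S₁.N (d i)) g∈))))

      Pull : OpenNormalSubgroup ⟨d⟩.quotient → OpenNormalSubgroup ⟨c⟩.quotient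
      Pull M = ⟨c⟩.toQuotient (pull (⟨d⟩.fromQuotient M) (⟨d⟩.kernel-⊆ M))
        (λ z → pull-⊇ (⟨d⟩.fromQuotient M) (⟨d⟩.kernel-⊆ M) (below-c (f i₀) z))

      Matches : OpenNormalSubgroup ⟨d⟩.quotient → OpenNormalSubgroup ⟨c⟩.quotient → Set ℓ
      Matches M M′ = ∀ {x g} → T x g → x ∈ mem M′ ⇔ g ∈ mem M

      Pull-matches : ∀ M → Matches M (Pull M)
      Pull-matches M = pull-mem (⟨d⟩.fromQuotient M) (⟨d⟩.kernel-⊆ M)

      Matches-⊆ : ∀ {M₁ M₂ M₁′ M₂′} → Matches M₁ M₁′ → Matches M₂ M₂′ → mem M₁ ⊆ mem M₂ →
                  mem M₁′ ⊆ mem M₂′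
      Matches-⊆ m₁ m₂ p {x} z = let g , u = T.total₁ x in bwd (m₂ u) (p (fwd (m₁ u) z))

      -- Stated for every matching `M′` so that the induction passes through `up`; for `above` and
      -- `meet` the intermediate subgroups are moved by `Pull`.
      Gen-match : ∀ {M J} → ⟨d⟩.Gen M J → ∀ M′ → Matches M M′ → ⟨c⟩.Gen M′ J
      Gen-match (⟨d⟩.gen i) M′ m = ⟨c⟩.up
        ( (λ {x} z → let g , u = T.total₁ x in bwd (m u) (fwd (T-N i u) z))
        , (λ {x} z → let g , u = T.total₁ x in bwd (T-N i u) (fwd (m u) z)) )
        id (⟨c⟩.gen (f i))
      Gen-match (⟨d⟩.all J) M′ m = ⟨c⟩.up
        ((λ {x} _ → let g , u = T.total₁ x in bwd (m u) tt) , (λ _ → tt))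
        id (⟨c⟩.all J)
      Gen-match (⟨d⟩.up {N₁} {N₂} (p , q) r δ) M′ m = ⟨c⟩.up (id , id) r
        (Gen-match δ M′ (λ u → mk⇔ (λ z → q (fwd (m u) z)) (λ z → bwd (m u) (p z))))
      Gen-match (⟨d⟩.above {N₁} {N₂} k p i δ) M′ m = ⟨c⟩.above {N₁ = Pull N₁} {M′} k
        (Matches-⊆ {N₁} {N₂} {Pull N₁} {M′} (Pull-matches N₁) m p)
        (pull-Index≤ (⟨d⟩.fromQuotient N₁) (⟨d⟩.kernel-⊆ N₁) i)
        (Gen-match δ (Pull N₁) (Pull-matches N₁))
      Gen-match (⟨d⟩.meet {N₁} {N₂} δ δ′) M′ m = ⟨c⟩.up {N₁ = Pull N₁ ∩ᴺ Pull N₂} {M′}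
        ( (λ {x} (z , w) → let g , u = T.total₁ x
                           in bwd (m u) (fwd (Pull-matches N₁ u) z , fwd (Pull-matches N₂ u) w))
        , (λ {x} z → let g , u = T.total₁ x
                         v , w = fwd (m u) z
                     in bwd (Pull-matches N₁ u) v , bwd (Pull-matches N₂ u) w) )
        id (⟨c⟩.meet (Gen-match δ (Pull N₁) (Pull-matches N₁))
                     (Gen-match δ′ (Pull N₂) (Pull-matches N₂)))

      module A₁ = SCS ⟨d⟩.system
      module A₂ = SCS ⟨c⟩.system

      member : ∀ {s M} → ⟨d⟩.Gen M (proj₂ s) → (b : ∣ structure S₂ ∣ s) →
               (∀ {x g} → T x g → x ∈ mem (S₂.N b) ⇔ g ∈ mem M) → SubsetOf.holds ⟨c⟩.subset b
      member {_} {M} δ b m = ⊆b , ⌊⌋⁺ (Gen-match δ (⟨c⟩.toQuotient (S₂.N b) ⊆b) m)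
        where
        ⊆b : mem ⟨c⟩.K ⊆ mem (S₂.N b)
        ⊆b z = let g , u = T.total₁ _
               in bwd (m u) (fwd (Pull-matches M u) (⟨c⟩.kernel-⊆ (Pull M) z))

      move : ∀ {s} M → Index≤ {G = ⟨d⟩.quotient} M (value (proj₁ s)) → ⟨d⟩.Gen M (proj₂ s) → ∀ y →
             Σ[ b ∈ ∣ structure ⟨c⟩.system ∣ s ] Matches M (A₂.N b) × y ∈ A₂.coset b
      move {s} M i δ y =
        let b , (p , q) , y∈ = S₂.mk s (⟨c⟩.fromQuotient (Pull M))
              (pull-Index≤ (⟨d⟩.fromQuotient M) (⟨d⟩.kernel-⊆ M) i)
              (⟨c⟩.Gen⇒F (Gen-match δ (Pull M) (Pull-matches M))) y
        in conclude b p q y∈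
        where
        conclude : (b : ∣ structure S₂ ∣ s) → mem (S₂.N b) ⊆ mem (Pull M) →
                   mem (Pull M) ⊆ mem (S₂.N b) → y ∈ S₂.coset b →
                   Σ[ b ∈ ∣ structure ⟨c⟩.system ∣ s ] Matches M (A₂.N b) × y ∈ A₂.coset b
        conclude b p q y∈ = (b , member δ b m) , (λ {x} {g} → m {x} {g}) , y∈
          where
          m : ∀ {x g} → T x g → x ∈ mem (S₂.N b) ⇔ g ∈ mem M
          m u = mk⇔ (λ z → fwd (Pull-matches M u) (p z)) (λ z → q (bwd (Pull-matches M u) z))

      abstract
        transport : ∀ {s} (a : ∣ structure ⟨d⟩.system ∣ s) →
          Σ[ b ∈ ∣ structure ⟨c⟩.system ∣ s ]
            Matches (A₁.N a) (A₂.N b) × proj₁ (T.total₂ (A₁.rep a)) ∈ A₂.coset b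
        transport {s} a =
          move (A₁.N a) (A₁.index a) (⌊⌋⁻ (A₁.sort a)) (proj₁ (T.total₂ (A₁.rep a)))

      φ : ∀ {s} → ∣ structure ⟨d⟩.system ∣ s → ∣ structure ⟨c⟩.system ∣ s
      φ a = proj₁ (transport a)

      N-match : ∀ {s} (a : ∣ structure ⟨d⟩.system ∣ s) {x g} → T x g →
                g ∈ mem (A₁.N a) ⇔ x ∈ mem (A₂.N (φ a))
      N-match a u = let m = proj₁ (proj₂ (transport a)) u in mk⇔ (bwd m) (fwd m)

      -- Dividing by the representative of `a` and by its partner reduces cosets to subgroups.
      coset-match : ∀ {s} (a : ∣ structure ⟨d⟩.system ∣ s) {x g} → T x g →
                    g ∈ A₁.coset a ⇔ x ∈ A₂.coset (φ a)
      coset-match a {x} {g} u =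
        let b , m , y∈ = transport a
            v = T.T-∙ (T.T-⁻¹ (proj₂ (T.total₂ (A₁.rep a)))) u
        in mk⇔ (λ z → ·-⊆ (A₂.N b) y∈ (bwd (m v) z))
               (λ z → fwd (m v) (·-⊆ (A₂.N b) (·-sym (A₂.N b) y∈) z))

      φ-unique : ∀ {s} (a : ∣ structure ⟨d⟩.system ∣ s) (b : ∣ structure ⟨c⟩.system ∣ s) →
        (∀ {x g} → T x g → x ∈ mem (A₂.N b) ⇔ g ∈ mem (A₁.N a)) →
        (∀ {x g} → T x g → x ∈ A₂.coset b ⇔ g ∈ A₁.coset a) → φ a A₂.≈ b
      φ-unique a b m m′ = A₂.≈-intro (φ a) b
        ( (λ {y} z → let _ , u = T.total₁ y in bwd (m u) (bwd (N-match a u) z))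
        , (λ {y} z → let _ , u = T.total₁ y in fwd (N-match a u) (fwd (m u) z)) )
        (A₂.rep∈ (φ a))
        (let _ , u = T.total₁ (A₂.rep (φ a))
         in bwd (m′ u) (bwd (coset-match a u) (A₂.rep∈ (φ a))))

    extension : SystemEmbedding ⟨d⟩.system ⟨c⟩.system
    extension = matchingEmbedding ⟨d⟩.system ⟨c⟩.system φ T T.total₁ T.total₂ T-∙
                  N-match coset-match

    extension-extends : ∀ {s} (i : s ∈ₗ Γ₁) →
      SCS._≈_ ⟨c⟩.system (SystemEmbedding.to extension (⟨d⟩.generators i)) (⟨c⟩.generators (f i))
    extension-extends i =
      φ-unique (⟨d⟩.generators i) (⟨c⟩.generators (f i)) (T-N i) (T-coset i)

  module _ (M : Structure ℓ ℓ) where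
    open Structure M hiding (∣_∣)

    module _ {s : Sort} where
      open Setoid (m s) public using ()
        renaming (refl to ≈-refl; sym to ≈-sym; trans to ≈-trans; reflexive to ≈-reflexive)

    module _ {Γ} {σ τ : Tuple M Γ} (σ≈τ : ∀ {s} (i : s ∈ₗ Γ) → σ i ≈ τ i) where

      SameAtoms-≈ : SameAtoms M M σ τ
      SameAtoms-≈ (eqᵃ i j) = mk⇔
        (λ p → ≈-trans (≈-sym (σ≈τ i)) (≈-trans p (σ≈τ j)))
        (λ p → ≈-trans (σ≈τ i) (≈-trans p (≈-sym (σ≈τ j))))
      SameAtoms-≈ (leᵃ i j) = mk⇔ (LE-resp (σ≈τ i) (σ≈τ j))
                                  (LE-resp (≈-sym (σ≈τ i)) (≈-sym (σ≈τ j)))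
      SameAtoms-≈ (cᵃ i j) = mk⇔ (C-resp (σ≈τ i) (σ≈τ j))
                                 (C-resp (≈-sym (σ≈τ i)) (≈-sym (σ≈τ j)))
      SameAtoms-≈ (pᵃ i j k) = mk⇔ (P-resp (σ≈τ i) (σ≈τ j) (σ≈τ k))
                                   (P-resp (≈-sym (σ≈τ i)) (≈-sym (σ≈τ j)) (≈-sym (σ≈τ k)))

      Top-≈ : ∀ {t} {i₀ : t ∈ₗ Γ} → Top M σ i₀ → Top M τ i₀
      Top-≈ {i₀ = i₀} top = record
        { lowest = λ i → LE-resp (σ≈τ i₀) (σ≈τ i) (Top.lowest top i)
        ; mates  = λ y p q →
            let i , e = Top.mates top y (LE-resp (≈-sym (σ≈τ i₀)) ≈-refl p)
                                        (LE-resp ≈-refl (≈-sym (σ≈τ i₀)) q)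
            in i , ≈-trans (≈-sym (σ≈τ i)) e
        }

    -- By convention the lowest entry comes first. The empty tuple counts as nice so that the
    -- back-and-forth can start.
    Nice : ∀ {Γ} → Tuple M Γ → Set ℓ
    Nice {[]}    σ = ⊤
    Nice {_ ∷ _} σ = Top M σ (here ≡.refl)

    Nice-≈ : ∀ {Γ} {σ τ : Tuple M Γ} → (∀ {s} (i : s ∈ₗ Γ) → σ i ≈ τ i) → Nice σ → Nice τ
    Nice-≈ {[]}    σ≈τ _   = tt
    Nice-≈ {_ ∷ _} σ≈τ top = Top-≈ σ≈τ top

  module _ {M M′ M″ : Structure ℓ ℓ} {Γ} {σ : Tuple M Γ} {τ : Tuple M′ Γ} {υ : Tuple M″ Γ} where
    SameAtoms-trans : SameAtoms M M′ σ τ → SameAtoms M′ M″ τ υ → SameAtoms M M″ σ υ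
    SameAtoms-trans p q α = mk⇔ (λ z → fwd (q α) (fwd (p α) z)) (λ z → bwd (p α) (bwd (q α) z))

  SameAtoms-sym : ∀ {M M′ : Structure ℓ ℓ} {Γ} {σ : Tuple M Γ} {τ : Tuple M′ Γ} →
                  SameAtoms M M′ σ τ → SameAtoms M′ M τ σ
  SameAtoms-sym p α = mk⇔ (bwd (p α)) (fwd (p α))

  SameAtoms-rename : ∀ {M M′ : Structure ℓ ℓ} {Γ Δ} {σ : Tuple M Δ} {τ : Tuple M′ Δ}
                     (f : ∀ {s} → s ∈ₗ Γ → s ∈ₗ Δ) → SameAtoms M M′ σ τ →
                     SameAtoms M M′ (λ i → σ (f i)) (λ i → τ (f i))
  SameAtoms-rename f p (eqᵃ i j)  = p (eqᵃ (f i) (f j))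
  SameAtoms-rename f p (leᵃ i j)  = p (leᵃ (f i) (f j))
  SameAtoms-rename f p (cᵃ i j)   = p (cᵃ (f i) (f j))
  SameAtoms-rename f p (pᵃ i j k) = p (pᵃ (f i) (f j) (f k))

  SameAtoms-image : ∀ {M M′ : Structure ℓ ℓ} (h : Embedding M M′) {Γ} (σ : Tuple M Γ) →
                    SameAtoms M M′ σ (λ i → Embedding.to h (σ i))
  SameAtoms-image h σ (eqᵃ i j)  = Embedding.to-≈ h (σ i) (σ j)
  SameAtoms-image h σ (leᵃ i j)  = Embedding.to-LE h (σ i) (σ j)
  SameAtoms-image h σ (cᵃ i j)   = Embedding.to-C h (σ i) (σ j)
  SameAtoms-image h σ (pᵃ i j k) = Embedding.to-P h (σ i) (σ j) (σ k)

  -- By `full`, no coset of the image of the lowest entry is new in S.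
  Top-image : ∀ {B S : SortedCompleteSystem} (h : SystemEmbedding B S) {Γ}
              {σ : Tuple (structure B) Γ} {t} {i₀ : t ∈ₗ Γ} → Top (structure B) σ i₀ →
              Top (structure S) (λ i → SystemEmbedding.to h (σ i)) i₀
  Top-image {B} {S} h {Γ} {σ} {t} {i₀} top = record
    { lowest = λ i → fwd (to-LE (σ i₀) (σ i)) (Top.lowest top i)
    ; mates  = λ y p q → mate y (S.LE⇒⊆ᴺ (to (σ i₀)) y p) (S.LE⇒⊆ᴺ y (to (σ i₀)) q)
    }
    where
    open EmbeddingProperties h
    near : ∀ y b → b B.≐ᴺ σ i₀ → to b S.≈ y → Σ[ i ∈ t ∈ₗ Γ ] to (σ i) S.≈ y
    near y b (b⊆ , ⊆b) b≈y =
      let i , e = Top.mates top b (B.LE-intro (σ i₀) b ≤-refl ⊆b) (B.LE-intro b (σ i₀) ≤-refl b⊆)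
      in i , Setoid.trans (S.m t) (fwd (to-≈ (σ i) b) e) b≈y

    match : ∀ y b → to (σ i₀) S.⊆ᴺ y → y S.⊆ᴺ to (σ i₀) → b B.≐ᴺ σ i₀ →
            S.rep y ∈ S.coset (to b) → to b S.≈ y
    match y b p q b≐ y∈ =
      let u , v = ≐⇒ b (σ i₀) b≐
      in S.≈-intro (to b) y ((λ z → p (u z)) , (λ z → v (q z))) y∈ (S.rep∈ y)

    mate : ∀ y → to (σ i₀) S.⊆ᴺ y → y S.⊆ᴺ to (σ i₀) → Σ[ i ∈ t ∈ₗ Γ ] to (σ i) S.≈ y
    mate y p q =
      let b , b≐ , y∈ = full (σ i₀) (S.rep y)
      in near y b b≐ (match y b p q b≐ y∈)

  Nice-image : ∀ {B S : SortedCompleteSystem} (h : SystemEmbedding B S) {Γ}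
               {σ : Tuple (structure B) Γ} → Nice (structure B) σ →
               Nice (structure S) (λ i → SystemEmbedding.to h (σ i))
  Nice-image h {[]}    _   = tt
  Nice-image h {_ ∷ _} top = Top-image h top

  module GeneratedTop (S : SortedCompleteSystem) {Γ} (σ : Tuple (structure S) Γ) {t} {i₀ : t ∈ₗ Γ}
                      (top : Top (structure S) σ i₀) where
    open TopProperties S top using (below)
    open Generated S σ i₀ below public
      using (subsystem; system; generators; generated; finitelyGenerated)

    generators-top : Top (structure system) generators i₀
    generators-top = record
      { lowest = Top.lowest top ; mates = λ (y , _) → Top.mates top y }

    fgSystem : FGSystem
    fgSystem = record { scs = system ; fg = finitelyGenerated }

  module _ (S₁ S₂ : SortedCompleteSystem) {Γ}
    (d : Tuple (structure S₁) Γ) (c : Tuple (structure S₂) Γ) {t} {i₀ : t ∈ₗ Γ}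
    (top-d : Top (structure S₁) d i₀) (top-c : Top (structure S₂) c i₀)
    (same : SameAtoms (structure S₁) (structure S₂) d c) where
    private
      module ⟨d⟩ = GeneratedTop S₁ d top-d
      module ⟨c⟩ = GeneratedTop S₂ c top-c
      module E = Extension S₁ S₂ {d = d} {c = c} id top-d top-c same {j₀ = i₀}
                   (TopProperties.below S₂ top-c)

    -- The extension is onto because its image is a subsystem that contains the generators.
    generated-≅ : structure ⟨d⟩.system ≅ structure ⟨c⟩.system
    generated-≅ = record
      { embedding  = SystemEmbedding.embedding E.extension
      ; surjective = ⟨c⟩.generated E.extension (λ i → ⟨d⟩.generators i , E.extension-extends i)
      }

  -- Amalgamation

  Amalgam : (S S₁ : SortedCompleteSystem) → ∀ {Γ Γ₁} (f : ∀ {s} → s ∈ₗ Γ → s ∈ₗ Γ₁) →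
            Tuple (structure S₁) Γ₁ → ∀ {t} → t ∈ₗ Γ₁ → Tuple (structure S) Γ → Set ℓ
  Amalgam S S₁ {Γ} {Γ₁} f c j₀ d = Σ[ c′ ∈ All ∣ structure S ∣ Γ₁ ]
      Top (structure S) (All.lookup c′) j₀
    × SameAtoms (structure S₁) (structure S) c (All.lookup c′)
    × (∀ {s} (i : s ∈ₗ Γ) → SortedCompleteSystem._≈_ S (All.lookup c′ (f i)) (d i))

  module _ (S : SortedCompleteSystem) (S-coSEP : CoSEP S) (S₁ : SortedCompleteSystem)
    {Γ Γ₁} (f : ∀ {s} → s ∈ₗ Γ → s ∈ₗ Γ₁)
    (c : Tuple (structure S₁) Γ₁) {t₁} {j₀ : t₁ ∈ₗ Γ₁} (top-c : Top (structure S₁) c j₀)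
    (A : Subsystem S)
    (h : structure (GeneratedTop.system S₁ c top-c) ≅ structure (Subsystem.system A))
    where
    private
      module ⟨c⟩ = GeneratedTop S₁ c top-c
      module S = SCS S
      module h = _≅_ h
      A-fg : IsFinitelyGenerated (Subsystem.system A)
      A-fg = IsFinitelyGenerated-≅ ⟨c⟩.system (Subsystem.system A) h ⟨c⟩.finitelyGenerated
      h′ : SystemEmbedding ⟨c⟩.system (Subsystem.system A)
      h′ = ≅⇒SystemEmbedding ⟨c⟩.system (Subsystem.system A) h

    private
      along : (d : Tuple (structure S) Γ) (Ψ : SystemEmbedding (Subsystem.system A) S) →
              (∀ {s} (i : s ∈ₗ Γ) →
                SystemEmbedding.to Ψ (h.to (⟨c⟩.generators (f i))) S.≈ d i) →
              Amalgam S S₁ f c j₀ d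
      along d Ψ p = All.tabulate c′
        , Top-≈ (structure S) c′≈ (Top-image k ⟨c⟩.generators-top)
        , SameAtoms-trans {M = structure S₁} {structure ⟨c⟩.system} {structure S}
            (SameAtoms-sym {M = structure ⟨c⟩.system} {structure S₁}
              (SameAtoms-image (SystemEmbedding.embedding (ι ⟨c⟩.subsystem)) ⟨c⟩.generators))
            (SameAtoms-trans {M = structure ⟨c⟩.system} {structure S} {structure S}
              (SameAtoms-image (SystemEmbedding.embedding k) ⟨c⟩.generators)
              (SameAtoms-≈ (structure S) c′≈))
        , λ i → Setoid.trans (S.m _) (Setoid.sym (S.m _) (c′≈ (f i))) (p i)
        where
        k : SystemEmbedding ⟨c⟩.system S
        k = ∘-SystemEmbedding {⟨c⟩.system} {Subsystem.system A} {S} Ψ h′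
        c′ : Tuple (structure S) Γ₁
        c′ i = SystemEmbedding.to k (⟨c⟩.generators i)
        c′≈ : ∀ {s} (i : s ∈ₗ Γ₁) → c′ i S.≈ All.lookup (All.tabulate c′) i
        c′≈ i = Setoid.sym (S.m _) (Setoid.reflexive (S.m _) (lookup-tabulate c′ i))

    -- Co-SEP is applied to `A`, a copy of the system of `c`, and the system generated by `d`. Π
    -- extends d ↦ c ∘ f into this copy and Φ is the identity, so Ψ moves the copy until its part
    -- over `f` is `d` itself.
    amalgamate-Top : (d : Tuple (structure S) Γ) → ∀ {t} {i₀ : t ∈ₗ Γ} →
      Top (structure S₁) (λ i → c (f i)) i₀ → Top (structure S) d i₀ →
      SameAtoms (structure S) (structure S₁) d (λ i → c (f i)) →
      Amalgam S S₁ f c j₀ d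
    amalgamate-Top d top-cf top-d same = along d Ψ λ i → Setoid.trans (S.m _)
        (fwd (SystemEmbedding.to-≈ Ψ (h.to (⟨c⟩.generators (f i))) (h.to (e i)))
          (fwd (h.to-≈ (⟨c⟩.generators (f i)) (e i))
            (Setoid.sym (Structure.m (structure ⟨c⟩.system) _)
              {x = e i} {y = ⟨c⟩.generators (f i)} (E.extension-extends i))))
        (proj₂ amalgam (⟨d⟩.generators i))
      where
      module ⟨d⟩ = GeneratedTop S d top-d
      module E = Extension S S₁ {d = d} {c = c} f top-d top-cf same (TopProperties.below S₁ top-c)
      amalgam = S-coSEP A ⟨d⟩.subsystem A-fg ⟨d⟩.finitelyGenerated
                  (∘-SystemEmbedding {⟨d⟩.system} {⟨c⟩.system} {Subsystem.system A} h′ E.extension)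
                  id-SystemEmbedding
      Ψ = proj₁ amalgam
      e : Tuple (structure ⟨c⟩.system) Γ
      e i = SystemEmbedding.to E.extension (⟨d⟩.generators i)

    -- The empty tuple has no lowest entry and hence no system to amalgamate over; the copy stays
    -- where it is.
    amalgamate-[] : (d : Tuple (structure S) Γ) → (∀ {s} → ¬ (s ∈ₗ Γ)) → Amalgam S S₁ f c j₀ d
    amalgamate-[] d empty = along d (ι A) (λ i → ⊥-elim (empty i))

  amalgamate : (S : SortedCompleteSystem) → CoSEP S → (S₁ : SortedCompleteSystem) →
    ∀ {Γ Γ₁} (f : ∀ {s} → s ∈ₗ Γ → s ∈ₗ Γ₁)
    (c : Tuple (structure S₁) Γ₁) {t₁} {j₀ : t₁ ∈ₗ Γ₁} (top-c : Top (structure S₁) c j₀)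
    (A : Subsystem S)
    (h : structure (GeneratedTop.system S₁ c top-c) ≅ structure (Subsystem.system A))
    (d : Tuple (structure S) Γ) →
    Nice (structure S₁) (λ {s} (i : s ∈ₗ Γ) → c (f i)) → Nice (structure S) d →
    SameAtoms (structure S) (structure S₁) d (λ i → c (f i)) →
    Amalgam S S₁ f c j₀ d
  amalgamate S S-coSEP S₁ {[]} f c top-c A h d _ _ _ =
    amalgamate-[] S S-coSEP S₁ f c top-c A h d λ ()
  amalgamate S S-coSEP S₁ {_ ∷ _} f c top-c A h d top-cf top-d same =
    amalgamate-Top S S-coSEP S₁ f c top-c A h d top-cf top-d same

  -- Extending a tuple to a nice one

  meetSort : Sort → Sort → Sort
  meetSort (k , J) (k′ , J′) = k *⁺ k′ , J*∩ J J′

  -- The sort depends on the sorts of a tuple and not on its elements, so the existence of a nice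
  -- extension becomes one sentence for each list of sorts.
  lowerSort : Sort → List Sort → Sort
  lowerSort s []      = s
  lowerSort s (t ∷ Γ) = meetSort s (lowerSort t Γ)

  -- A lower bound followed by as many entries of its sort as that sort allows cosets; repetitions
  -- do no harm.
  mateSorts : Sort → List Sort → List Sort
  mateSorts s Γ = let t = lowerSort s Γ in t ∷ replicate (value (proj₁ t)) t

  module _ (S : SortedCompleteSystem) where
    open SCS S

    LE-trans : ∀ {s t u} (a : ∣ structure S ∣ s) (b : ∣ structure S ∣ t) (c : ∣ structure S ∣ u) →
               LE a b → LE b c → LE a c
    LE-trans a b c p q = LE-intro a c (≤-trans (LE⇒≥ b c q) (LE⇒≥ a b p))
                           (λ z → LE⇒⊆ᴺ b c q (LE⇒⊆ᴺ a b p z))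

    meet : ∀ {s t} (a : ∣ structure S ∣ s) (b : ∣ structure S ∣ t) →
           Σ[ x ∈ ∣ structure S ∣ (meetSort s t) ] LE x a × LE x b
    meet {k , J} {k′ , J′} a b =
      let x , (p , _) , _ = mk (meetSort (k , J) (k′ , J′)) (N a ∩ᴺ N b)
            (Index≤-∩ em (N a) (N b) (index a) (index b)) (F-∩ (N a) (N b) J J′ (sort a) (sort b)) ε
      in x , LE-intro x a (k≤k*⁺k′ k k′) (λ z → proj₁ (p z))
           , LE-intro x b (k′≤k*⁺k′ k k′) (λ z → proj₂ (p z))

    lower-bound : ∀ {s Γ} (ρ : Assignment (structure S) (s ∷ Γ)) →
      Σ[ x ∈ ∣ structure S ∣ (lowerSort s Γ) ] (∀ {t} (i : t ∈ₗ s ∷ Γ) → LE x (All.lookup ρ i))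
    lower-bound (a ∷ []) = a , λ { (here ≡.refl) → LE-intro a a ≤-refl id }
    lower-bound (a ∷ ρ@(_ ∷ _)) =
      let y , below = lower-bound ρ
          x , p , q = meet a y
      in x , λ { (here ≡.refl) → p ; (there i) → LE-trans x y (All.lookup ρ i) q (below i) }

    niceExtension : ∀ {s Γ} (ρ : Assignment (structure S) (s ∷ Γ)) →
      Σ[ δ ∈ Assignment (structure S) (mateSorts s Γ) ]
        Top (structure S) (All.lookup (++⁺ δ ρ)) (here ≡.refl)
    niceExtension {s} {Γ} ρ = δ , record { lowest = lowest ; mates = mates }
      where
      t = lowerSort s Γ
      x = proj₁ (lower-bound ρ)
      r = proj₁ (index x)
      mateOf : ∀ i → Σ[ a ∈ ∣ structure S ∣ t ] a ≐ᴺ x × r i ∈ coset a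
      mateOf i = mk t (N x) (index x) (sort x) (r i)
      f : Fin (value (proj₁ t)) → ∣ structure S ∣ t
      f i = proj₁ (mateOf i)
      δ : Assignment (structure S) (mateSorts s Γ)
      δ = x ∷ tabulateʳ (value (proj₁ t)) f

      lowest : ∀ {u} (i : u ∈ₗ mateSorts s Γ ++ s ∷ Γ) → LE x (All.lookup (++⁺ δ ρ) i)
      lowest = lookup-++⁺-elim ρ (LE x) δ
        (λ { (here ≡.refl) → LE-intro x x ≤-refl id
           ; (there i) → tabulateʳ-elim (LE x) _ f
               (λ j → LE-intro x (f j) ≤-refl (proj₂ (proj₁ (proj₂ (mateOf j))))) i })
        (proj₂ (lower-bound ρ))

      mates : ∀ (y : ∣ structure S ∣ t) → LE x y → LE y x →
              Σ[ i ∈ t ∈ₗ mateSorts s Γ ++ s ∷ Γ ] All.lookup (++⁺ δ ρ) i ≈ y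
      mates y p q =
        let i , y∈ = proj₂ (index x) (rep y)
            a≐x = proj₁ (proj₂ (mateOf i))
            r∈ = proj₂ (proj₂ (mateOf i))
            j , e = tabulateʳ-hit (value (proj₁ t)) f i
            a≈y = ≈-intro (f i) y
                    ( (λ z → LE⇒⊆ᴺ x y p (proj₁ a≐x z)) , (λ z → proj₂ a≐x (LE⇒⊆ᴺ y x q z)) )
                    (·-⊆ (N (f i)) r∈ (proj₂ a≐x y∈)) (rep∈ y)
        in ∈-++⁺ˡ {xs = mateSorts s Γ} (there j) ,
           ≡.subst (_≈ y) (≡.sym (≡.trans (lookup-++⁺ˡ ρ δ (there j)) e)) a≈y

  -- Formulas about finite tuples

  -- Conjunctions and disjunctions over variables of one sort need a finite list of them; excluded
  -- middle compares the sorts.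
  indices : (s : Sort) (Γ : List Sort) → List (s ∈ₗ Γ)
  indices s []      = []
  indices s (t ∷ Γ) with em {P = s ≡ t}
  ... | yes p = here p ∷ map there (indices s Γ)
  ... | no _  = map there (indices s Γ)

  ∈-indices : ∀ {s : Sort} {Γ} (i : s ∈ₗ Γ) → i ∈ₗ indices s Γ
  ∈-indices {s} {t ∷ Γ} i with em {P = s ≡ t}
  ∈-indices {s} {t ∷ Γ} (here ≡.refl) | yes ≡.refl = here ≡.refl
  ∈-indices {s} {t ∷ Γ} (there i)     | yes _      = there (∈-map⁺ there (∈-indices i))
  ∈-indices {s} {t ∷ Γ} (here p)      | no s≢t     with () ← s≢t p
  ∈-indices {s} {t ∷ Γ} (there i)     | no _       = ∈-map⁺ there (∈-indices i)

  ⊤ᶠ : ∀ {Θ} → Formula Θ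
  ⊤ᶠ = ⊥ᶠ ⇒ᶠ ⊥ᶠ

  ⋀ ⋁ : ∀ {a} {A : Set a} {Θ} → List A → (A → Formula Θ) → Formula Θ
  ⋀ []       φ = ⊤ᶠ
  ⋀ (x ∷ xs) φ = φ x ∧ᶠ ⋀ xs φ
  ⋁ []       φ = ⊥ᶠ
  ⋁ (x ∷ xs) φ = φ x ∨ᶠ ⋁ xs φ

  ⋀ᵢ : ∀ Γ {Θ} → (∀ {s} → s ∈ₗ Γ → Formula Θ) → Formula Θ
  ⋀ᵢ Γ φ = ⋀ Γ λ s → ⋀ (indices s Γ) φ

  atomᶠ : ∀ {Γ Θ} → (∀ {s} → s ∈ₗ Γ → s ∈ₗ Θ) → Atom Γ → Formula Θ
  atomᶠ v (eqᵃ i j)  = v i ≈ᶠ v j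
  atomᶠ v (leᵃ i j)  = LEᶠ (v i) (v j)
  atomᶠ v (cᵃ i j)   = Cᶠ (v i) (v j)
  atomᶠ v (pᵃ i j k) = Pᶠ (v i) (v j) (v k)

  topᶠ : ∀ {Γ Θ} → (∀ {s} → s ∈ₗ Γ → s ∈ₗ Θ) → ∀ {t} → t ∈ₗ Γ → Formula Θ
  topᶠ {Γ} v {t} i₀ =
    ⋀ᵢ Γ (λ i → LEᶠ (v i₀) (v i)) ∧ᶠ
    ∀ᶠ t (LEᶠ (there (v i₀)) (here ≡.refl) ⇒ᶠ (LEᶠ (here ≡.refl) (there (v i₀)) ⇒ᶠ
      ⋁ (indices t Γ) (λ i → there (v i) ≈ᶠ here ≡.refl)))

  niceᶠ : ∀ Γ {Θ} → (∀ {s} → s ∈ₗ Γ → s ∈ₗ Θ) → Formula Θ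
  niceᶠ []      v = ⊤ᶠ
  niceᶠ (_ ∷ Γ) v = topᶠ v (here ≡.refl)

  module _ (M : Structure ℓ ℓ) {Γ} (σ : Tuple M Γ) where

    literalᶠ : ∀ {Θ} → (∀ {s} → s ∈ₗ Γ → s ∈ₗ Θ) → Atom Γ → Formula Θ
    literalᶠ v α with em {P = Holds M σ α}
    ... | yes _ = atomᶠ v α
    ... | no _  = ¬ᶠ (atomᶠ v α)

    -- The nesting follows the typing of atoms: `eqᵃ` and `pᵃ` need a single sort, `leᵃ` and `cᵃ`
    -- take any two.
    diagramᶠ : ∀ {Θ} → (∀ {s} → s ∈ₗ Γ → s ∈ₗ Θ) → Formula Θ
    diagramᶠ v = ⋀ᵢ Γ λ {s} i →
      ⋀ (indices s Γ) (λ j → literalᶠ v (eqᵃ i j) ∧ᶠ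
        ⋀ (indices s Γ) (λ k → literalᶠ v (pᵃ i j k))) ∧ᶠ
      ⋀ᵢ Γ (λ j → literalᶠ v (leᵃ i j) ∧ᶠ literalᶠ v (cᵃ i j))

  ∃[_]ᶠ : ∀ Δ {Θ} → Formula (Δ ++ Θ) → Formula Θ
  ∃[ [] ]ᶠ    φ = φ
  ∃[ s ∷ Δ ]ᶠ φ = ∃[ Δ ]ᶠ (∃ᶠ s φ)

  ∀∀ᶠ : ∀ {Θ} → Formula Θ → Sentence
  ∀∀ᶠ {[]}    φ = φ
  ∀∀ᶠ {s ∷ Θ} φ = ∀∀ᶠ (∀ᶠ s φ)

  module _ (N : Structure ℓ ℓ) where
    open Structure N hiding (∣_∣)

    module _ {a} {A : Set a} {Θ} (ρ : Assignment N Θ) (φ : A → Formula Θ) where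

      ⋀⁺ : ∀ xs → (∀ x → Satisfies N (φ x) ρ) → Satisfies N (⋀ xs φ) ρ
      ⋀⁺ []       h = id
      ⋀⁺ (x ∷ xs) h = h x , ⋀⁺ xs h

      ⋀⁻ : ∀ {xs} → Satisfies N (⋀ xs φ) ρ → ∀ {x} → x ∈ₗ xs → Satisfies N (φ x) ρ
      ⋀⁻ (p , _) (here ≡.refl) = p
      ⋀⁻ (_ , q) (there i)     = ⋀⁻ q i

      ⋁⁺ : ∀ {xs x} → x ∈ₗ xs → Satisfies N (φ x) ρ → Satisfies N (⋁ xs φ) ρ
      ⋁⁺ (here ≡.refl) p = inj₁ p
      ⋁⁺ (there i)     p = inj₂ (⋁⁺ i p)

      ⋁⁻ : ∀ xs → Satisfies N (⋁ xs φ) ρ → ∃[ x ] Satisfies N (φ x) ρ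
      ⋁⁻ (x ∷ xs) (inj₁ p) = x , p
      ⋁⁻ (x ∷ xs) (inj₂ q) = ⋁⁻ xs q

    module _ {Γ Θ : List Sort} (ρ : Assignment N Θ) (φ : ∀ {s : Sort} → s ∈ₗ Γ → Formula Θ) where

      ⋀ᵢ⁺ : (∀ {s} (i : s ∈ₗ Γ) → Satisfies N (φ i) ρ) → Satisfies N (⋀ᵢ Γ φ) ρ
      ⋀ᵢ⁺ h = ⋀⁺ ρ (λ s → ⋀ (indices s Γ) φ) Γ (λ s → ⋀⁺ ρ φ (indices s Γ) h)

      ⋀ᵢ⁻ : Satisfies N (⋀ᵢ Γ φ) ρ → ∀ {s} (i : s ∈ₗ Γ) → Satisfies N (φ i) ρ
      ⋀ᵢ⁻ p i = ⋀⁻ ρ φ (⋀⁻ ρ (λ s → ⋀ (indices s Γ) φ) p i) (∈-indices i)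

    module _ {Γ Θ} (v : ∀ {s} → s ∈ₗ Γ → s ∈ₗ Θ) (ρ : Assignment N Θ) where

      atomᶠ-sat : ∀ α → Satisfies N (atomᶠ v α) ρ ⇔ Holds N (λ i → All.lookup ρ (v i)) α
      atomᶠ-sat (eqᵃ i j)  = mk⇔ lower lift
      atomᶠ-sat (leᵃ i j)  = mk⇔ lower lift
      atomᶠ-sat (cᵃ i j)   = mk⇔ lower lift
      atomᶠ-sat (pᵃ i j k) = mk⇔ lower lift

      topᶠ-sat : ∀ {t} {i₀ : t ∈ₗ Γ} →
                 Satisfies N (topᶠ v i₀) ρ ⇔ Top N (λ i → All.lookup ρ (v i)) i₀
      topᶠ-sat {t} {i₀} = mk⇔
        (λ (p , q) → record
          { lowest = λ i → lower (⋀ᵢ⁻ ρ (λ i → LEᶠ (v i₀) (v i)) p i)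
          ; mates  = λ y r s →
              let i , e = ⋁⁻ (y ∷ ρ) (λ i → there (v i) ≈ᶠ here ≡.refl) (indices t Γ)
                             (q y (lift r) (lift s))
              in i , lower e
          })
        (λ top → ⋀ᵢ⁺ ρ (λ i → LEᶠ (v i₀) (v i)) (λ i → lift (Top.lowest top i))
               , λ y r s →
                   let i , e = Top.mates top y (lower r) (lower s)
                   in ⋁⁺ (y ∷ ρ) (λ i → there (v i) ≈ᶠ here ≡.refl) (∈-indices i) (lift e))

    niceᶠ-sat : ∀ Γ {Θ} (v : ∀ {s} → s ∈ₗ Γ → s ∈ₗ Θ) (ρ : Assignment N Θ) →
                Satisfies N (niceᶠ Γ v) ρ ⇔ Nice N (λ {s} (i : s ∈ₗ Γ) → All.lookup ρ (v i))
    niceᶠ-sat []      v ρ = mk⇔ (λ _ → tt) (λ _ → id)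
    niceᶠ-sat (_ ∷ Γ) v ρ = topᶠ-sat v ρ

    module _ (M : Structure ℓ ℓ) {Γ} (σ : Tuple M Γ)
             {Θ} (v : ∀ {s} → s ∈ₗ Γ → s ∈ₗ Θ) (ρ : Assignment N Θ) where

      literalᶠ-sat : ∀ α → Satisfies N (literalᶠ M σ v α) ρ ⇔
                           (Holds M σ α ⇔ Holds N (λ i → All.lookup ρ (v i)) α)
      literalᶠ-sat α with em {P = Holds M σ α}
      ... | yes h = mk⇔ (λ p → mk⇔ (λ _ → fwd (atomᶠ-sat v ρ α) p) (λ _ → h))
                        (λ p → bwd (atomᶠ-sat v ρ α) (fwd p h))
      ... | no ¬h = mk⇔ (λ ¬p → mk⇔ (λ h → ⊥-elim (¬h h))
                                      (λ q → ⊥ₚ-elim (¬p (bwd (atomᶠ-sat v ρ α) q))))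
                        (λ p q → ⊥-elim (¬h (bwd p (fwd (atomᶠ-sat v ρ α) q))))

      diagramᶠ-sat : Satisfies N (diagramᶠ M σ v) ρ ⇔
                     SameAtoms M N σ (λ i → All.lookup ρ (v i))
      diagramᶠ-sat = mk⇔ (λ p α → fwd (literalᶠ-sat α) (from p α))
                         (λ same → to (λ α → bwd (literalᶠ-sat α) (same α)))
        where
        L : Atom Γ → Formula Θ
        L = literalᶠ M σ v
        E : ∀ {s} → s ∈ₗ Γ → s ∈ₗ Γ → Formula Θ
        E {s} i j = L (eqᵃ i j) ∧ᶠ ⋀ (indices s Γ) (λ k → L (pᵃ i j k))
        R : ∀ {s} → s ∈ₗ Γ → ∀ {t} → t ∈ₗ Γ → Formula Θ
        R i j = L (leᵃ i j) ∧ᶠ L (cᵃ i j)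
        D : ∀ {s} → s ∈ₗ Γ → Formula Θ
        D {s} i = ⋀ (indices s Γ) (E i) ∧ᶠ ⋀ᵢ Γ (R i)

        to : (∀ α → Satisfies N (L α) ρ) → Satisfies N (diagramᶠ M σ v) ρ
        to h = ⋀ᵢ⁺ ρ D λ {s} i →
            ⋀⁺ ρ (E i) (indices s Γ)
              (λ j → h (eqᵃ i j) , ⋀⁺ ρ (λ k → L (pᵃ i j k)) (indices s Γ) (λ k → h (pᵃ i j k)))
          , ⋀ᵢ⁺ ρ (R i) (λ j → h (leᵃ i j) , h (cᵃ i j))

        from : Satisfies N (diagramᶠ M σ v) ρ → ∀ α → Satisfies N (L α) ρ
        from p (eqᵃ i j)  = proj₁ (⋀⁻ ρ (E i) (proj₁ (⋀ᵢ⁻ ρ D p i)) (∈-indices j))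
        from p (pᵃ i j k) = ⋀⁻ ρ (λ k → L (pᵃ i j k))
          (proj₂ (⋀⁻ ρ (E i) (proj₁ (⋀ᵢ⁻ ρ D p i)) (∈-indices j))) (∈-indices k)
        from p (leᵃ i j)  = proj₁ (⋀ᵢ⁻ ρ (R i) (proj₂ (⋀ᵢ⁻ ρ D p i)) j)
        from p (cᵃ i j)   = proj₂ (⋀ᵢ⁻ ρ (R i) (proj₂ (⋀ᵢ⁻ ρ D p i)) j)

    ∃[]ᶠ-sat : ∀ Δ {Θ} (φ : Formula (Δ ++ Θ)) (ρ : Assignment N Θ) →
      Satisfies N (∃[ Δ ]ᶠ φ) ρ ⇔ (Σ[ δ ∈ Assignment N Δ ] Satisfies N φ (++⁺ δ ρ))
    ∃[]ᶠ-sat []      φ ρ = mk⇔ (λ p → [] , p) (λ { ([] , p) → p })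
    ∃[]ᶠ-sat (s ∷ Δ) φ ρ = mk⇔
      (λ p → let δ , a , q = fwd (∃[]ᶠ-sat Δ (∃ᶠ s φ) ρ) p in a ∷ δ , q)
      (λ { (a ∷ δ , q) → bwd (∃[]ᶠ-sat Δ (∃ᶠ s φ) ρ) (δ , a , q) })

    ∃∃ᶠ-sat : ∀ {Θ} (φ : Formula Θ) → N ⊨ ∃∃ᶠ φ ⇔ (Σ[ ρ ∈ Assignment N Θ ] Satisfies N φ ρ)
    ∃∃ᶠ-sat {[]}    φ = mk⇔ (λ p → [] , p) (λ { ([] , p) → p })
    ∃∃ᶠ-sat {s ∷ Θ} φ = mk⇔
      (λ p → let ρ , a , q = fwd (∃∃ᶠ-sat (∃ᶠ s φ)) p in a ∷ ρ , q)
      (λ { (a ∷ ρ , q) → bwd (∃∃ᶠ-sat (∃ᶠ s φ)) (ρ , a , q) })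

    ∀∀ᶠ-sat : ∀ {Θ} (φ : Formula Θ) → N ⊨ ∀∀ᶠ φ ⇔ (∀ (ρ : Assignment N Θ) → Satisfies N φ ρ)
    ∀∀ᶠ-sat {[]}    φ = mk⇔ (λ { p [] → p }) (λ p → p [])
    ∀∀ᶠ-sat {s ∷ Θ} φ = mk⇔
      (λ { p (a ∷ ρ) → fwd (∀∀ᶠ-sat (∀ᶠ s φ)) p ρ a })
      (λ p → bwd (∀∀ᶠ-sat (∀ᶠ s φ)) (λ ρ a → p (a ∷ ρ)))

  open FGSystem using (scs; fg)
  open NiceFinitePresystem using (sorts; elements)
  open Subsystem using (system)

  by-contradiction : ∀ {a b} {A : Set a} → (¬ A → ⊥ {b}) → A
  by-contradiction {A = A} h with em {P = A}
  ... | yes x = x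
  ... | no ¬x = ⊥ₚ-elim (h ¬x)

  -- The sentences used about a model of the axioms

  module WithPresystems
    (X : ∀ (S′ : FGSystem) → NiceFinitePresystem (scs S′))
    (θ : ∀ (S′ : FGSystem) → Formula (sorts (X S′)))
    (θ-expresses : ∀ (S′ : FGSystem) → Expresses (scs S′) (X S′) (θ S′)) where

    ∃θ⁺ : (N : SortedCompleteSystem) (S′ : FGSystem) (A : Subsystem N) →
          structure (scs S′) ≅ structure (system A) → structure N ⊨ ∃∃ᶠ (θ S′)
    ∃θ⁺ N S′ A h = bwd (∃∃ᶠ-sat (structure N) (θ S′))
      (All.tabulate c , bwd (θ-expresses S′ N (All.tabulate c))
        (A , h , λ i → Setoid.sym (m _) (Setoid.reflexive (m _) (lookup-tabulate c i))))
      where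
      open SCS N using (m)
      c : Tuple (structure N) (sorts (X S′))
      c i = proj₁ (_≅_.to h (All.lookup (elements (X S′)) i))

    ∃θ⁻ : (N : SortedCompleteSystem) (S′ : FGSystem) → structure N ⊨ ∃∃ᶠ (θ S′) →
          Σ[ A ∈ Subsystem N ] structure (scs S′) ≅ structure (system A)
    ∃θ⁻ N S′ p =
      let c , q = fwd (∃∃ᶠ-sat (structure N) (θ S′)) p
          A , h , _ = fwd (θ-expresses S′ N c) q
      in A , h

    ∃θ⇒coFSIm : (N : SortedCompleteSystem) (S′ : FGSystem) → structure N ⊨ ∃∃ᶠ (θ S′) →
                S′ ∈coFSIm N
    ∃θ⇒coFSIm N S′ p =
      let A , h = ∃θ⁻ N S′ p
      in A , IsFinitelyGenerated-≅ (scs S′) (system A) h (fg S′) , h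

    niceExtensionᶠ : Sort → List Sort → Sentence
    niceExtensionᶠ s Γ =
      ∀∀ᶠ {s ∷ Γ} (∃[ mateSorts s Γ ]ᶠ (topᶠ {Γ = mateSorts s Γ ++ s ∷ Γ} id (here ≡.refl)))

    NiceExtension : (N : Structure ℓ ℓ) → ∀ {s Γ} → Assignment N (s ∷ Γ) → Set ℓ
    NiceExtension N {s} {Γ} ρ =
      Σ[ δ ∈ Assignment N (mateSorts s Γ) ] Top N (All.lookup (++⁺ δ ρ)) (here ≡.refl)

    niceExtensionᶠ-sat : ∀ N s Γ → N ⊨ niceExtensionᶠ s Γ ⇔ (∀ ρ → NiceExtension N {s} {Γ} ρ)
    niceExtensionᶠ-sat N s Γ = mk⇔
      (λ p ρ → let δ , q = fwd (∃[]ᶠ-sat N (mateSorts s Γ) φ ρ) (fwd (∀∀ᶠ-sat N φ′) p ρ)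
               in δ , fwd (topᶠ-sat N id (++⁺ δ ρ)) q)
      (λ h → bwd (∀∀ᶠ-sat N φ′) (λ ρ →
               let δ , q = h ρ
               in bwd (∃[]ᶠ-sat N (mateSorts s Γ) φ ρ) (δ , bwd (topᶠ-sat N id (++⁺ δ ρ)) q)))
      where
      φ : Formula (mateSorts s Γ ++ s ∷ Γ)
      φ = topᶠ {Γ = mateSorts s Γ ++ s ∷ Γ} id (here ≡.refl)
      φ′ : Formula (s ∷ Γ)
      φ′ = ∃[ mateSorts s Γ ]ᶠ φ

    module Realization (S₁ : SortedCompleteSystem) {Γ Γ₁} (f : ∀ {s} → s ∈ₗ Γ → s ∈ₗ Γ₁)
      (c : Tuple (structure S₁) Γ₁) {t} {j₀ : t ∈ₗ Γ₁} (top-c : Top (structure S₁) c j₀) where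

      S′ : FGSystem
      S′ = GeneratedTop.fgSystem S₁ c top-c

      conclusionᶠ : Formula (Γ₁ ++ Γ)
      conclusionᶠ = topᶠ {Γ = Γ₁} ∈-++⁺ˡ j₀ ∧ᶠ (diagramᶠ (structure S₁) c ∈-++⁺ˡ ∧ᶠ
                    ⋀ᵢ Γ (λ i → ∈-++⁺ˡ (f i) ≈ᶠ ∈-++⁺ʳ Γ₁ i))

      extendᶠ : Formula Γ
      extendᶠ = niceᶠ Γ id ⇒ᶠ (diagramᶠ (structure S₁) (λ {s} (i : s ∈ₗ Γ) → c (f i)) id ⇒ᶠ
                  ∃[ Γ₁ ]ᶠ conclusionᶠ)

      -- The premise provides some copy of the system of `c`, which co-SEP then moves over the given
      -- tuple.
      forthᶠ : Sentence
      forthᶠ = ∃∃ᶠ (θ S′) ⇒ᶠ ∀∀ᶠ extendᶠ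

      copyᶠ : Formula Γ₁
      copyᶠ = topᶠ {Γ = Γ₁} id j₀ ∧ᶠ diagramᶠ (structure S₁) c id

      -- Turns a realized diagram into a statement about `θ S′`, which the axioms decide. It is
      -- valid because equal diagrams generate isomorphic systems.
      realizeᶠ : Sentence
      realizeᶠ = ∃∃ᶠ copyᶠ ⇒ᶠ ∃∃ᶠ (θ S′)

      conclusionᶠ-sat : ∀ N (δ : Assignment N Γ₁) (ρ : Assignment N Γ) →
        Satisfies N conclusionᶠ (++⁺ δ ρ) ⇔
          ( Top N (All.lookup δ) j₀ × SameAtoms (structure S₁) N c (All.lookup δ)
          × (∀ {s} (i : s ∈ₗ Γ) → Structure._≈_ N (All.lookup δ (f i)) (All.lookup ρ i)) )
      conclusionᶠ-sat N δ ρ = mk⇔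
        (λ (p , q , r) →
            Top-≈ N left (fwd (topᶠ-sat N ∈-++⁺ˡ (++⁺ δ ρ)) p)
          , SameAtoms-trans {M = structure S₁} {N} {N}
              (fwd (diagramᶠ-sat N (structure S₁) c ∈-++⁺ˡ (++⁺ δ ρ)) q) (SameAtoms-≈ N left)
          , λ i → ≈-trans N (≈-sym N (left (f i)))
                    (≈-trans N (lower (⋀ᵢ⁻ N (++⁺ δ ρ) E r i)) (right i)))
        (λ (p , q , r) →
            bwd (topᶠ-sat N ∈-++⁺ˡ (++⁺ δ ρ)) (Top-≈ N (λ i → ≈-sym N (left i)) p)
          , bwd (diagramᶠ-sat N (structure S₁) c ∈-++⁺ˡ (++⁺ δ ρ))
              (SameAtoms-trans {M = structure S₁} {N} {N} q
                (SameAtoms-≈ N (λ i → ≈-sym N (left i))))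
          , ⋀ᵢ⁺ N (++⁺ δ ρ) E (λ i → lift (≈-trans N (left (f i))
              (≈-trans N (r i) (≈-sym N (right i))))))
        where
        E : ∀ {s} → s ∈ₗ Γ → Formula (Γ₁ ++ Γ)
        E i = ∈-++⁺ˡ (f i) ≈ᶠ ∈-++⁺ʳ Γ₁ i
        left : ∀ {s} (i : s ∈ₗ Γ₁) →
               Structure._≈_ N (All.lookup (++⁺ δ ρ) (∈-++⁺ˡ i)) (All.lookup δ i)
        left i = ≈-reflexive N (lookup-++⁺ˡ ρ δ i)
        right : ∀ {s} (i : s ∈ₗ Γ) →
                Structure._≈_ N (All.lookup (++⁺ δ ρ) (∈-++⁺ʳ Γ₁ i)) (All.lookup ρ i)
        right i = ≈-reflexive N (lookup-++⁺ʳ ρ δ i)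

      forthᶠ-valid : Nice (structure S₁) (λ {s} (i : s ∈ₗ Γ) → c (f i)) → forthᶠ ∈ SCS-SEP
      forthᶠ-valid nice N N-coSEP p = bwd (∀∀ᶠ-sat (structure N) extendᶠ) λ ρ nice-ρ same →
        let A , h = ∃θ⁻ N S′ p
            δ , q = amalgamate N N-coSEP S₁ f c top-c A h (All.lookup ρ) nice
                      (fwd (niceᶠ-sat (structure N) Γ id ρ) nice-ρ)
                      (SameAtoms-sym {M = structure S₁} {structure N}
                        (fwd (diagramᶠ-sat (structure N) (structure S₁) (λ i → c (f i)) id ρ) same))
        in bwd (∃[]ᶠ-sat (structure N) Γ₁ conclusionᶠ ρ)
             (δ , bwd (conclusionᶠ-sat (structure N) δ ρ) q)

      realizeᶠ-valid : realizeᶠ ∈ SCS-SEP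
      realizeᶠ-valid N _ p =
        let ρ , q , r = fwd (∃∃ᶠ-sat (structure N) copyᶠ) p
            top = fwd (topᶠ-sat (structure N) id ρ) q
            same = fwd (diagramᶠ-sat (structure N) (structure S₁) c id ρ) r
        in ∃θ⁺ N S′ (GeneratedTop.subsystem N (All.lookup ρ) top)
             (generated-≅ S₁ N c (All.lookup ρ) top-c top same)

    -- Back-and-forth

    module _ (M N : Structure ℓ ℓ) where

      -- Assignments need not be nice, so each is read through `v` inside a nice tuple; the
      -- surrounding tuples are replaced by larger ones at every quantifier.
      record Related {Γ} (ρ : Assignment M Γ) (ρ′ : Assignment N Γ) : Set ℓ where
        field
          {shape} : List Sort
          σ       : Tuple M shape
          τ       : Tuple N shape
          nice-σ  : Nice M σ
          nice-τ  : Nice N τ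
          same    : SameAtoms M N σ τ
          v       : ∀ {s} → s ∈ₗ Γ → s ∈ₗ shape
          ρ≈σ     : ∀ {s} (i : s ∈ₗ Γ) → Structure._≈_ M (All.lookup ρ i) (σ (v i))
          ρ′≈τ    : ∀ {s} (i : s ∈ₗ Γ) → Structure._≈_ N (All.lookup ρ′ i) (τ (v i))

        related-atoms : SameAtoms M N (All.lookup ρ) (All.lookup ρ′)
        related-atoms = SameAtoms-trans {M = M} {M} {N} (SameAtoms-≈ M ρ≈σ)
          (SameAtoms-trans {M = M} {N} {N}
            (SameAtoms-rename {M = M} {N} {σ = σ} {τ = τ} v same)
            (SameAtoms-≈ N (λ i → ≈-sym N (ρ′≈τ i))))

      related-[] : Related [] []
      related-[] = record
        { shape = [] ; σ = λ () ; τ = λ () ; nice-σ = tt ; nice-τ = tt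
        ; same = λ { (eqᵃ () _) ; (leᵃ () _) ; (cᵃ () _) ; (pᵃ () _ _) }
        ; v = λ () ; ρ≈σ = λ () ; ρ′≈τ = λ () }

      BackAndForth : Set ℓ
      BackAndForth = ∀ {Γ} {ρ : Assignment M Γ} {ρ′ : Assignment N Γ} → Related ρ ρ′ → ∀ s →
          (∀ (a : ∣ M ∣ s) → Σ[ b ∈ ∣ N ∣ s ] Related (a ∷ ρ) (b ∷ ρ′))
        × (∀ (b : ∣ N ∣ s) → Σ[ a ∈ ∣ M ∣ s ] Related (a ∷ ρ) (b ∷ ρ′))

      related⇒equivalent : BackAndForth → ∀ {Γ} (φ : Formula Γ) {ρ : Assignment M Γ}
        {ρ′ : Assignment N Γ} → Related ρ ρ′ → Satisfies M φ ρ ⇔ Satisfies N φ ρ′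
      related⇒equivalent bf (i ≈ᶠ j) r =
        let p = Related.related-atoms r (eqᵃ i j)
        in mk⇔ (λ (lift z) → lift (fwd p z)) (λ (lift z) → lift (bwd p z))
      related⇒equivalent bf (LEᶠ i j) r =
        let p = Related.related-atoms r (leᵃ i j)
        in mk⇔ (λ (lift z) → lift (fwd p z)) (λ (lift z) → lift (bwd p z))
      related⇒equivalent bf (Cᶠ i j) r =
        let p = Related.related-atoms r (cᵃ i j)
        in mk⇔ (λ (lift z) → lift (fwd p z)) (λ (lift z) → lift (bwd p z))
      related⇒equivalent bf (Pᶠ i j k) r =
        let p = Related.related-atoms r (pᵃ i j k)
        in mk⇔ (λ (lift z) → lift (fwd p z)) (λ (lift z) → lift (bwd p z))
      related⇒equivalent bf ⊥ᶠ r = mk⇔ (λ ()) (λ ())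
      related⇒equivalent bf (φ ∧ᶠ ψ) r =
        let p = related⇒equivalent bf φ r
            q = related⇒equivalent bf ψ r
        in mk⇔ (λ (x , y) → fwd p x , fwd q y) (λ (x , y) → bwd p x , bwd q y)
      related⇒equivalent bf (φ ∨ᶠ ψ) r =
        let p = related⇒equivalent bf φ r
            q = related⇒equivalent bf ψ r
        in mk⇔ (λ { (inj₁ x) → inj₁ (fwd p x) ; (inj₂ y) → inj₂ (fwd q y) })
               (λ { (inj₁ x) → inj₁ (bwd p x) ; (inj₂ y) → inj₂ (bwd q y) })
      related⇒equivalent bf (φ ⇒ᶠ ψ) r =
        let p = related⇒equivalent bf φ r
            q = related⇒equivalent bf ψ r
        in mk⇔ (λ f x → fwd q (f (bwd p x))) (λ f x → bwd q (f (fwd p x)))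
      related⇒equivalent bf (∀ᶠ s φ) r = mk⇔
        (λ f b → let a , r′ = proj₂ (bf r s) b in fwd (related⇒equivalent bf φ r′) (f a))
        (λ f a → let b , r′ = proj₁ (bf r s) a in bwd (related⇒equivalent bf φ r′) (f b))
      related⇒equivalent bf (∃ᶠ s φ) r = mk⇔
        (λ (a , p) → let b , r′ = proj₁ (bf r s) a in b , fwd (related⇒equivalent bf φ r′) p)
        (λ (b , p) → let a , r′ = proj₂ (bf r s) b in a , bwd (related⇒equivalent bf φ r′) p)

    -- Comparison of S with a model of the axioms

    module _ (S : SortedCompleteSystem) (S-coSEP : CoSEP S) where

      Axioms : Theory _
      Axioms = SCS-SEP
        ∪ (λ φ → ∃ λ (S′ : FGSystem) → (S′ ∈coFSIm S) × (φ ≡ ∃∃ᶠ (θ S′)))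
        ∪ (λ φ → ∃ λ (S′ : FGSystem) → ¬ (S′ ∈coFSIm S) × (φ ≡ ¬ᶠ (∃∃ᶠ (θ S′))))

      axioms-hold : structure S ⊨ᵀ Axioms
      axioms-hold φ (inj₁ valid) = valid S S-coSEP
      axioms-hold φ (inj₂ (inj₁ (S′ , (A , _ , h) , ≡.refl))) = ∃θ⁺ S S′ A h
      axioms-hold φ (inj₂ (inj₂ (S′ , S′∉ , ≡.refl))) p = ⊥-elim (S′∉ (∃θ⇒coFSIm S S′ p))

      module _ (M : Structure ℓ ℓ) (M⊨ : M ⊨ᵀ Axioms) where
        private
          module S = Structure (structure S)
          module M = Structure M

          valid : ∀ {φ} → φ ∈ SCS-SEP → M ⊨ φ
          valid p = M⊨ _ (inj₁ p)

          module Shape (s : Sort) (Γ : List Sort) where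
            Γ₁ : List Sort
            Γ₁ = mateSorts s Γ ++ s ∷ Γ
            j₀ : lowerSort s Γ ∈ₗ Γ₁
            j₀ = here ≡.refl
            new : s ∈ₗ Γ₁
            new = ∈-++⁺ʳ (mateSorts s Γ) (here ≡.refl)
            old : ∀ {t} → t ∈ₗ Γ → t ∈ₗ Γ₁
            old i = ∈-++⁺ʳ (mateSorts s Γ) (there i)

            module Extended (N : Structure ℓ ℓ) (a : ∣ N ∣ s) (σ : Tuple N Γ)
                            (extension : ∀ ρ → NiceExtension N {s} {Γ} ρ) where
              ρ₁ : Assignment N (s ∷ Γ)
              ρ₁ = a ∷ All.tabulate σ
              δ : Assignment N (mateSorts s Γ)
              δ = proj₁ (extension ρ₁)
              c : Tuple N Γ₁
              c = All.lookup (++⁺ δ ρ₁)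
              top : Top N c j₀
              top = proj₂ (extension ρ₁)
              c-new : Structure._≈_ N (c new) a
              c-new = ≈-reflexive N (lookup-++⁺ʳ ρ₁ δ (here ≡.refl))
              c-old : ∀ {t} (i : t ∈ₗ Γ) → Structure._≈_ N (c (old i)) (σ i)
              c-old i = ≈-reflexive N (≡.trans (lookup-++⁺ʳ ρ₁ δ (there i)) (lookup-tabulate σ i))

          module _ {Γ} {ρ : Assignment (structure S) Γ} {ρ′ : Assignment M Γ}
                   (r : Related (structure S) M ρ ρ′) (s : Sort) where
            open Related r
            open Shape s shape

            extend : ∀ {a b} (c : Tuple (structure S) Γ₁) (d : Tuple M Γ₁) →
              Top (structure S) c j₀ → Top M d j₀ → SameAtoms (structure S) M c d →
              c new S.≈ a → d new M.≈ b →
              (∀ {t} (i : t ∈ₗ shape) → c (old i) S.≈ σ i) →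
              (∀ {t} (i : t ∈ₗ shape) → d (old i) M.≈ τ i) →
              Related (structure S) M (a ∷ ρ) (b ∷ ρ′)
            extend {a} {b} c d top-c top-d same₁ c-new d-new c-old d-old = record
              { σ = c ; τ = d ; nice-σ = top-c ; nice-τ = top-d ; same = same₁
              ; v = place ; ρ≈σ = in-c ; ρ′≈τ = in-d }
              where
              place : ∀ {t} → t ∈ₗ s ∷ Γ → t ∈ₗ Γ₁
              place (here ≡.refl) = new
              place (there i)     = old (v i)
              in-c : ∀ {t} (i : t ∈ₗ s ∷ Γ) → All.lookup (a ∷ ρ) i S.≈ c (place i)
              in-c (here ≡.refl)  = ≈-sym (structure S) c-new
              in-c (there i)      = ≈-trans (structure S) (ρ≈σ i)
                                      (≈-sym (structure S) (c-old (v i)))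
              in-d : ∀ {t} (i : t ∈ₗ s ∷ Γ) → All.lookup (b ∷ ρ′) i M.≈ d (place i)
              in-d (here ≡.refl)  = ≈-sym M d-new
              in-d (there i)      = ≈-trans M (ρ′≈τ i) (≈-sym M (d-old (v i)))

            forth : ∀ a → Σ[ b ∈ ∣ M ∣ s ] Related (structure S) M (a ∷ ρ) (b ∷ ρ′)
            forth a = d new , extend c d top top-d same₁ c-new (≈-refl M) c-old d-old
              where
              open Extended (structure S) a σ (niceExtension S)
              module Z = Realization S old c top
              nice-cf : Nice (structure S) (λ {t} (i : t ∈ₗ shape) → c (old i))
              nice-cf = Nice-≈ (structure S) (λ i → ≈-sym (structure S) (c-old i)) nice-σ
              ρ₀ : Assignment M shape
              ρ₀ = All.tabulate τ
              τ≈ρ₀ : ∀ {t} (i : t ∈ₗ shape) → τ i M.≈ All.lookup ρ₀ i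
              τ≈ρ₀ i = ≈-sym M (≈-reflexive M (lookup-tabulate τ i))
              -- This system is generated inside S, so the sentence is itself an axiom.
              M⊨∃θ : M ⊨ ∃∃ᶠ (θ Z.S′)
              M⊨∃θ = M⊨ _ (inj₂ (inj₁ (Z.S′ ,
                ( GeneratedTop.subsystem S c top , GeneratedTop.finitelyGenerated S c top
                , ≅-refl ) , ≡.refl)))
              same₀ : SameAtoms (structure S) M (λ i → c (old i)) (All.lookup ρ₀)
              same₀ = SameAtoms-trans {M = structure S} {structure S} {M}
                        (SameAtoms-≈ (structure S) c-old)
                        (SameAtoms-trans {M = structure S} {M} {M} same (SameAtoms-≈ M τ≈ρ₀))
              copy : Σ[ δ ∈ Assignment M Γ₁ ] Satisfies M Z.conclusionᶠ (++⁺ δ ρ₀)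
              copy = fwd (∃[]ᶠ-sat M Γ₁ Z.conclusionᶠ ρ₀)
                (fwd (∀∀ᶠ-sat M Z.extendᶠ) (valid {Z.forthᶠ} (Z.forthᶠ-valid nice-cf) M⊨∃θ) ρ₀
                  (bwd (niceᶠ-sat M shape id ρ₀) (Nice-≈ M τ≈ρ₀ nice-τ))
                  (bwd (diagramᶠ-sat M (structure S) (λ i → c (old i)) id ρ₀) same₀))
              facts = fwd (Z.conclusionᶠ-sat M (proj₁ copy) ρ₀) (proj₂ copy)
              d : Tuple M Γ₁
              d = All.lookup (proj₁ copy)
              top-d : Top M d j₀
              top-d = proj₁ facts
              same₁ : SameAtoms (structure S) M c d
              same₁ = proj₁ (proj₂ facts)
              d-old : ∀ {t} (i : t ∈ₗ shape) → d (old i) M.≈ τ i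
              d-old i = ≈-trans M (proj₂ (proj₂ facts) i) (≈-sym M (τ≈ρ₀ i))

            back : ∀ b → Σ[ a ∈ ∣ structure S ∣ s ] Related (structure S) M (a ∷ ρ) (b ∷ ρ′)
            back b = let N , e , top-e , nice-e , same-e = model
                     in FromModel.result N e top-e nice-e same-e
              where
              open Extended M b τ (fwd (niceExtensionᶠ-sat M s shape)
                                    (valid {niceExtensionᶠ s shape} (λ N _ →
                                       bwd (niceExtensionᶠ-sat (structure N) s shape)
                                           (niceExtension N))))
                renaming (c to d; c-new to c-new′; c-old to d-old)

              Model : Set _
              Model = Σ[ N ∈ SortedCompleteSystem ] Σ[ e ∈ Tuple (structure N) Γ₁ ]
                Top (structure N) e j₀ × Nice (structure N) (λ {t} (i : t ∈ₗ shape) → e (old i))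
                × SameAtoms M (structure N) d e

              -- Niceness of the old part is stated separately: it quantifies over all elements of
              -- the structure, so the diagram does not contain it, and the amalgamation over `σ`
              -- requires it.
              copyᶠ : Formula Γ₁
              copyᶠ = topᶠ {Γ = Γ₁} id j₀ ∧ᶠ (niceᶠ shape old ∧ᶠ diagramᶠ M d id)

              ρ₁′ : Assignment M Γ₁
              ρ₁′ = All.tabulate d
              d≈ρ₁′ : ∀ {t} (i : t ∈ₗ Γ₁) → d i M.≈ All.lookup ρ₁′ i
              d≈ρ₁′ i = ≈-sym M (≈-reflexive M (lookup-tabulate d i))

              nice-d : Nice M (λ {t} (i : t ∈ₗ shape) → d (old i))
              nice-d = Nice-≈ M (λ i → ≈-sym M (d-old i)) nice-τ

              M⊨copyᶠ : M ⊨ ∃∃ᶠ copyᶠ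
              M⊨copyᶠ = bwd (∃∃ᶠ-sat M copyᶠ)
                ( ρ₁′ , bwd (topᶠ-sat M id ρ₁′) (Top-≈ M d≈ρ₁′ top)
                , bwd (niceᶠ-sat M shape old ρ₁′) (Nice-≈ M (λ i → d≈ρ₁′ (old i)) nice-d)
                , bwd (diagramᶠ-sat M M d id ρ₁′) (SameAtoms-≈ M d≈ρ₁′) )

              copied : (N : SortedCompleteSystem) (ρ : Assignment (structure N) Γ₁) →
                Satisfies (structure N) copyᶠ ρ →
                Top (structure N) (All.lookup ρ) j₀
                × Nice (structure N) (λ {t} (i : t ∈ₗ shape) → All.lookup ρ (old i))
                × SameAtoms M (structure N) d (All.lookup ρ)
              copied N ρ (q , q′ , q″) =
                  fwd (topᶠ-sat (structure N) id ρ) q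
                , fwd (niceᶠ-sat (structure N) shape old ρ) q′
                , fwd (diagramᶠ-sat (structure N) M d id ρ) q″

              -- The diagram of d has a model among the sorted complete systems, since otherwise
              -- its negation would be an axiom.
              model : Model
              model = by-contradiction λ ∄ → valid {¬ᶠ ∃∃ᶠ copyᶠ} (refuted ∄) M⊨copyᶠ
                where
                refuted : ¬ Model → (¬ᶠ ∃∃ᶠ copyᶠ) ∈ SCS-SEP
                refuted ∄ N _ p =
                  let ρ , q = fwd (∃∃ᶠ-sat (structure N) copyᶠ) p
                  in ⊥-elim (∄ (N , All.lookup ρ , copied N ρ q))

              module FromModel (N : SortedCompleteSystem) (e : Tuple (structure N) Γ₁)
                (top-e : Top (structure N) e j₀)
                (nice-e : Nice (structure N) (λ {t} (i : t ∈ₗ shape) → e (old i)))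
                (same-e : SameAtoms M (structure N) d e) where
                module Z = Realization N old e top-e

                M⊨∃θ : M ⊨ ∃∃ᶠ (θ Z.S′)
                M⊨∃θ = valid {Z.realizeᶠ} Z.realizeᶠ-valid (bwd (∃∃ᶠ-sat M Z.copyᶠ)
                  ( ρ₁′ , bwd (topᶠ-sat M id ρ₁′) (Top-≈ M d≈ρ₁′ top)
                  , bwd (diagramᶠ-sat M (structure N) e id ρ₁′)
                      (SameAtoms-trans {M = structure N} {M} {M}
                        (SameAtoms-sym {M = M} {structure N} same-e) (SameAtoms-≈ M d≈ρ₁′)) ))

                -- Otherwise the negation of `M⊨∃θ` would be an axiom.
                embeds : Z.S′ ∈coFSIm S
                embeds = by-contradiction λ ∄ → M⊨ _ (inj₂ (inj₂ (Z.S′ , ∄ , ≡.refl))) M⊨∃θ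

                amalgam : Amalgam S N old e j₀ σ
                amalgam = amalgamate S S-coSEP N old e top-e (proj₁ embeds) (proj₂ (proj₂ embeds)) σ
                  nice-e nice-σ
                  (SameAtoms-trans {M = structure S} {M} {structure N} same
                    (SameAtoms-trans {M = M} {M} {structure N}
                      (SameAtoms-≈ M (λ i → ≈-sym M (d-old i)))
                      (SameAtoms-rename {M = M} {structure N} {σ = d} {τ = e} old same-e)))
                conclude : Amalgam S N old e j₀ σ →
                           Σ[ a ∈ ∣ structure S ∣ s ] Related (structure S) M (a ∷ ρ) (b ∷ ρ′)
                conclude (δ′ , top-c , same-c , c-old) =
                  c new , extend c d top-c top same₁ (≈-refl (structure S)) c-new′ c-old d-old
                  where
                  c : Tuple (structure S) Γ₁
                  c = All.lookup δ′
                  same₁ : SameAtoms (structure S) M c d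
                  same₁ = SameAtoms-trans {M = structure S} {structure N} {M}
                    (SameAtoms-sym {M = structure N} {structure S} same-c)
                    (SameAtoms-sym {M = M} {structure N} same-e)

                result : Σ[ a ∈ ∣ structure S ∣ s ] Related (structure S) M (a ∷ ρ) (b ∷ ρ′)
                result = conclude amalgam

        back-and-forth : BackAndForth (structure S) M
        back-and-forth r s = forth r s , back r s

      axiomatized : Th (structure S) IsAxiomatizedBy Axioms
      axiomatized M = mk⇔
        (λ M⊨Th φ φ∈ → M⊨Th φ (axioms-hold φ φ∈))
        -- The empty assignments are related, so S and `M` agree on all sentences.
        (λ M⊨ φ S⊨φ →
          fwd (related⇒equivalent (structure S) M (back-and-forth M M⊨) φ
                (related-[] (structure S) M)) S⊨φ)

theorem4p13 :
  (∀ {a} → ExcludedMiddle a) →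
  ∀ {ℓ} (𝒥 : Set ℓ) (J*⊆ : ℕ⁺ → List⁺ 𝒥 → List⁺ 𝒥) →
  let open Sorted 𝒥 J*⊆
      open SortedCompleteSystem using (structure)
      open FGSystem using (scs)
      open NiceFinitePresystem using (sorts) in
  𝒥 ↣ ℕ →
  (S : SortedCompleteSystem) →
  CoSEP S →
  (X : ∀ (S′ : FGSystem) → NiceFinitePresystem (scs S′)) →
  (θ : ∀ (S′ : FGSystem) → Formula (sorts (X S′))) →
  (∀ (S′ : FGSystem) → Expresses (scs S′) (X S′) (θ S′)) →
  Th (structure S) IsAxiomatizedBy
    (SCS-SEP
      ∪ (λ φ → ∃ λ (S′ : FGSystem) → (S′ ∈coFSIm S) × (φ ≡ ∃∃ᶠ (θ S′)))
      ∪ (λ φ → ∃ λ (S′ : FGSystem) → ¬ (S′ ∈coFSIm S) × (φ ≡ ¬ᶠ (∃∃ᶠ (θ S′)))))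
theorem4p13 em 𝒥 J*⊆ _ S S-coSEP X θ θ-expresses =
  SortedSystems.WithPresystems.axiomatized em 𝒥 J*⊆ X θ θ-expresses S S-coSEP
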